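{- Let $(v_n)_{n\ge 0}$ be the integer sequence defined below. Then: 1. $v_n$ is odd for every $n\ge 1$. 2. For every integer $k\ge 1$ and every $l\ge 0$: $v_{lk+1}\equiv v_{lk+2} \pmod k$. 3. For every even $k\ge 2$ and every $l\ge 0$: $v_{lk+k/2+1}\equiv v_{lk+k/2+2}\pmod k$. 4. For every odd $k\ge 3$ and every $l\ge 0$: $v_{lk+(k+3)/2}\equiv 0\pmod k$. 5. For every prime $k$: $v_1\equiv v_2\equiv v_{k+1}\equiv v_{k+2}\equiv 1\pmod k$, and $v_{lk+1}\equiv v_{lk+2}\equiv -1 \pmod k$ for every $l$ with $2\le l\le k+1$. 6. For every prime $k>2$: $v_i\equiv 0\pmod k$ for all $i$ with $(k+3)/2\le i\le k$. 7. For every prime $k>2$: $v_{lk+i}\equiv 0\pmod k$ for all $l$ with $(k-1)/2\le l\le k$ and all $i$ with $(k+3)/2\le i\le k$. 8. For every $q\ge 1$, with $k=2^q$: $v_{lk+i}\equiv v_i\pmod{2^q}$ for all $l\ge 0$ and $1\le i\le 2^q$; moreover, for every odd integer $a$ there are exactly two indices $i\in\{1,\dots,2^q\}$ with $v_i\equiv a\pmod{2^q}$. 9. For every $q\ge 2$: $v_1\equiv v_2\equiv 1$, $v_{2^{q-1}}\equiv 2^{q-1}-1$, $v_{2^{q-1}+1}\equiv v_{2^{q-1}+2}\equiv 2^{q-1}+1$, and $v_{2^q}\equiv 2^q-1$, all modulo $2^q$. 10. For every $q\ge 2$ and every $a$ with $1\le a\le 2^{q-1}$: $v_{a+2^{q-1}}\equiv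 v_a+2^{q-1}\pmod{2^q}$.
   Context: For an integer $n\ge 1$ let $v_n=\Big[(1-x)\prod_{j=0}^{2n-3}(2n-3-j+jx)\Big]_{x^{n-1}}$, where $[f(x)]_{x^m}$ denotes the coefficient of $x^m$ in the polynomial $f$ (an empty product equals $1$, so $v_1=1$); additionally set $v_0=-1$. For $n\ge 2$, $v_n$ is the number of lines on a generic hypersurface of degree $2n-3$ in $\mathbb{P}^n$ ($v_2=1,v_3=27,v_4=2875,\dots$). The paper phrases these results via tables: for a modulus $k$, the entry in row $i$ ($1\le i\le k$) and column $l$ ($l\ge 0$) of the table is $v_{lk+i}\bmod k$; the statements above are written directly in terms of $v_n$. -}

module Defs where

open import Data.Nat as ℕ using (ℕ; zero; suc)
open import Data.Integer as ℤ using (ℤ; +_; _+_; _*_; _-_; -_)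
open import Data.Integer.Divisibility using (_∣_)
open import Data.List using (List; []; _∷_; map; foldr; upTo)

-- Polynomials with integer coefficients as coefficient lists,
-- lowest degree first.
Poly : Set
Poly = List ℤ

addP : Poly → Poly → Poly
addP [] q = q
addP p [] = p
addP (x ∷ p) (y ∷ q) = (x + y) ∷ addP p q

mulLin : ℤ → ℤ → Poly → Poly
mulLin a b p = addP (map (a *_) p) (+ 0 ∷ map (b *_) p)

coeff : Poly → ℕ → ℤ
coeff [] _ = + 0
coeff (c ∷ _) zero = c
coeff (_ ∷ p) (suc m) = coeff p m

-- For n = m + 1 (so 2n-3 = 2m-1): ∏_{j=0}^{2m-1} ((2m-1-j) + j·x).
-- For m = 0 this is the empty product 1.
prodPoly : ℕ → Poly
prodPoly m = foldr (λ j p → mulLin (+ ((2 ℕ.* m ℕ.∸ 1) ℕ.∸ j)) (+ j) p)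
                   (+ 1 ∷ []) (upTo (2 ℕ.* m))

-- v_0 = -1,  v_n = [ (1-x) ∏_{j=0}^{2n-3} (2n-3-j + j x) ]_{x^{n-1}}  for n ≥ 1
v : ℕ → ℤ
v zero = - (+ 1)
v (suc m) = coeff (mulLin (+ 1) (- (+ 1)) (prodPoly m)) m

_≡_[mod_] : ℤ → ℤ → ℕ → Set
a ≡ b [mod k ] = (+ k) ∣ (a - b)

infix 4 _≡_[mod_]

{-# OPTIONS --safe #-}
module Submission where

-- Put y = x - 1. The factors are N + j y with N = 2n - 3, so modulo k they depend on j mod k only, and a product over
-- many j is a power of the product G over one period times a short remainder. Parts 2-4 follow from the reflection
-- j ↦ -1 - j, which exchanges N = -1 and N = 1, and from the factor at j = 0.
--
-- Modulo 2h = 2^q, grouping the factors by fours shows that doubling the period squares G; hence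
-- G = x^h + h E with an explicit E, and lengthening the product from n to n + h adds h to v_n.
-- This is part 10, and parts 8 and 9 follow.
--
-- Modulo a prime p, G = N Φ with Φ = 1 - y^(p-1), by Lagrange's argument: ∏_{j<p} (1 + j x) is invariant under j ↦ j + 1.
-- As y Φ = x - x^p, coefficients of y Φ^a can be computed from (x^p - 1) y Φ^a = (x - x^p)^a y^(p+1-a) for a ≤ p + 1,
-- and from Φ^p = Φ(x^p) for a ≥ p.

open import Defs
import Algebra.Solver.Ring
open import Algebra.Bundles using (CommutativeRing)
open import Algebra.Solver.Ring.AlmostCommutativeRing using (fromCommutativeRing; _-Raw-AlmostCommutative⟶_)
open import Data.Empty using (⊥; ⊥-elim)
open import Data.Integer as ℤ using (ℤ; +_; -_)
import Data.Integer.DivMod as ℤ÷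
open import Data.Integer.Divisibility using (_∣_)
import Data.Integer.Divisibility.Signed as Signed
import Data.Integer.Properties as ℤₚ
open import Data.Integer.Solver using (module +-*-Solver)
open import Data.List using ([]; _∷_; map; foldr; applyUpTo)
open import Data.Maybe using (Maybe; just; nothing)
open import Data.Nat as ℕ using (ℕ; zero; suc; z≤n; s≤s)
import Data.Nat.DivMod as ℕ÷
import Data.Nat.Divisibility as ℕ∣
open import Data.Nat.Induction using (<-rec)
open import Data.Nat.Primality using (Prime; euclidsLemma; prime⇒irreducible; ¬prime[0]; ¬prime[1])
import Data.Nat.Properties as ℕₚ
open import Data.Nat.Solver renaming (module +-*-Solver to ℕ-Solver)
open import Data.Product using (Σ; ∃; _×_; _,_; proj₁; proj₂)
open import Data.Sum using (_⊎_; inj₁; inj₂; swap)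
open import Function using (_∘_; id)
open import Level using (0ℓ)
open import Relation.Binary using (Setoid; tri<; tri≈; tri>)
open import Relation.Binary.PropositionalEquality
  using (_≡_; _≢_; refl; sym; trans; cong; cong₂; subst; module ≡-Reasoning)
import Relation.Binary.Reasoning.Setoid as SetoidReasoning
open import Relation.Nullary using (¬_; yes; no)

-- Modulo 2h, moving j by h changes a factor by h y, and products of two or three consecutive
-- factors still change; four is the least number for which the derivative is even. Squaring then
-- gains a modulus: G modulo 2h determines G² modulo 4h. The cross term of (x^h + h E)² becomes the
-- next error term, and h² E² vanishes modulo 4h as soon as 4 divides h, so h = 2 and h = 4 have to
-- start the induction. The value v_h ≡ h - 1 modulo 2h looks like the shift of v_0 = -1, but the
-- shift is a statement about n ≥ 1. The obstacle to computing v_h directly is the factor 2 + x: its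
-- constant term is not a unit, so one cannot divide by it upwards. A downward recursion works,
-- since each step multiplies the unknown remainder by -2. For a prime p, 1 - x = -y is the reason
-- for studying y Φ^a, and y^p ≡ x^p - 1 turns division by y^p into a summation in steps of p. The
-- exponents that occur are 2l and 2l + 1, up to 2p + 2, whereas y^(p+1-a) only makes sense for a ≤
-- p + 1; hence the second method.

module LineNumbers where
  open import Data.Integer using (_+_; _*_; _-_)

  -- Integer power series and their Cauchy product.

  Series : Set
  Series = ℕ → ℤ

  infixl 6 _⊕_
  infixl 7 _⊛_ _·_

  -- Coefficient functions instead of the lists of `Poly`: lists that differ by trailing zeros
  -- represent one polynomial, whereas here the ring laws hold coefficient by coefficient.
  _⊕_ _⊛_ : Series → Series → Series
  (f ⊕ g) n = f n + g n
  (f ⊛ g) zero = f 0 * g 0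
  (f ⊛ g) (suc n) = f 0 * g (suc n) + ((f ∘ suc) ⊛ g) n

  _·_ : ℤ → Series → Series
  (c · f) n = c * f n

  ⊝_ : Series → Series
  (⊝ f) n = - f n

  lin : ℤ → ℤ → Series
  lin a b zero = a
  lin a b (suc zero) = b
  lin a b (suc (suc n)) = + 0

  const : ℤ → Series
  const c zero = c
  const c (suc n) = + 0

  infix 4 _≗_
  _≗_ : Series → Series → Set
  f ≗ g = ∀ n → f n ≡ g n

  ⊛-cong≗ : ∀ {f f′ g g′} → f ≗ f′ → g ≗ g′ → (f ⊛ g) ≗ (f′ ⊛ g′)
  ⊛-cong≗ p q zero = cong₂ _*_ (p 0) (q 0)
  ⊛-cong≗ p q (suc n) = cong₂ _+_ (cong₂ _*_ (p 0) (q (suc n))) (⊛-cong≗ (p ∘ suc) q n)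

  ⊛-distribʳ : ∀ h f g → ((f ⊕ g) ⊛ h) ≗ (f ⊛ h ⊕ g ⊛ h)
  ⊛-distribʳ h f g zero = ℤₚ.*-distribʳ-+ (h 0) (f 0) (g 0)
  ⊛-distribʳ h f g (suc n) = trans
    (cong (ℤ._+_ ((f 0 + g 0) * h (suc n))) (⊛-distribʳ h (f ∘ suc) (g ∘ suc) n))
    (let open +-*-Solver in solve 5 (λ a b c d e → (a :+ b) :* c :+ (d :+ e)
       := (a :* c :+ d) :+ (b :* c :+ e)) refl
       (f 0) (g 0) (h (suc n)) (((f ∘ suc) ⊛ h) n) (((g ∘ suc) ⊛ h) n))

  ⊛-scale : ∀ c f g → ((c · f) ⊛ g) ≗ (c · (f ⊛ g))
  ⊛-scale c f g zero = ℤₚ.*-assoc c (f 0) (g 0)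
  ⊛-scale c f g (suc n) = trans
    (cong (ℤ._+_ ((c * f 0) * g (suc n))) (⊛-scale c (f ∘ suc) g n))
    (let open +-*-Solver in solve 4 (λ c a b d → (c :* a) :* b :+ c :* d := c :* (a :* b :+ d)) refl
       c (f 0) (g (suc n)) (((f ∘ suc) ⊛ g) n))

  ⊛-assoc : ∀ f g h → ((f ⊛ g) ⊛ h) ≗ (f ⊛ (g ⊛ h))
  ⊛-assoc f g h zero = ℤₚ.*-assoc (f 0) (g 0) (h 0)
  ⊛-assoc f g h (suc n) = begin
    (f 0 * g 0) * h (suc n) + ((f 0 · (g ∘ suc) ⊕ (f ∘ suc) ⊛ g) ⊛ h) n
      ≡⟨ cong (ℤ._+_ ((f 0 * g 0) * h (suc n))) (begin
        ((f 0 · (g ∘ suc) ⊕ (f ∘ suc) ⊛ g) ⊛ h) n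
          ≡⟨ ⊛-distribʳ h (f 0 · (g ∘ suc)) ((f ∘ suc) ⊛ g) n ⟩
        ((f 0 · (g ∘ suc)) ⊛ h) n + (((f ∘ suc) ⊛ g) ⊛ h) n
          ≡⟨ cong₂ _+_ (⊛-scale (f 0) (g ∘ suc) h n) (⊛-assoc (f ∘ suc) g h n) ⟩
        f 0 * ((g ∘ suc) ⊛ h) n + ((f ∘ suc) ⊛ (g ⊛ h)) n ∎) ⟩
    (f 0 * g 0) * h (suc n) + (f 0 * ((g ∘ suc) ⊛ h) n + ((f ∘ suc) ⊛ (g ⊛ h)) n)
      ≡⟨ (let open +-*-Solver in solve 5 (λ a b c d e → (a :* b) :* c :+ (a :* d :+ e)
           := a :* (b :* c :+ d) :+ e) refl
           (f 0) (g 0) (h (suc n)) (((g ∘ suc) ⊛ h) n) (((f ∘ suc) ⊛ (g ⊛ h)) n)) ⟩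
    f 0 * (g 0 * h (suc n) + ((g ∘ suc) ⊛ h) n) + ((f ∘ suc) ⊛ (g ⊛ h)) n ∎
    where open ≡-Reasoning

  -- The recursion of `⊛` peels the lowest coefficient off the left factor; commutativity needs the
  -- same for the right factor.
  ⊛-snoc : ∀ f g n → (f ⊛ g) (suc n) ≡ (f ⊛ (g ∘ suc)) n + f (suc n) * g 0
  ⊛-snoc f g zero = refl
  ⊛-snoc f g (suc n) = trans (cong (ℤ._+_ (f 0 * g (suc (suc n)))) (⊛-snoc (f ∘ suc) g n))
    (sym (ℤₚ.+-assoc (f 0 * g (suc (suc n))) (((f ∘ suc) ⊛ (g ∘ suc)) n) (f (suc (suc n)) * g 0)))

  ⊛-comm : ∀ f g → (f ⊛ g) ≗ (g ⊛ f)
  ⊛-comm f g zero = ℤₚ.*-comm (f 0) (g 0)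
  ⊛-comm f g (suc n) = begin
    f 0 * g (suc n) + ((f ∘ suc) ⊛ g) n  ≡⟨ cong₂ _+_ (ℤₚ.*-comm (f 0) (g (suc n))) (⊛-comm (f ∘ suc) g n) ⟩
    g (suc n) * f 0 + (g ⊛ (f ∘ suc)) n  ≡⟨ ℤₚ.+-comm (g (suc n) * f 0) _ ⟩
    (g ⊛ (f ∘ suc)) n + g (suc n) * f 0  ≡⟨ ⊛-snoc g f n ⟨
    (g ⊛ f) (suc n) ∎
    where open ≡-Reasoning

  zero-⊛ : ∀ f g → (∀ n → f n ≡ + 0) → ∀ n → (f ⊛ g) n ≡ + 0
  zero-⊛ f g p zero = trans (cong (_* g 0) (p 0)) (ℤₚ.*-zeroˡ (g 0))
  zero-⊛ f g p (suc n) = cong₂ _+_ (trans (cong (_* g (suc n)) (p 0)) (ℤₚ.*-zeroˡ (g (suc n)))) (zero-⊛ (f ∘ suc) g (p ∘ suc) n)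

  const-⊛ : ∀ c f n → (const c ⊛ f) n ≡ c * f n
  const-⊛ c f zero = refl
  const-⊛ c f (suc n) = trans (cong (ℤ._+_ (c * f (suc n))) (zero-⊛ _ f (λ _ → refl) n)) (ℤₚ.+-identityʳ _)

  lin-⊛ : ∀ a b f n → (lin a b ⊛ f) (suc n) ≡ a * f (suc n) + b * f n
  lin-⊛ a b f n = cong (ℤ._+_ (a * f (suc n))) (trans (⊛-cong≗ {lin a b ∘ suc} {const b} {f} (λ { zero → refl ; (suc _) → refl }) (λ _ → refl) n) (const-⊛ b f n))

  X : Series
  X = lin (+ 0) (+ 1)

  X-⊛ : ∀ f n → (X ⊛ f) (suc n) ≡ f n
  X-⊛ f n = trans (lin-⊛ (+ 0) (+ 1) f n) (trans (cong₂ _+_ (ℤₚ.*-zeroˡ (f (suc n))) (ℤₚ.*-identityˡ (f n))) (ℤₚ.+-identityˡ (f n)))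

  infixr 8 _^_
  _^_ : Series → ℕ → Series
  f ^ zero = const (+ 1)
  f ^ suc n = f ⊛ f ^ n

  -- Congruences modulo k and the ring of series modulo k.

  module Mod (k : ℕ) where

    infix 4 _≋_ _≈_

    -- Unlike a ≡ b [mod k ], whose unfolding hides a and b, this form lets Agda infer its arguments.
    data _≋_ : ℤ → ℤ → Set where
      by : ∀ {a b} t → a ≡ b + t * + k → a ≋ b

    ≋⇒mod : ∀ {a b} → a ≋ b → a ≡ b [mod k ]
    ≋⇒mod {b = b} (by t refl) = Signed.∣⇒∣ᵤ (Signed.divides t
      (let open +-*-Solver in solve 2 (λ b x → (b :+ x) :- b := x) refl b (t * + k)))

    mod⇒≋ : ∀ {a b} → a ≡ b [mod k ] → a ≋ b
    mod⇒≋ {a} {b} p with Signed.∣ᵤ⇒∣ {+ k} {a - b} p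
    ... | Signed.divides t eq = by t (trans
      (let open +-*-Solver in solve 2 (λ a b → a := b :+ (a :- b)) refl a b) (cong (ℤ._+_ b) eq))

    ≡⇒≋ : ∀ {a b} → a ≡ b → a ≋ b
    ≡⇒≋ {a} refl = by (+ 0) (sym (ℤₚ.+-identityʳ a))

    ≋-refl : ∀ {a} → a ≋ a
    ≋-refl = ≡⇒≋ refl

    ≋-sym : ∀ {a b} → a ≋ b → b ≋ a
    ≋-sym {b = b} (by t refl) = by (- t)
      (let open +-*-Solver in solve 3 (λ b t k → b := (b :+ t :* k) :+ (:- t) :* k) refl b t (+ k))

    ≋-trans : ∀ {a b c} → a ≋ b → b ≋ c → a ≋ c
    ≋-trans {c = c} (by t refl) (by s refl) = by (s + t)
      (let open +-*-Solver in
       solve 4 (λ c s t k → (c :+ s :* k) :+ t :* k := c :+ (s :+ t) :* k) refl c s t (+ k))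

    +-cong≋ : ∀ {a b c d} → a ≋ b → c ≋ d → a + c ≋ b + d
    +-cong≋ {b = b} {d = d} (by s refl) (by t refl) = by (s + t)
      (let open +-*-Solver in
       solve 5 (λ b d s t k → (b :+ s :* k) :+ (d :+ t :* k) := (b :+ d) :+ (s :+ t) :* k) refl b d s t (+ k))

    *-cong≋ : ∀ {a b c d} → a ≋ b → c ≋ d → a * c ≋ b * d
    *-cong≋ {b = b} {d = d} (by s refl) (by t refl) = by (s * d + t * b + s * t * + k)
      (let open +-*-Solver in
       solve 5 (λ b d s t k → (b :+ s :* k) :* (d :+ t :* k)
         := b :* d :+ (s :* d :+ t :* b :+ s :* t :* k) :* k) refl b d s t (+ k))

    neg-cong≋ : ∀ {a b} → a ≋ b → - a ≋ - b
    neg-cong≋ {b = b} (by t refl) = by (- t)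
      (let open +-*-Solver in solve 3 (λ b t k → :- (b :+ t :* k) := :- b :+ (:- t) :* k) refl b t (+ k))

    ≋-setoid : Setoid 0ℓ 0ℓ
    ≋-setoid = record { Carrier = ℤ ; _≈_ = _≋_ ; isEquivalence = record { refl = ≋-refl ; sym = ≋-sym ; trans = ≋-trans } }

    record _≈_ (f g : Series) : Set where
      constructor ⟪_⟫
      field at : ∀ n → f n ≋ g n
    open _≈_ public

    exact : ∀ {f g} → f ≗ g → f ≈ g
    exact p = ⟪ (λ n → ≡⇒≋ (p n)) ⟫

    ⊛-cong : ∀ {f f′ g g′} → f ≈ f′ → g ≈ g′ → (f ⊛ g) ≈ (f′ ⊛ g′)
    ⊛-cong ⟪ p ⟫ ⟪ q ⟫ = ⟪ go p q ⟫
      where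
      go : ∀ {f f′ g g′} → (∀ n → f n ≋ f′ n) → (∀ n → g n ≋ g′ n) → ∀ n → (f ⊛ g) n ≋ (f′ ⊛ g′) n
      go p q zero = *-cong≋ (p 0) (q 0)
      go p q (suc n) = +-cong≋ (*-cong≋ (p 0) (q (suc n))) (go (p ∘ suc) q n)

    seriesRing : CommutativeRing 0ℓ 0ℓ
    seriesRing = record
      { Carrier = Series ; _≈_ = _≈_ ; _+_ = _⊕_ ; _*_ = _⊛_ ; -_ = ⊝_
      ; 0# = const (+ 0) ; 1# = const (+ 1)
      ; isCommutativeRing = record
        { isRing = record
          { +-isAbelianGroup = record
            { isGroup = record
              { isMonoid = record
                { isSemigroup = record
                  { isMagma = record
                    { isEquivalence = record
                      { refl = λ {f} → exact {f} {f} (λ _ → refl)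
                      ; sym = λ {f} {g} p → ⟪ (λ n → ≋-sym (at p n)) ⟫
                      ; trans = λ {f} {g} {h} p q → ⟪ (λ n → ≋-trans (at p n) (at q n)) ⟫ }
                    ; ∙-cong = λ {f} {f′} {g} {g′} p q → ⟪ (λ n → +-cong≋ (at p n) (at q n)) ⟫ }
                  ; assoc = λ f g h → exact (λ n → ℤₚ.+-assoc (f n) (g n) (h n)) }
                ; identity = (λ f → exact (λ { zero → ℤₚ.+-identityˡ _ ; (suc n) → ℤₚ.+-identityˡ _ }))
                           , (λ f → exact (λ { zero → ℤₚ.+-identityʳ _ ; (suc n) → ℤₚ.+-identityʳ _ })) }
              ; inverse = (λ f → exact (λ { zero → ℤₚ.+-inverseˡ (f 0) ; (suc n) → ℤₚ.+-inverseˡ (f (suc n)) }))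
                        , (λ f → exact (λ { zero → ℤₚ.+-inverseʳ (f 0) ; (suc n) → ℤₚ.+-inverseʳ (f (suc n)) }))
              ; ⁻¹-cong = λ {f} {g} p → ⟪ (λ n → neg-cong≋ (at p n)) ⟫ }
            ; comm = λ f g → exact (λ n → ℤₚ.+-comm (f n) (g n)) }
          ; *-cong = ⊛-cong
          ; *-assoc = λ f g h → exact (⊛-assoc f g h)
          ; *-identity = (λ f → exact (λ n → trans (const-⊛ (+ 1) f n) (ℤₚ.*-identityˡ (f n))))
                       , (λ f → exact (λ n → trans (⊛-comm f (const (+ 1)) n) (trans (const-⊛ (+ 1) f n) (ℤₚ.*-identityˡ (f n)))))
          ; distrib = (λ f g h → exact (λ n → trans (⊛-comm f (g ⊕ h) n)
                         (trans (⊛-distribʳ f g h n) (cong₂ _+_ (⊛-comm g f n) (⊛-comm h f n)))))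
                    , (λ f g h → exact (⊛-distribʳ f g h)) }
        ; *-comm = λ f g → exact (⊛-comm f g) } }

    open CommutativeRing seriesRing public
      using (setoid; +-cong; *-comm; *-assoc; *-cong; *-congˡ; *-congʳ; +-congˡ; +-congʳ)
      renaming (refl to ≈-refl; sym to ≈-sym; trans to ≈-trans; reflexive to ≈-reflexive; -‿cong to ⊝-cong
        ; *-identityˡ to ⊛-identityˡ; *-identityʳ to ⊛-identityʳ)

    ^-congˡ : ∀ n {f g} → f ≈ g → f ^ n ≈ g ^ n
    ^-congˡ zero p = ≈-refl
    ^-congˡ (suc n) p = ⊛-cong p (^-congˡ n p)

    ^-congʳ : ∀ f {m n} → m ≡ n → f ^ m ≈ f ^ n
    ^-congʳ f refl = ≈-refl

    ^-homo-* : ∀ f m n → f ^ (m ℕ.+ n) ≈ f ^ m ⊛ f ^ n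
    ^-homo-* f zero n = ≈-sym (⊛-identityˡ (f ^ n))
    ^-homo-* f (suc m) n = ≈-trans (*-congˡ {x = f} (^-homo-* f m n)) (≈-sym (*-assoc f (f ^ m) (f ^ n)))

    ^-assocʳ : ∀ f m n → (f ^ m) ^ n ≈ f ^ (m ℕ.* n)
    ^-assocʳ f m zero = ^-congʳ f (sym (ℕₚ.*-zeroʳ m))
    ^-assocʳ f m (suc n) = ≈-trans (*-congˡ {x = f ^ m} (^-assocʳ f m n))
      (≈-trans (≈-sym (^-homo-* f m (m ℕ.* n))) (^-congʳ f (sym (ℕₚ.*-suc m n))))

    const-cong : ∀ {a b} → a ≋ b → const a ≈ const b
    const-cong p = ⟪ (λ { zero → p ; (suc n) → ≋-refl }) ⟫

    const-+ : ∀ a b → const (a + b) ≈ const a ⊕ const b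
    const-+ a b = exact (λ { zero → refl ; (suc n) → refl })

    const-* : ∀ a b → const (a * b) ≈ const a ⊛ const b
    const-* a b = exact (λ n → sym (trans (const-⊛ a (const b) n) (go n)))
      where
      go : ∀ n → a * const b n ≡ const (a * b) n
      go zero = refl
      go (suc n) = ℤₚ.*-zeroʳ a

    -- Makes integers the coefficients of the solver, which therefore normalises over ℤ; facts such
    -- as 2h ≡ 0 are applied in separate steps.
    const-homomorphism : ℤ.+-*-rawRing -Raw-AlmostCommutative⟶ fromCommutativeRing seriesRing
    const-homomorphism = record
      { ⟦_⟧ = const
      ; +-homo = const-+
      ; *-homo = const-*
      ; -‿homo = λ a → exact (λ { zero → refl ; (suc n) → refl })
      ; 0-homo = ≈-refl
      ; 1-homo = ≈-refl }

    private
      const-≟ : ∀ a b → Maybe (const a ≈ const b)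
      const-≟ a b with a ℤ.≟ b
      ... | yes refl = just ≈-refl
      ... | no _ = nothing

    module Solver = Algebra.Solver.Ring ℤ.+-*-rawRing (fromCommutativeRing seriesRing) const-homomorphism const-≟

    ^-distrib-* : ∀ f g n → (f ⊛ g) ^ n ≈ f ^ n ⊛ g ^ n
    ^-distrib-* f g zero = ≈-sym (⊛-identityˡ (const (+ 1)))
    ^-distrib-* f g (suc n) = ≈-trans (*-congˡ {x = f ⊛ g} (^-distrib-* f g n))
      (let open Solver in solve 4 (λ f g F G → (f :* g) :* (F :* G) := (f :* F) :* (g :* G)) ≈-refl f g (f ^ n) (g ^ n))

  -- From coefficient lists to series, and products of linear factors.

  coeff-addP : ∀ p q n → coeff (addP p q) n ≡ coeff p n + coeff q n
  coeff-addP [] q n = sym (ℤₚ.+-identityˡ _)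
  coeff-addP (x ∷ p) [] n = sym (ℤₚ.+-identityʳ _)
  coeff-addP (x ∷ p) (y ∷ q) zero = refl
  coeff-addP (x ∷ p) (y ∷ q) (suc n) = coeff-addP p q n

  coeff-map : ∀ a p n → coeff (map (a *_) p) n ≡ a * coeff p n
  coeff-map a [] n = sym (ℤₚ.*-zeroʳ a)
  coeff-map a (x ∷ p) zero = refl
  coeff-map a (x ∷ p) (suc n) = coeff-map a p n

  coeff-mulLin : ∀ a b p → coeff (mulLin a b p) ≗ lin a b ⊛ coeff p
  coeff-mulLin a b p zero = trans (coeff-addP (map (a *_) p) _ 0)
    (trans (ℤₚ.+-identityʳ _) (coeff-map a p 0))
  coeff-mulLin a b p (suc n) = trans (coeff-addP (map (a *_) p) _ (suc n))
    (trans (cong₂ _+_ (coeff-map a p (suc n)) (coeff-map b p n)) (sym (lin-⊛ a b (coeff p) n)))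

  prod : (ℕ → Series) → ℕ → Series
  prod g zero = const (+ 1)
  prod g (suc n) = g 0 ⊛ prod (g ∘ suc) n

  factor : ℤ → ℕ → Series
  factor N j = lin (N - + j) (+ j)

  factors : ℤ → ℕ → Series
  factors N = prod (factor N)

  1-X : Series
  1-X = lin (+ 1) (- + 1)

  module Products (k : ℕ) where
    open Mod k public

    module ≈-Reasoning = SetoidReasoning setoid
    module ≋-Reasoning = SetoidReasoning ≋-setoid

    prod-cong : ∀ {g h} n → (∀ j → j ℕ.< n → g j ≈ h j) → prod g n ≈ prod h n
    prod-cong zero p = ≈-refl
    prod-cong (suc n) p = ⊛-cong (p 0 (s≤s z≤n)) (prod-cong n (λ j j<n → p (suc j) (s≤s j<n)))

    prod-+ : ∀ g m n → prod g (m ℕ.+ n) ≈ prod g m ⊛ prod (λ j → g (m ℕ.+ j)) n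
    prod-+ g zero n = ≈-sym (⊛-identityˡ _)
    prod-+ g (suc m) n = ≈-trans (*-congˡ {x = g 0} (prod-+ (g ∘ suc) m n)) (≈-sym (*-assoc (g 0) (prod (g ∘ suc) m) _))

    prod-snoc : ∀ g n → prod g (suc n) ≈ prod g n ⊛ g n
    prod-snoc g zero = *-comm (g 0) (const (+ 1))
    prod-snoc g (suc n) = ≈-trans (*-congˡ {x = g 0} (prod-snoc (g ∘ suc) n)) (≈-sym (*-assoc (g 0) (prod (g ∘ suc) n) _))

    prod-reverse : ∀ g n → prod (λ j → g (n ℕ.∸ suc j)) n ≈ prod g n
    prod-reverse g zero = ≈-refl
    prod-reverse g (suc n) = begin
      g n ⊛ prod (λ j → g (n ℕ.∸ suc j)) n  ≈⟨ *-congˡ {x = g n} (prod-reverse g n) ⟩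
      g n ⊛ prod g n                        ≈⟨ *-comm (g n) (prod g n) ⟩
      prod g n ⊛ g n                        ≈⟨ prod-snoc g n ⟨
      prod g (suc n) ∎
      where open ≈-Reasoning

    -- The factor that enters equals the factor that leaves, so a product over a period may start at
    -- 1 instead of 0.
    prod-rotate : ∀ g n → g n ≈ g 0 → prod (g ∘ suc) n ≈ prod g n
    prod-rotate g zero p = ≈-refl
    prod-rotate g (suc n) p = begin
      prod (g ∘ suc) (suc n)           ≈⟨ prod-snoc (g ∘ suc) n ⟩
      prod (g ∘ suc) n ⊛ g (suc n)     ≈⟨ *-congˡ {x = prod (g ∘ suc) n} p ⟩
      prod (g ∘ suc) n ⊛ g 0           ≈⟨ *-comm (prod (g ∘ suc) n) (g 0) ⟩
      prod g (suc n) ∎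
      where open ≈-Reasoning

    prod-scale : ∀ c g n → prod (λ j → c ⊛ g j) n ≈ c ^ n ⊛ prod g n
    prod-scale c g zero = ≈-sym (⊛-identityˡ _)
    prod-scale c g (suc n) = ≈-trans (*-congˡ {x = c ⊛ g 0} (prod-scale c (g ∘ suc) n))
      (let open Solver in solve 4 (λ c g cn p → (c :* g) :* (cn :* p) := (c :* cn) :* (g :* p))
         ≈-refl c (g 0) (c ^ n) (prod (g ∘ suc) n))

    prod-blocks : ∀ g r c → (∀ j → g (r ℕ.+ j) ≈ g j) → ∀ s → prod g (c ℕ.* r ℕ.+ s) ≈ prod g r ^ c ⊛ prod g s
    prod-blocks g r zero p s = ≈-sym (⊛-identityˡ _)
    prod-blocks g r (suc c) p s = begin
      prod g (r ℕ.+ c ℕ.* r ℕ.+ s)                       ≡⟨ cong (prod g) (ℕₚ.+-assoc r (c ℕ.* r) s) ⟩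
      prod g (r ℕ.+ (c ℕ.* r ℕ.+ s))                     ≈⟨ prod-+ g r (c ℕ.* r ℕ.+ s) ⟩
      prod g r ⊛ prod (λ j → g (r ℕ.+ j)) (c ℕ.* r ℕ.+ s) ≈⟨ *-congˡ {x = prod g r} (prod-cong (c ℕ.* r ℕ.+ s) (λ j _ → p j)) ⟩
      prod g r ⊛ prod g (c ℕ.* r ℕ.+ s)                   ≈⟨ *-congˡ {x = prod g r} (prod-blocks g r c p s) ⟩
      prod g r ⊛ (prod g r ^ c ⊛ prod g s)               ≈⟨ *-assoc (prod g r) (prod g r ^ c) (prod g s) ⟨
      prod g r ^ suc c ⊛ prod g s ∎
      where open ≈-Reasoning

    lin-cong : ∀ {a b c d} → a ≋ c → b ≋ d → lin a b ≈ lin c d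
    lin-cong p q = ⟪ (λ { zero → p ; (suc zero) → q ; (suc (suc n)) → ≋-refl }) ⟫

    +k≋0 : + k ≋ + 0
    +k≋0 = by (+ 1) (sym (trans (ℤₚ.+-identityˡ _) (ℤₚ.*-identityˡ _)))

    factor-cong : ∀ {M N i j} → M ≋ N → + i ≋ + j → factor M i ≈ factor N j
    factor-cong p q = lin-cong (+-cong≋ p (neg-cong≋ q)) q

    factors-cong : ∀ {M N} n → M ≋ N → factors M n ≈ factors N n
    factors-cong n p = prod-cong n (λ j _ → factor-cong p ≋-refl)

    k+≋ : ∀ j → + (k ℕ.+ j) ≋ + j
    k+≋ j = ≋-trans (≡⇒≋ (ℤₚ.pos-+ k j)) (≋-trans (+-cong≋ +k≋0 (≋-refl {+ j})) (≡⇒≋ (ℤₚ.+-identityˡ (+ j))))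

    factors-blocks : ∀ N c s → factors N (c ℕ.* k ℕ.+ s) ≈ factors N k ^ c ⊛ factors N s
    factors-blocks N c s = prod-blocks (factor N) k c (λ j → factor-cong (≋-refl {N}) (k+≋ j)) s

    private
      foldr-prod : ∀ (a b : ℕ → ℤ) (f : ℕ → ℕ) n →
        coeff (foldr (λ j p → mulLin (a j) (b j) p) (+ 1 ∷ []) (applyUpTo f n)) ≈ prod (λ j → lin (a (f j)) (b (f j))) n
      foldr-prod a b f zero = exact (λ { zero → refl ; (suc n) → refl })
      foldr-prod a b f (suc n) = ≈-trans
        (exact (coeff-mulLin (a (f 0)) (b (f 0)) (foldr (λ j p → mulLin (a j) (b j) p) (+ 1 ∷ []) (applyUpTo (f ∘ suc) n))))
        (*-congˡ {x = lin (a (f 0)) (b (f 0))} (foldr-prod a b (f ∘ suc) n))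

      ∸-pos : ∀ m j → j ℕ.< m → + ((m ℕ.∸ 1) ℕ.∸ j) ≡ (+ m - + 1) - + j
      ∸-pos (suc m) j (s≤s j≤m) = trans (sym (ℤₚ.⊖-≥ j≤m)) (trans (sym (ℤₚ.[+m]-[+n]≡m⊖n m j))
        (cong (_- + j) (let open +-*-Solver in solve 1 (λ m → m := (con (+ 1) :+ m) :- con (+ 1)) refl (+ m))))

    -- N is the integer 2m - 1. At m = 0 it differs from the truncated `2m ∸ 1`, but there the
    -- product is empty.
    v-coeff : ∀ m → v (suc m) ≋ (1-X ⊛ factors (+ (2 ℕ.* m) - + 1) (2 ℕ.* m)) m
    v-coeff m = ≋-trans (≡⇒≋ (coeff-mulLin (+ 1) (- + 1) (prodPoly m) m))
      (at (*-congˡ {x = 1-X} (≈-trans (foldr-prod _ +_ id (2 ℕ.* m))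
        (prod-cong (2 ℕ.* m) (λ j j<2m → lin-cong (≡⇒≋ (∸-pos (2 ℕ.* m) j j<2m)) ≋-refl)))) m)

  -- Coefficient extraction, reflection of the factors, and the factor at j = 0.

  Y : Series
  Y = lin (- + 1) (+ 1)

  module Values (k : ℕ) where
    open Products k public

    X^-⊛ : ∀ n f m → (X ^ n ⊛ f) (n ℕ.+ m) ≋ f m
    X^-⊛ zero f m = at (⊛-identityˡ f) m
    X^-⊛ (suc n) f m = ≋-trans (at (*-assoc X (X ^ n) f) (suc n ℕ.+ m))
      (≋-trans (≡⇒≋ (X-⊛ (X ^ n ⊛ f) (n ℕ.+ m))) (X^-⊛ n f m))

    X^-⊛-low : ∀ n f m → m ℕ.< n → (X ^ n ⊛ f) m ≋ + 0
    X^-⊛-low (suc n) f zero p = ≋-trans (at (*-assoc X (X ^ n) f) 0) (≡⇒≋ (ℤₚ.*-zeroˡ ((X ^ n ⊛ f) 0)))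
    X^-⊛-low (suc n) f (suc m) (s≤s p) = ≋-trans (at (*-assoc X (X ^ n) f) (suc m))
      (≋-trans (≡⇒≋ (X-⊛ (X ^ n ⊛ f) m)) (X^-⊛-low n f m p))

    1^n≈1 : ∀ n → const (+ 1) ^ n ≈ const (+ 1)
    1^n≈1 zero = ≈-refl
    1^n≈1 (suc n) = ≈-trans (⊛-identityˡ _) (1^n≈1 n)

    lin≈ : ∀ a b → lin a b ≈ const a ⊕ const b ⊛ X
    lin≈ a b = exact λ
      { zero → sym (trans (cong (ℤ._+_ a) (ℤₚ.*-zeroʳ b)) (ℤₚ.+-identityʳ a))
      ; (suc zero) → sym (trans (ℤₚ.+-identityˡ _) (trans (const-⊛ b X 1) (ℤₚ.*-identityʳ b)))
      ; (suc (suc n)) → sym (trans (ℤₚ.+-identityˡ _) (trans (const-⊛ b X (suc (suc n))) (ℤₚ.*-zeroʳ b))) }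

    factor≈ : ∀ N j → factor N j ≈ const N ⊕ const (+ j) ⊛ Y
    factor≈ N j = begin
      lin (N - + j) (+ j)                          ≈⟨ lin≈ (N - + j) (+ j) ⟩
      const (N - + j) ⊕ const (+ j) ⊛ X            ≈⟨ +-congʳ {x = const (+ j) ⊛ X} (exact split) ⟩
      (const N ⊕ ⊝ const (+ j)) ⊕ const (+ j) ⊛ X
        ≈⟨ (let open Solver in solve 3 (λ N j X → (N :+ :- j) :+ j :* X := N :+ j :* (con (- + 1) :+ con (+ 1) :* X))
              ≈-refl (const N) (const (+ j)) X) ⟩
      const N ⊕ const (+ j) ⊛ (const (- + 1) ⊕ const (+ 1) ⊛ X)
        ≈⟨ +-congˡ {x = const N} (*-congˡ {x = const (+ j)} (lin≈ (- + 1) (+ 1))) ⟨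
      const N ⊕ const (+ j) ⊛ Y ∎
      where
      open ≈-Reasoning
      split : const (N - + j) ≗ const N ⊕ ⊝ const (+ j)
      split zero = refl
      split (suc n) = refl

    factors-1-2 : factors (+ 1) 2 ≈ X
    factors-1-2 = ≈-trans (*-cong (lin-const (+ 1)) (≈-trans (⊛-identityʳ _) ≈-refl)) (⊛-identityˡ X)
      where
      lin-const : ∀ a → lin a (+ 0) ≈ const a
      lin-const a = exact (λ { zero → refl ; (suc zero) → refl ; (suc (suc n)) → refl })

    factors-zero : ∀ {N} n → N ≋ + 0 → factors N (suc n) ≈ const (+ 0)
    factors-zero {N} n p = ≈-trans (*-congʳ {x = prod (factor N ∘ suc) n} zero-factor)
        (let open Solver in solve 1 (λ a → con (+ 0) :* a := con (+ 0)) ≈-refl (prod (factor N ∘ suc) n))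
      where
      zero-factor : factor N 0 ≈ const (+ 0)
      zero-factor = ⟪ (λ { zero → ≋-trans (≡⇒≋ (ℤₚ.+-identityʳ N)) p ; (suc zero) → ≋-refl ; (suc (suc n)) → ≋-refl }) ⟫

    v-coeff′ : ∀ m {N} c → 2 ℕ.* m ≡ c → + c - + 1 ≋ N → v (suc m) ≋ (1-X ⊛ factors N c) m
    v-coeff′ m c refl p = ≋-trans (v-coeff m) (at (*-congˡ {x = 1-X} (factors-cong c p)) m)

    plus-zero : ∀ {a} → a ≋ + 0 → ∀ b → a + b ≋ b
    plus-zero p b = ≋-trans (+-cong≋ p (≋-refl {b})) (≡⇒≋ (ℤₚ.+-identityˡ b))

    multiple≋0 : ∀ c → + (c ℕ.* k) ≋ + 0
    multiple≋0 c = by (+ c) (trans (ℤₚ.pos-* c k) (sym (ℤₚ.+-identityˡ _)))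

    -- j ↦ k - 1 - j turns a factor for N = -1 into the negative of a factor for N = 1.
    factors-neg : factors (- + 1) k ≈ const (- + 1) ^ k ⊛ factors (+ 1) k
    factors-neg = begin
      factors (- + 1) k                                        ≈⟨ prod-reverse (factor (- + 1)) k ⟨
      prod (λ j → factor (- + 1) (k ℕ.∸ suc j)) k              ≈⟨ prod-cong k reflect ⟩
      prod (λ j → const (- + 1) ⊛ factor (+ 1) (suc j)) k      ≈⟨ prod-scale (const (- + 1)) (factor (+ 1) ∘ suc) k ⟩
      const (- + 1) ^ k ⊛ prod (factor (+ 1) ∘ suc) k
        ≈⟨ *-congˡ {x = const (- + 1) ^ k} (prod-rotate (factor (+ 1)) k (factor-cong (≋-refl {+ 1}) +k≋0)) ⟩
      const (- + 1) ^ k ⊛ factors (+ 1) k ∎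
      where
      open ≈-Reasoning
      const-lin : ∀ c a b → const c ⊛ lin a b ≈ lin (c * a) (c * b)
      const-lin c a b = exact (λ n → trans (const-⊛ c (lin a b) n) (go n))
        where
        go : ∀ n → c * lin a b n ≡ lin (c * a) (c * b) n
        go zero = refl
        go (suc zero) = refl
        go (suc (suc n)) = ℤₚ.*-zeroʳ c
      negate : ∀ j → j ℕ.< k → + (k ℕ.∸ suc j) ≋ - + 1 * + suc j
      negate j j<k = by (+ 1) (trans (trans (sym (ℤₚ.⊖-≥ j<k)) (sym (ℤₚ.[+m]-[+n]≡m⊖n k (suc j))))
        (let open +-*-Solver in solve 2 (λ k s → k :- s := con (- + 1) :* s :+ con (+ 1) :* k) refl (+ k) (+ suc j)))
      reflect : ∀ j → j ℕ.< k → factor (- + 1) (k ℕ.∸ suc j) ≈ const (- + 1) ⊛ factor (+ 1) (suc j)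
      reflect j j<k = ≈-trans (lin-cong (≋-trans (+-cong≋ (≋-refl { - + 1}) (neg-cong≋ (negate j j<k)))
          (≡⇒≋ (let open +-*-Solver in solve 1 (λ s → con (- + 1) :- (con (- + 1) :* s) := con (- + 1) :* (con (+ 1) :- s)) refl (+ suc j))))
          (negate j j<k))
        (≈-sym (const-lin (- + 1) (+ 1 - + suc j) (+ suc j)))

    -1^even : ∀ m → const (- + 1) ^ (2 ℕ.* m) ≈ const (+ 1)
    -1^even m = ≈-trans (≈-sym (^-assocʳ (const (- + 1)) 2 m))
      (≈-trans (^-congˡ m (let open Solver in solve 0 (con (- + 1) :^ 2 := con (+ 1)) ≈-refl)) (1^n≈1 m))

    -- With ck factors N ≡ -1, with two more N ≡ 1. Reflection identifies the full periods up to the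
    -- sign (-1)^(ck), which is 1 because ck = 2m. The two extra factors, at j = 0 and 1, multiply
    -- to x, and this x accounts for the step from coefficient m to m + 1.
    v-consecutive : ∀ m c → 2 ℕ.* m ≡ c ℕ.* k → v (suc m) ≋ v (suc (suc m))
    v-consecutive m c eq = begin
      v (suc m)                        ≈⟨ v-coeff′ m (c ℕ.* k ℕ.+ 0) (trans eq (sym (ℕₚ.+-identityʳ _))) (plus-zero ck≋0 (- + 1)) ⟩
      (1-X ⊛ factors (- + 1) (c ℕ.* k ℕ.+ 0)) m ≈⟨ at (*-congˡ {x = 1-X} P) m ⟩
      (1-X ⊛ F) m                      ≈⟨ ≡⇒≋ (X-⊛ (1-X ⊛ F) m) ⟨
      (X ⊛ (1-X ⊛ F)) (suc m)
        ≈⟨ at (let open Solver in solve 3 (λ X Z F → X :* (Z :* F) := Z :* (F :* X)) ≈-refl X 1-X F) (suc m) ⟩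
      (1-X ⊛ (F ⊛ X)) (suc m)          ≈⟨ at (*-congˡ {x = 1-X} P′) (suc m) ⟨
      (1-X ⊛ factors (+ 1) (c ℕ.* k ℕ.+ 2)) (suc m)
        ≈⟨ v-coeff′ (suc m) (c ℕ.* k ℕ.+ 2) count
             (≋-trans (≡⇒≋ (cong (_- + 1) (ℤₚ.pos-+ (c ℕ.* k) 2))) (≋-trans (≡⇒≋ (ℤₚ.+-assoc (+ (c ℕ.* k)) (+ 2) (- + 1))) (plus-zero (multiple≋0 c) (+ 1)))) ⟨
      v (suc (suc m)) ∎
      where
      open ≋-Reasoning
      F = factors (+ 1) k ^ c
      count : 2 ℕ.* suc m ≡ c ℕ.* k ℕ.+ 2
      count = trans (ℕₚ.*-suc 2 m) (trans (cong (2 ℕ.+_) eq) (ℕₚ.+-comm 2 (c ℕ.* k)))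
      ck≋0 : + (c ℕ.* k ℕ.+ 0) ≋ + 0
      ck≋0 = ≋-trans (≡⇒≋ (cong +_ (ℕₚ.+-identityʳ (c ℕ.* k)))) (multiple≋0 c)
      sign : (const (- + 1) ^ k) ^ c ≈ const (+ 1)
      sign = ≈-trans (^-assocʳ (const (- + 1)) k c)
        (≈-trans (^-congʳ (const (- + 1)) (trans (ℕₚ.*-comm k c) (sym eq))) (-1^even m))
      P : factors (- + 1) (c ℕ.* k ℕ.+ 0) ≈ F
      P = ≈-trans (factors-blocks (- + 1) c 0) (≈-trans (⊛-identityʳ _) (≈-trans (^-congˡ c factors-neg)
        (≈-trans (^-distrib-* (const (- + 1) ^ k) (factors (+ 1) k) c)
        (≈-trans (*-congʳ {x = F} sign) (⊛-identityˡ F)))))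
      P′ : factors (+ 1) (c ℕ.* k ℕ.+ 2) ≈ F ⊛ X
      P′ = ≈-trans (factors-blocks (+ 1) c 2) (*-congˡ {x = F} factors-1-2)

    -- The factor at j = 0 is the constant N ≡ 0. The index starts at 2 because the product for v_1
    -- is empty.
    v-vanishing : ∀ m → + (2 ℕ.* suc m) - + 1 ≋ + 0 → v (suc (suc m)) ≋ + 0
    v-vanishing m p = begin
      v (suc (suc m))                                             ≈⟨ v-coeff (suc m) ⟩
      (1-X ⊛ factors (+ (2 ℕ.* suc m) - + 1) (2 ℕ.* suc m)) (suc m)
        ≈⟨ at (≈-trans (*-congˡ {x = 1-X} (factors-zero (m ℕ.+ (suc m ℕ.+ 0)) p))
             (let open Solver in solve 1 (λ a → a :* con (+ 0) := con (+ 0)) ≈-refl 1-X)) (suc m) ⟩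
      + 0 ∎
      where open ≋-Reasoning

  -- Parity.

  module Mod2 = Values 2

  -- Modulo 2 the factors alternate between 1 and x, so each pair contributes one x.
  factors-odd : ∀ {N} → N Mod2.≋ + 1 → ∀ m → factors N (m ℕ.* 2 ℕ.+ 0) Mod2.≈ X ^ m
  factors-odd {N} odd m = ≈-trans (factors-cong (m ℕ.* 2 ℕ.+ 0) odd)
      (≈-trans (factors-blocks (+ 1) m 0) (≈-trans (⊛-identityʳ _) (^-congˡ m factors-1-2)))
    where open Mod2

  v-odd : ∀ m → v (suc m) Mod2.≋ + 1
  v-odd m = begin
      v (suc m)
        ≈⟨ v-coeff′ m {+ 1} (m ℕ.* 2 ℕ.+ 0) (trans (ℕₚ.*-comm 2 m) (sym (ℕₚ.+-identityʳ _)))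
             (≋-trans (+-cong≋ {b = + 0} (≋-trans (≡⇒≋ (cong +_ (ℕₚ.+-identityʳ _))) (multiple≋0 m)) (≋-refl { - + 1})) (by (- + 1) refl)) ⟩
      (1-X ⊛ factors (+ 1) (m ℕ.* 2 ℕ.+ 0)) m   ≈⟨ at (≈-trans (*-congˡ {x = 1-X} (factors-odd ≋-refl m)) (*-comm 1-X (X ^ m))) m ⟩
      (X ^ m ⊛ 1-X) m                           ≡⟨ cong (X ^ m ⊛ 1-X) (sym (ℕₚ.+-identityʳ m)) ⟩
      (X ^ m ⊛ 1-X) (m ℕ.+ 0)                   ≈⟨ X^-⊛ m 1-X 0 ⟩
      + 1 ∎
    where
    open Mod2
    open ≋-Reasoning

  -- Powers of two: changing the modulus and doubling the period.

  ≋-scale : ∀ c {k k′ a b} → c ℕ.* k ≡ k′ → Mod._≋_ k a b → Mod._≋_ k′ (+ c * a) (+ c * b)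
  ≋-scale c {k} {b = b} refl (Mod.by t refl) = Mod.by t (trans
    (let open +-*-Solver in solve 4 (λ c b t k → c :* (b :+ t :* k) := c :* b :+ t :* (c :* k)) refl (+ c) b t (+ k))
    (cong (λ z → + c * b + t * z) (sym (ℤₚ.pos-* c k))))

  ≋-coarsen : ∀ c {k k′ a b} → c ℕ.* k ≡ k′ → Mod._≋_ k′ a b → Mod._≋_ k a b
  ≋-coarsen c {k} {b = b} refl (Mod.by t refl) = Mod.by (t * + c)
    (cong (ℤ._+_ b) (trans (cong (ℤ._*_ t) (ℤₚ.pos-* c k)) (sym (ℤₚ.*-assoc t (+ c) (+ k)))))

  -- Collects the quotients of all coefficients into one series, so that a congruence modulo k can
  -- be used as an equation in the ring modulo k′.
  ≈-lift : ∀ {k f g} k′ → Mod._≈_ k f g → Σ Series λ Z → Mod._≈_ k′ f (g ⊕ const (+ k) ⊛ Z)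
  ≈-lift {k} {f} {g} k′ Mod.⟪ p ⟫ = (λ n → quotient (p n)) , Mod.exact k′ (λ n → trans (equation (p n))
      (cong (ℤ._+_ (g n)) (trans (ℤₚ.*-comm (quotient (p n)) (+ k)) (sym (const-⊛ (+ k) (λ n → quotient (p n)) n)))))
    where
    quotient : ∀ {a b} → Mod._≋_ k a b → ℤ
    quotient (Mod.by t _) = t
    equation : ∀ {a b} (r : Mod._≋_ k a b) → a ≡ b + quotient r * + k
    equation (Mod.by _ eq) = eq

  module Doubling (h : ℕ) where

    open Values (2 ℕ.* h)

    2⊛h≈0 : const (+ 2) ⊛ const (+ h) ≈ const (+ 0)
    2⊛h≈0 = ≈-trans (≈-sym (const-* (+ 2) (+ h)))
      (const-cong (≋-trans (≡⇒≋ (sym (ℤₚ.pos-* 2 h))) +k≋0))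

    h⊛h≈0 : ∀ r → h ≡ r ℕ.* 2 → const (+ h) ⊛ const (+ h) ≈ const (+ 0)
    h⊛h≈0 r eq = begin
      const (+ h) ⊛ const (+ h)                  ≈⟨ *-congʳ {x = const (+ h)} (const-cong (≡⇒≋ (trans (cong +_ eq) (ℤₚ.pos-* r 2)))) ⟩
      const (+ r * + 2) ⊛ const (+ h)            ≈⟨ *-congʳ {x = const (+ h)} (const-* (+ r) (+ 2)) ⟩
      const (+ r) ⊛ const (+ 2) ⊛ const (+ h)    ≈⟨ *-assoc (const (+ r)) (const (+ 2)) (const (+ h)) ⟩
      const (+ r) ⊛ (const (+ 2) ⊛ const (+ h))  ≈⟨ *-congˡ {x = const (+ r)} 2⊛h≈0 ⟩
      const (+ r) ⊛ const (+ 0)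
        ≈⟨ (let open Solver in solve 1 (λ a → a :* con (+ 0) := con (+ 0)) ≈-refl (const (+ r))) ⟩
      const (+ 0) ∎
      where open ≈-Reasoning

    -- From f = g + h Z the squares differ by 2h g Z + h² Z², and h² is a multiple of 2h because h
    -- is even. This is how one squaring doubles the modulus.
    square-cong : ∀ r → h ≡ r ℕ.* 2 → ∀ {f g} → Mod._≈_ h f g → f ⊛ f ≈ g ⊛ g
    square-cong r eq {f} {g} p with ≈-lift (2 ℕ.* h) p
    ... | Z , f≈ = begin
      f ⊛ f ≈⟨ *-cong f≈ f≈ ⟩
      (g ⊕ κ ⊛ Z) ⊛ (g ⊕ κ ⊛ Z)
        ≈⟨ (let open Solver in solve 3 (λ g κ Z → (g :+ κ :* Z) :* (g :+ κ :* Z)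
             := g :* g :+ ((con (+ 2) :* κ) :* (g :* Z) :+ (κ :* κ) :* (Z :* Z))) ≈-refl g κ Z) ⟩
      g ⊛ g ⊕ (const (+ 2) ⊛ κ ⊛ (g ⊛ Z) ⊕ κ ⊛ κ ⊛ (Z ⊛ Z))
        ≈⟨ +-congˡ {x = g ⊛ g} (+-cong (*-congʳ {x = g ⊛ Z} 2⊛h≈0) (*-congʳ {x = Z ⊛ Z} (h⊛h≈0 r eq))) ⟩
      g ⊛ g ⊕ (const (+ 0) ⊛ (g ⊛ Z) ⊕ const (+ 0) ⊛ (Z ⊛ Z))
        ≈⟨ (let open Solver in solve 2 (λ g Z → g :* g :+ (con (+ 0) :* (g :* Z) :+ con (+ 0) :* (Z :* Z)) := g :* g) ≈-refl g Z) ⟩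
      g ⊛ g ∎
      where
      open ≈-Reasoning
      κ = const (+ h)

    block : (ℕ → Series) → ℕ → Series
    block g j = g j ⊛ (g (1 ℕ.+ j) ⊛ (g (2 ℕ.+ j) ⊛ g (3 ℕ.+ j)))

    prod-cong-blocks : ∀ g g′ r → (∀ j → block g j ≈ block g′ j) → prod g (r ℕ.* 4) ≈ prod g′ (r ℕ.* 4)
    prod-cong-blocks g g′ zero p = ≈-refl
    prod-cong-blocks g g′ (suc r) p = begin
      prod g (4 ℕ.+ r ℕ.* 4)       ≈⟨ regroup g ⟩
      block g 0 ⊛ prod (g ∘ (4 ℕ.+_)) (r ℕ.* 4)
        ≈⟨ *-cong (p 0) (prod-cong-blocks (g ∘ (4 ℕ.+_)) (g′ ∘ (4 ℕ.+_)) r (λ j → p (4 ℕ.+ j))) ⟩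
      block g′ 0 ⊛ prod (g′ ∘ (4 ℕ.+_)) (r ℕ.* 4)  ≈⟨ regroup g′ ⟨
      prod g′ (4 ℕ.+ r ℕ.* 4) ∎
      where
      open ≈-Reasoning
      regroup : ∀ g → prod g (4 ℕ.+ r ℕ.* 4) ≈ block g 0 ⊛ prod (g ∘ (4 ℕ.+_)) (r ℕ.* 4)
      regroup g = let open Solver in solve 5 (λ a b c d e → a :* (b :* (c :* (d :* e))) := (a :* (b :* (c :* d))) :* e)
        ≈-refl (g 0) (g 1) (g 2) (g 3) (prod (g ∘ (4 ℕ.+_)) (r ℕ.* 4))

    factor-+ : ∀ N i j → factor N (i ℕ.+ j) ≈ factor N j ⊕ const (+ i) ⊛ Y
    factor-+ N i j = ≈-trans (factor≈ N (i ℕ.+ j)) (≈-trans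
      (+-congˡ {x = const N} (*-congʳ {x = Y} (≈-trans (const-cong (≡⇒≋ (ℤₚ.pos-+ i j))) (const-+ (+ i) (+ j)))))
      (≈-trans (let open Solver in solve 4 (λ N i j Y → N :+ (i :+ j) :* Y := (N :+ j :* Y) :+ i :* Y)
         ≈-refl (const N) (const (+ i)) (const (+ j)) Y)
       (+-congʳ {x = const (+ i) ⊛ Y} (≈-sym (factor≈ N j)))))

    block≈ : ∀ N j → block (factor N) j
      ≈ factor N j ⊛ ((factor N j ⊕ const (+ 1) ⊛ Y) ⊛ ((factor N j ⊕ const (+ 2) ⊛ Y) ⊛ (factor N j ⊕ const (+ 3) ⊛ Y)))
    block≈ N j = *-congˡ {x = factor N j} (*-cong (factor-+ N 1 j) (*-cong (factor-+ N 2 j) (factor-+ N 3 j)))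

    -- c (c + y) (c + 2y) (c + 3y) has derivative 4c³ + 18c²y + 22cy² + 6y³ in c, which is even:
    -- so replacing c by c + h y changes it by a multiple of 2h.
    block-shift : ∀ r → h ≡ r ℕ.* 2 → ∀ N j → block (factor N) (h ℕ.+ j) ≈ block (factor N) j
    block-shift r eq N j = begin
      block (factor N) (h ℕ.+ j) ≈⟨ block≈ N (h ℕ.+ j) ⟩
      quartic (factor N (h ℕ.+ j)) ≈⟨ quartic-cong (factor-+ N h j) ⟩
      quartic (c ⊕ κ ⊛ Y)
        ≈⟨ (let open Solver in solve 3 (λ c κ Y → let d = c :+ κ :* Y in
              d :* ((d :+ con (+ 1) :* Y) :* ((d :+ con (+ 2) :* Y) :* (d :+ con (+ 3) :* Y)))
              := c :* ((c :+ con (+ 1) :* Y) :* ((c :+ con (+ 2) :* Y) :* (c :+ con (+ 3) :* Y)))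
              :+ ((con (+ 2) :* κ) :* (Y :* (con (+ 2) :* c :^ 3 :+ con (+ 9) :* Y :* c :^ 2 :+ con (+ 11) :* Y :^ 2 :* c :+ con (+ 3) :* Y :^ 3))
              :+ (κ :* κ) :* (Y :^ 2 :* (con (+ 6) :* c :^ 2 :+ con (+ 18) :* Y :* c :+ con (+ 11) :* Y :^ 2)
                :+ κ :* Y :^ 3 :* (con (+ 4) :* c :+ con (+ 6) :* Y) :+ κ :^ 2 :* Y :^ 4))) ≈-refl c κ Y) ⟩
      quartic c ⊕ (const (+ 2) ⊛ κ ⊛ P ⊕ κ ⊛ κ ⊛ Q)
        ≈⟨ +-congˡ {x = quartic c} (+-cong (*-congʳ {x = P} 2⊛h≈0) (*-congʳ {x = Q} (h⊛h≈0 r eq))) ⟩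
      quartic c ⊕ (const (+ 0) ⊛ P ⊕ const (+ 0) ⊛ Q)
        ≈⟨ (let open Solver in solve 3 (λ c P Q → c :+ (con (+ 0) :* P :+ con (+ 0) :* Q) := c) ≈-refl (quartic c) P Q) ⟩
      quartic c ≈⟨ block≈ N j ⟨
      block (factor N) j ∎
      where
      open ≈-Reasoning
      κ = const (+ h)
      c = factor N j
      quartic : Series → Series
      quartic c = c ⊛ ((c ⊕ const (+ 1) ⊛ Y) ⊛ ((c ⊕ const (+ 2) ⊛ Y) ⊛ (c ⊕ const (+ 3) ⊛ Y)))
      quartic-cong : ∀ {c d} → c ≈ d → quartic c ≈ quartic d
      quartic-cong p = *-cong p (*-cong (+-congʳ p) (*-cong (+-congʳ p) (+-congʳ p)))
      P = Y ⊛ (const (+ 2) ⊛ c ^ 3 ⊕ const (+ 9) ⊛ Y ⊛ c ^ 2 ⊕ const (+ 11) ⊛ Y ^ 2 ⊛ c ⊕ const (+ 3) ⊛ Y ^ 3)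
      Q = Y ^ 2 ⊛ (const (+ 6) ⊛ c ^ 2 ⊕ const (+ 18) ⊛ Y ⊛ c ⊕ const (+ 11) ⊛ Y ^ 2)
          ⊕ κ ⊛ Y ^ 3 ⊛ (const (+ 4) ⊛ c ⊕ const (+ 6) ⊛ Y) ⊕ κ ^ 2 ⊛ Y ^ 4

    -- The factors with indices h, ..., 2h - 1 need not be congruent to those with indices 0, ..., h
    -- - 1, but their blocks of four are, and 4 ∣ h lets the blocks tile the half period.
    factors-double : ∀ r → h ≡ r ℕ.* 4 → ∀ N → factors N (2 ℕ.* h) ≈ factors N h ⊛ factors N h
    factors-double r refl N = begin
      factors N (h ℕ.+ (h ℕ.+ 0))  ≡⟨ cong (λ n → factors N (h ℕ.+ n)) (ℕₚ.+-identityʳ h) ⟩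
      factors N (h ℕ.+ h)          ≈⟨ prod-+ (factor N) h h ⟩
      factors N h ⊛ prod (λ j → factor N (h ℕ.+ j)) h
        ≈⟨ *-congˡ {x = factors N h} (prod-cong-blocks (λ j → factor N (h ℕ.+ j)) (factor N) r
             (λ j → ≈-trans (reassoc j) (block-shift (r ℕ.* 2) (sym (ℕₚ.*-assoc r 2 2)) N j))) ⟩
      factors N h ⊛ factors N h ∎
      where
      open ≈-Reasoning
      reassoc : ∀ j → block (λ j → factor N (h ℕ.+ j)) j ≈ block (factor N) (h ℕ.+ j)
      reassoc j = *-congˡ {x = factor N (h ℕ.+ j)} (*-cong (move 1) (*-cong (move 2) (move 3)))
        where
        move : ∀ i → factor N (h ℕ.+ (i ℕ.+ j)) ≈ factor N (i ℕ.+ (h ℕ.+ j))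
        move i = ≈-reflexive (cong (factor N) (trans (sym (ℕₚ.+-assoc h i j)) (trans (cong (ℕ._+ j) (ℕₚ.+-comm h i)) (ℕₚ.+-assoc i h j))))

  -- The parity of the error term E is what makes v_{n+h} - v_n ≡ h (mod 2h).
  FullProduct : ℕ → ℤ → Set
  FullProduct h N = Σ Series λ E →
    Values._≈_ (2 ℕ.* h) (factors N (2 ℕ.* h)) (X ^ h ⊕ const (+ h) ⊛ E) × (1-X ⊛ E) h Mod2.≋ + 1

  odd⇒1+2t : ∀ {N} → N Mod2.≋ + 1 → ∃ λ t → N ≡ + 1 + + 2 * t
  odd⇒1+2t (Mod.by t refl) = t , cong (ℤ._+_ (+ 1)) (ℤₚ.*-comm t (+ 2))

  -- The half period 2 is too short for a block of four, so this case is expanded directly with N =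
  -- 1 + 2t.
  factors-4 : ∀ {N} → N Mod2.≋ + 1 → Mod._≈_ 4 (factors N 4) (X ^ 2 ⊕ const (+ 2) ⊛ (X ⊕ X ^ 3))
  factors-4 {N} odd with odd⇒1+2t odd
  ... | t , refl = begin
      factors N 4   ≈⟨ *-cong (factor≈ N 0) (*-cong (factor≈ N 1) (*-cong (factor≈ N 2) (*-cong (factor≈ N 3) ≈-refl))) ⟩
      f 0 ⊛ (f 1 ⊛ (f 2 ⊛ (f 3 ⊛ const (+ 1))))
        ≈⟨ *-cong (f≈ 0) (*-cong (f≈ 1) (*-cong (f≈ 2) (*-cong (f≈ 3) ≈-refl))) ⟩
      g 0 ⊛ (g 1 ⊛ (g 2 ⊛ (g 3 ⊛ const (+ 1))))
        ≈⟨ (let open Solver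
                n = λ T → con (+ 1) :+ con (+ 2) :* T
                y = λ X → con (- + 1) :+ con (+ 1) :* X
                f = λ j T X → n T :+ con (+ j) :* y X in
            solve 2 (λ T X → f 0 T X :* (f 1 T X :* (f 2 T X :* (f 3 T X :* con (+ 1))))
              := (X :^ 2 :+ con (+ 2) :* (X :+ X :^ 3)) :+ con (+ 4) :*
                (T :- T :^ 2 :- con (+ 4) :* T :* X :- con (+ 2) :* X :^ 2 :- con (+ 4) :* T :^ 3 :- con (+ 4) :* T :^ 2 :* X
                 :+ con (+ 2) :* T :* X :^ 2 :+ X :^ 3 :+ con (+ 4) :* T :^ 4 :+ con (+ 12) :* T :^ 3 :* X
                 :+ con (+ 11) :* T :^ 2 :* X :^ 2 :+ con (+ 3) :* T :* X :^ 3)) ≈-refl (const t) X) ⟩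
      (X ^ 2 ⊕ const (+ 2) ⊛ (X ⊕ X ^ 3)) ⊕ const (+ 4) ⊛ R
        ≈⟨ +-congˡ {x = X ^ 2 ⊕ const (+ 2) ⊛ (X ⊕ X ^ 3)} (*-congʳ {x = R} (const-cong +k≋0)) ⟩
      (X ^ 2 ⊕ const (+ 2) ⊛ (X ⊕ X ^ 3)) ⊕ const (+ 0) ⊛ R
        ≈⟨ (let open Solver in solve 2 (λ a R → a :+ con (+ 0) :* R := a) ≈-refl (X ^ 2 ⊕ const (+ 2) ⊛ (X ⊕ X ^ 3)) R) ⟩
      X ^ 2 ⊕ const (+ 2) ⊛ (X ⊕ X ^ 3) ∎
    where
    open Values 4
    open ≈-Reasoning
    T = const t
    -- The explicit quotient by 4 of the difference of the two sides; the solver verifies the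
    -- identity over ℤ before 4 ≡ 0 is used.
    R = T ⊕ ⊝ (T ^ 2) ⊕ ⊝ (const (+ 4) ⊛ T ⊛ X) ⊕ ⊝ (const (+ 2) ⊛ X ^ 2) ⊕ ⊝ (const (+ 4) ⊛ T ^ 3) ⊕ ⊝ (const (+ 4) ⊛ T ^ 2 ⊛ X)
        ⊕ const (+ 2) ⊛ T ⊛ X ^ 2 ⊕ X ^ 3 ⊕ const (+ 4) ⊛ T ^ 4 ⊕ const (+ 12) ⊛ T ^ 3 ⊛ X
        ⊕ const (+ 11) ⊛ T ^ 2 ⊛ X ^ 2 ⊕ const (+ 3) ⊛ T ⊛ X ^ 3
    f g : ℕ → Series
    f j = const (+ 1 + + 2 * t) ⊕ const (+ j) ⊛ Y
    g j = (const (+ 1) ⊕ const (+ 2) ⊛ T) ⊕ const (+ j) ⊛ (const (- + 1) ⊕ const (+ 1) ⊛ X)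
    f≈ : ∀ j → f j ≈ g j
    f≈ j = +-cong (≈-trans (const-+ (+ 1) (+ 2 * t)) (+-congˡ {x = const (+ 1)} (const-* (+ 2) t)))
      (*-congˡ {x = const (+ j)} (lin≈ (- + 1) (+ 1)))

  fullProduct-2 : ∀ {N} → N Mod2.≋ + 1 → FullProduct 2 N
  fullProduct-2 odd = X ⊕ X ^ 3 , factors-4 odd , Mod.by (- + 1) refl

  module FullProductDoubling (h r : ℕ) (h≡r*2 : h ≡ r ℕ.* 2) where
    open Values (2 ℕ.* (2 ℕ.* h))
    open Doubling (2 ℕ.* h)

    -- Modulo 4h, the product over 4h factors is the square of the product over 2h factors, and for
    -- the square it is enough to know the latter modulo 2h.
    full-product-square : ∀ N → (F : FullProduct h N) → let E = proj₁ F in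
      factors N (2 ℕ.* (2 ℕ.* h)) ≈ (X ^ h ⊕ const (+ h) ⊛ E) ⊛ (X ^ h ⊕ const (+ h) ⊛ E)
    full-product-square N (E , F≈ , _) = ≈-trans
      (factors-double r (trans (cong (2 ℕ.*_) h≡r*2) (trans (ℕₚ.*-comm 2 (r ℕ.* 2)) (ℕₚ.*-assoc r 2 2))) N)
      (square-cong h (ℕₚ.*-comm 2 h) F≈)

    -- The new error term x^h E is the cross term of the square; h² E² drops out because 4 ∣ h gives
    -- 4h ∣ h². The parity is inherited: x^h moves coefficient h of (1 - x) E to coefficient 2h.
    full-product-double : ∀ s → h ≡ s ℕ.* 4 → ∀ {N} → FullProduct h N → FullProduct (2 ℕ.* h) N
    full-product-double s h≡s*4 {N} F@(E , _ , odd) = X ^ h ⊛ E , (begin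
        factors N (2 ℕ.* (2 ℕ.* h))                        ≈⟨ full-product-square N F ⟩
        (X ^ h ⊕ κ ⊛ E) ⊛ (X ^ h ⊕ κ ⊛ E)
          ≈⟨ (let open Solver in solve 3 (λ X κ E → (X :+ κ :* E) :* (X :+ κ :* E)
                := (X :* X :+ (con (+ 2) :* κ) :* (X :* E)) :+ (κ :* κ) :* (E :* E)) ≈-refl (X ^ h) κ E) ⟩
        (X ^ h ⊛ X ^ h ⊕ const (+ 2) ⊛ κ ⊛ (X ^ h ⊛ E)) ⊕ κ ⊛ κ ⊛ (E ⊛ E)
          ≈⟨ +-cong (+-cong X^h⊛X^h (*-congʳ {x = X ^ h ⊛ E} 2⊛κ)) (*-congʳ {x = E ⊛ E} κ⊛κ≈0) ⟩
        (X ^ (2 ℕ.* h) ⊕ const (+ (2 ℕ.* h)) ⊛ (X ^ h ⊛ E)) ⊕ const (+ 0) ⊛ (E ⊛ E)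
          ≈⟨ (let open Solver in solve 2 (λ a E → a :+ con (+ 0) :* E := a) ≈-refl
               (X ^ (2 ℕ.* h) ⊕ const (+ (2 ℕ.* h)) ⊛ (X ^ h ⊛ E)) (E ⊛ E)) ⟩
        X ^ (2 ℕ.* h) ⊕ const (+ (2 ℕ.* h)) ⊛ (X ^ h ⊛ E) ∎) ,
      M₂.≋-trans (M₂.at (M₂.≈-trans (M₂.≈-sym (M₂.*-assoc 1-X (X ^ h) E))
          (M₂.≈-trans (M₂.*-congʳ {x = E} (M₂.*-comm 1-X (X ^ h))) (M₂.*-assoc (X ^ h) 1-X E))) (h ℕ.+ (h ℕ.+ 0)))
        (M₂.≋-trans (M₂.X^-⊛ h (1-X ⊛ E) (h ℕ.+ 0))
        (subst (λ n → (1-X ⊛ E) n M₂.≋ + 1) (sym (ℕₚ.+-identityʳ h)) odd))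
      where
      open ≈-Reasoning
      module M₂ = Mod2
      κ = const (+ h)
      X^h⊛X^h : X ^ h ⊛ X ^ h ≈ X ^ (2 ℕ.* h)
      X^h⊛X^h = ≈-trans (≈-sym (^-homo-* X h h)) (^-congʳ X (cong (h ℕ.+_) (sym (ℕₚ.+-identityʳ h))))
      2⊛κ : const (+ 2) ⊛ κ ≈ const (+ (2 ℕ.* h))
      2⊛κ = ≈-trans (≈-sym (const-* (+ 2) (+ h))) (const-cong (≡⇒≋ (sym (ℤₚ.pos-* 2 h))))
      κ⊛κ≈0 : κ ⊛ κ ≈ const (+ 0)
      κ⊛κ≈0 = ≈-trans (≈-sym (const-* (+ h) (+ h))) (const-cong (≋-trans (≡⇒≋ (trans (sym (ℤₚ.pos-* h h)) (cong +_ h*h))) (multiple≋0 s)))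
        where
        h*h : h ℕ.* h ≡ s ℕ.* (2 ℕ.* (2 ℕ.* h))
        h*h = trans (cong (ℕ._* h) h≡s*4) (trans (ℕₚ.*-assoc s 4 h) (cong (s ℕ.*_) (ℕₚ.*-assoc 2 2 h)))

  -- Here h² = 4 is not 0 modulo 8, so E² survives as a part of the new error term; its parity is
  -- checked by computation.
  fullProduct-4 : ∀ {N} → N Mod2.≋ + 1 → FullProduct 4 N
  fullProduct-4 {N} odd = E′ , (begin
      factors N 8 ≈⟨ full-product-square N F ⟩
      (X ^ 2 ⊕ const (+ 2) ⊛ E) ⊛ (X ^ 2 ⊕ const (+ 2) ⊛ E)
        ≈⟨ (let open Solver in solve 2 (λ X E → (X :^ 2 :+ con (+ 2) :* E) :* (X :^ 2 :+ con (+ 2) :* E)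
                := X :^ 4 :+ con (+ 4) :* (X :^ 2 :* E :+ E :^ 2)) ≈-refl X E) ⟩
      X ^ 4 ⊕ const (+ 4) ⊛ E′ ∎) , Mod.by (+ 0) refl
    where
    F = fullProduct-2 odd
    E = proj₁ F
    E′ = X ^ 2 ⊛ E ⊕ E ^ 2
    open FullProductDoubling 2 1 refl
    open Values 8
    open ≈-Reasoning

  2^-≡-*4 : ∀ i → 2 ℕ.^ (2 ℕ.+ i) ≡ 2 ℕ.^ i ℕ.* 4
  2^-≡-*4 i = trans (sym (ℕₚ.*-assoc 2 2 (2 ℕ.^ i))) (ℕₚ.*-comm 4 (2 ℕ.^ i))

  fullProduct : ∀ i {N} → N Mod2.≋ + 1 → FullProduct (2 ℕ.^ suc i) N
  fullProduct zero odd = fullProduct-2 odd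
  fullProduct (suc zero) odd = fullProduct-4 odd
  fullProduct (suc (suc i)) {N} odd = FullProductDoubling.full-product-double (2 ℕ.^ suc (suc i)) (2 ℕ.^ suc i) (ℕₚ.*-comm 2 (2 ℕ.^ suc i))
    (2 ℕ.^ i) (2^-≡-*4 i) {N} (fullProduct (suc i) odd)

  2m-1-odd : ∀ m → + (2 ℕ.* m) - + 1 Mod2.≋ + 1
  2m-1-odd m = Mod.by (+ m - + 1) (trans (cong (_- + 1) (ℤₚ.pos-* 2 m))
    (let open +-*-Solver in solve 1 (λ m → con (+ 2) :* m :- con (+ 1) := con (+ 1) :+ (m :- con (+ 1)) :* con (+ 2)) refl (+ m)))

  -- Powers of two: the shift by h.

  module FullShift (h : ℕ) (full : ∀ {N} → N Mod2.≋ + 1 → FullProduct h N) where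
    open Values (2 ℕ.* h)
    private module M₂ = Mod2

    -- The summand x^h P reproduces the old coefficient. The other summand carries the factor h, so
    -- only the parity of (1 - x) E P matters; as P ≡ x^n modulo 2, that is the parity of
    -- coefficient h of (1 - x) E, which is odd.
    coefficient-of-full : ∀ {N} (odd : N Mod2.≋ + 1) P n → Mod2._≈_ P (X ^ n) →
      (1-X ⊛ (factors N (2 ℕ.* h) ⊛ P)) (h ℕ.+ n) ≋ (1-X ⊛ P) n + + h
    coefficient-of-full {N} odd P n P≈ = begin
      (1-X ⊛ (factors N (2 ℕ.* h) ⊛ P)) (h ℕ.+ n)
        ≈⟨ at (*-congˡ {x = 1-X} (*-congʳ {x = P} F≈)) (h ℕ.+ n) ⟩
      (1-X ⊛ ((X ^ h ⊕ const (+ h) ⊛ E) ⊛ P)) (h ℕ.+ n)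
        ≈⟨ at (let open Solver in solve 5 (λ Z X κ E P → Z :* ((X :+ κ :* E) :* P) := X :* (Z :* P) :+ κ :* ((Z :* E) :* P))
             ≈-refl 1-X (X ^ h) (const (+ h)) E P) (h ℕ.+ n) ⟩
      (X ^ h ⊛ (1-X ⊛ P)) (h ℕ.+ n) + (const (+ h) ⊛ ((1-X ⊛ E) ⊛ P)) (h ℕ.+ n)
        ≈⟨ +-cong≋ (X^-⊛ h (1-X ⊛ P) n) (≋-trans (≡⇒≋ (const-⊛ (+ h) ((1-X ⊛ E) ⊛ P) (h ℕ.+ n)))
             (≋-scale h {k = 2} (ℕₚ.*-comm h 2) parity)) ⟩
      (1-X ⊛ P) n + + h * + 1 ≡⟨ cong (ℤ._+_ ((1-X ⊛ P) n)) (ℤₚ.*-identityʳ (+ h)) ⟩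
      (1-X ⊛ P) n + + h ∎
      where
      open ≋-Reasoning
      E = proj₁ (full odd)
      F≈ = proj₁ (proj₂ (full odd))
      parity : ((1-X ⊛ E) ⊛ P) (h ℕ.+ n) M₂.≋ + 1
      parity = M₂.≋-trans (M₂.at (M₂.≈-trans (M₂.*-congˡ {x = 1-X ⊛ E} P≈) (M₂.*-comm (1-X ⊛ E) (X ^ n))) (h ℕ.+ n))
        (M₂.≋-trans (M₂.≡⇒≋ (cong (X ^ n ⊛ (1-X ⊛ E)) (ℕₚ.+-comm h n)))
        (M₂.≋-trans (M₂.X^-⊛ n (1-X ⊛ E) h) (proj₂ (proj₂ (full odd)))))

    -- Passing from m to m + h adds 2h factors, exactly one period, and leaves N unchanged modulo
    -- 2h.
    v-shift : ∀ m → v (suc m ℕ.+ h) ≋ v (suc m) + + h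
    v-shift m = begin
      v (suc (m ℕ.+ h))
        ≈⟨ v-coeff′ (m ℕ.+ h) {N} (1 ℕ.* (2 ℕ.* h) ℕ.+ 2 ℕ.* m) count N≋ ⟩
      (1-X ⊛ factors N (1 ℕ.* (2 ℕ.* h) ℕ.+ 2 ℕ.* m)) (m ℕ.+ h)
        ≈⟨ at (*-congˡ {x = 1-X} (≈-trans (factors-blocks N 1 (2 ℕ.* m)) (*-congʳ {x = P} (⊛-identityʳ (factors N (2 ℕ.* h)))))) (m ℕ.+ h) ⟩
      (1-X ⊛ (factors N (2 ℕ.* h) ⊛ P)) (m ℕ.+ h)
        ≡⟨ cong (1-X ⊛ (factors N (2 ℕ.* h) ⊛ P)) (ℕₚ.+-comm m h) ⟩
      (1-X ⊛ (factors N (2 ℕ.* h) ⊛ P)) (h ℕ.+ m)   ≈⟨ coefficient-of-full odd P m P≈ ⟩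
      (1-X ⊛ P) m + + h                             ≈⟨ +-cong≋ (v-coeff m) ≋-refl ⟨
      v (suc m) + + h ∎
      where
      open ≋-Reasoning
      N = + (2 ℕ.* m) - + 1
      P = factors N (2 ℕ.* m)
      odd = 2m-1-odd m
      P≈ : P M₂.≈ X ^ m
      P≈ = M₂.≈-trans (M₂.≈-reflexive (cong (factors N) (trans (ℕₚ.*-comm 2 m) (sym (ℕₚ.+-identityʳ _))))) (factors-odd odd m)
      count : 2 ℕ.* (m ℕ.+ h) ≡ 1 ℕ.* (2 ℕ.* h) ℕ.+ 2 ℕ.* m
      count = let open ℕ-Solver in solve 2 (λ m h → con 2 :* (m :+ h) := con 1 :* (con 2 :* h) :+ con 2 :* m) refl m h
      N≋ : + (1 ℕ.* (2 ℕ.* h) ℕ.+ 2 ℕ.* m) - + 1 ≋ N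
      N≋ = +-cong≋ (≋-trans (≡⇒≋ (cong (λ n → + (n ℕ.+ 2 ℕ.* m)) (ℕₚ.*-identityˡ (2 ℕ.* h)))) (k+≋ (2 ℕ.* m))) (≋-refl { - + 1})

  -- Powers of two: the value of v_h modulo 2h.

  module _ (i : ℕ) where
    private h = 2 ℕ.^ i
    open Values h

    -- Unrolling i times gives f 0 ≡ (-2)^i f i, a multiple of the modulus 2^i.
    nilpotent : ∀ (f : ℕ → ℤ) → (∀ e → f e ≋ - + 2 * f (suc e)) → f 0 ≋ + 0
    nilpotent f p = ≋-trans (iterate i) (≋-trans (*-cong≋ (powers≋0) (≋-refl {f i})) (≡⇒≋ (ℤₚ.*-zeroˡ (f i))))
      where
      iterate : ∀ j → f 0 ≋ (- + 2) ℤ.^ j * f j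
      iterate zero = ≡⇒≋ (sym (ℤₚ.*-identityˡ (f 0)))
      iterate (suc j) = ≋-trans (iterate j) (≋-trans (*-cong≋ (≋-refl {(- + 2) ℤ.^ j}) (p j)) (≡⇒≋
        (let open +-*-Solver in solve 2 (λ a b → a :* (con (- + 2) :* b) := con (- + 2) :* a :* b) refl ((- + 2) ℤ.^ j) (f (suc j)))))
      signed : ∀ j → ∃ λ s → (- + 2) ℤ.^ j ≡ s * + (2 ℕ.^ j)
      signed zero = + 1 , refl
      signed (suc j) with signed j
      ... | s , eq = - s , trans (cong (ℤ._*_ (- + 2)) eq) (trans
        (let open +-*-Solver in solve 2 (λ s a → con (- + 2) :* (s :* a) := (:- s) :* (con (+ 2) :* a)) refl s (+ (2 ℕ.^ j)))
        (cong (ℤ._*_ (- s)) (sym (ℤₚ.pos-* 2 (2 ℕ.^ j)))))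
      powers≋0 : (- + 2) ℤ.^ i ≋ + 0
      powers≋0 with signed i
      ... | s , eq = by s (trans eq (sym (ℤₚ.+-identityˡ _)))

  -- With n = h = 2^(i+1), N ≡ -3 and the two factors missing from the full product are -(1 + 2x) and -(2 + x).
  -- So W := (1 - x) P satisfies (1 + 2x) (2 + x) W ≡ (1 - x) (x^h + h E), which is solved for W_{h-1}:
  -- with U := (2 + x) W, upwards from U_0, and with z_e := 3 W_{h+e} + U_{h+e+1}, for which z_e ≡ -2 z_{e+1} (mod h).
  module Half (i m : ℕ) (h≡1+m : 2 ℕ.^ suc i ≡ suc m) where
    h : ℕ
    h = 2 ℕ.^ suc i
    open Values (2 ℕ.* h)
    private module Mₕ = Values h

    odd : - + 3 Mod2.≋ + 1
    odd = Mod.by (- + 2) refl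

    E P W U R : Series
    E = proj₁ (fullProduct i odd)
    P = factors (- + 3) (2 ℕ.* m)
    W = 1-X ⊛ P
    U = lin (+ 2) (+ 1) ⊛ W
    R = 1-X ⊛ (X ^ h ⊕ const (+ h) ⊛ E)

    2h≡ : 2 ℕ.* h ≡ 2 ℕ.* m ℕ.+ 2
    2h≡ = trans (cong (2 ℕ.*_) h≡1+m) (let open ℕ-Solver in solve 1 (λ m → con 2 :* (con 1 :+ m) := con 2 :* m :+ con 2) refl m)

    +2m+≋ : ∀ j → + (2 ℕ.* m ℕ.+ j) ≋ + j - + 2
    +2m+≋ j = by (+ 1) (begin
      + (2 ℕ.* m ℕ.+ j)                       ≡⟨ ℤₚ.pos-+ (2 ℕ.* m) j ⟩
      + (2 ℕ.* m) + + j
        ≡⟨ (let open +-*-Solver in solve 2 (λ M j → M :+ j := j :- con (+ 2) :+ con (+ 1) :* (M :+ con (+ 2))) refl (+ (2 ℕ.* m)) (+ j)) ⟩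
      + j - + 2 + + 1 * (+ (2 ℕ.* m) + + 2)   ≡⟨ cong (λ z → + j - + 2 + + 1 * z) (sym (trans (cong +_ 2h≡) (ℤₚ.pos-+ (2 ℕ.* m) 2))) ⟩
      + j - + 2 + + 1 * + (2 ℕ.* h) ∎)
      where open ≡-Reasoning

    missing-factors : P ⊛ (lin (+ 1) (+ 2) ⊛ lin (+ 2) (+ 1)) ≈ factors (- + 3) (2 ℕ.* h)
    missing-factors = ≈-sym (begin
      factors (- + 3) (2 ℕ.* h)          ≡⟨ cong (factors (- + 3)) 2h≡ ⟩
      factors (- + 3) (2 ℕ.* m ℕ.+ 2)    ≈⟨ prod-+ (factor (- + 3)) (2 ℕ.* m) 2 ⟩
      P ⊛ (factor (- + 3) (2 ℕ.* m ℕ.+ 0) ⊛ (factor (- + 3) (2 ℕ.* m ℕ.+ 1) ⊛ const (+ 1)))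
        ≈⟨ *-congˡ {x = P} (*-cong (lin-cong (+-cong≋ (≋-refl { - + 3}) (neg-cong≋ (+2m+≋ 0))) (+2m+≋ 0))
             (*-congʳ {x = const (+ 1)} (lin-cong (+-cong≋ (≋-refl { - + 3}) (neg-cong≋ (+2m+≋ 1))) (+2m+≋ 1)))) ⟩
      P ⊛ (lin (- + 1) (- + 2) ⊛ (lin (- + 2) (- + 1) ⊛ const (+ 1)))
        ≈⟨ *-congˡ {x = P} (*-cong (lin≈ (- + 1) (- + 2)) (*-congʳ {x = const (+ 1)} (lin≈ (- + 2) (- + 1)))) ⟩
      P ⊛ ((const (- + 1) ⊕ const (- + 2) ⊛ X) ⊛ ((const (- + 2) ⊕ const (- + 1) ⊛ X) ⊛ const (+ 1)))
        ≈⟨ *-congˡ {x = P} (let open Solver in solve 1 (λ X → (con (- + 1) :+ con (- + 2) :* X) :* ((con (- + 2) :+ con (- + 1) :* X) :* con (+ 1))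
             := (con (+ 1) :+ con (+ 2) :* X) :* (con (+ 2) :+ con (+ 1) :* X)) ≈-refl X) ⟩
      P ⊛ ((const (+ 1) ⊕ const (+ 2) ⊛ X) ⊛ (const (+ 2) ⊕ const (+ 1) ⊛ X))
        ≈⟨ *-congˡ {x = P} (*-cong (lin≈ (+ 1) (+ 2)) (lin≈ (+ 2) (+ 1))) ⟨
      P ⊛ (lin (+ 1) (+ 2) ⊛ lin (+ 2) (+ 1)) ∎)
      where open ≈-Reasoning

    [1+2X]U≈R : lin (+ 1) (+ 2) ⊛ U ≈ R
    [1+2X]U≈R = begin
      lin (+ 1) (+ 2) ⊛ (lin (+ 2) (+ 1) ⊛ (1-X ⊛ P))
        ≈⟨ (let open Solver in solve 4 (λ a b c P → a :* (b :* (c :* P)) := c :* (P :* (a :* b))) ≈-refl (lin (+ 1) (+ 2)) (lin (+ 2) (+ 1)) 1-X P) ⟩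
      1-X ⊛ (P ⊛ (lin (+ 1) (+ 2) ⊛ lin (+ 2) (+ 1)))  ≈⟨ *-congˡ {x = 1-X} missing-factors ⟩
      1-X ⊛ factors (- + 3) (2 ℕ.* h)  ≈⟨ *-congˡ {x = 1-X} (proj₁ (proj₂ (fullProduct i odd))) ⟩
      R ∎
      where open ≈-Reasoning

    U-rec : ∀ e → U (suc e) ≋ R (suc e) - + 2 * U e
    U-rec e = begin
      U (suc e)  ≡⟨ (let open +-*-Solver in solve 2 (λ a b → a := (con (+ 1) :* a :+ con (+ 2) :* b) :- con (+ 2) :* b) refl (U (suc e)) (U e)) ⟩
      (+ 1 * U (suc e) + + 2 * U e) - + 2 * U e  ≡⟨ cong (_- + 2 * U e) (sym (lin-⊛ (+ 1) (+ 2) U e)) ⟩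
      (lin (+ 1) (+ 2) ⊛ U) (suc e) - + 2 * U e  ≈⟨ +-cong≋ (at [1+2X]U≈R (suc e)) (≋-refl { - (+ 2 * U e)}) ⟩
      R (suc e) - + 2 * U e ∎
      where open ≋-Reasoning

    U-rec′ : ∀ e {r} → R (suc e) Mₕ.≋ r → U (suc e) Mₕ.≋ r - + 2 * U e
    U-rec′ e p = Mₕ.≋-trans (≋-coarsen 2 refl (U-rec e)) (Mₕ.+-cong≋ p (Mₕ.≋-refl { - (+ 2 * U e)}))

    U-zero : U 0 Mₕ.≋ R 0
    U-zero = Mₕ.≋-trans (Mₕ.≡⇒≋ (sym (ℤₚ.*-identityˡ (U 0)))) (≋-coarsen 2 refl (at [1+2X]U≈R 0))

    -- Coefficient e + 1 of (2 + x) W determines W (e + 1) only up to the factor 2, so the equation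
    -- is solved for W e and runs downwards.
    W-rec : ∀ e → W e ≡ U (suc e) - + 2 * W (suc e)
    W-rec e = trans (let open +-*-Solver in solve 2 (λ a b → a := (con (+ 2) :* b :+ con (+ 1) :* a) :- con (+ 2) :* b) refl (W e) (W (suc e)))
      (cong (_- + 2 * W (suc e)) (sym (lin-⊛ (+ 2) (+ 1) W e)))

    R≈ : R Mₕ.≈ X ^ h ⊛ 1-X
    R≈ = begin
      1-X ⊛ (X ^ h ⊕ const (+ h) ⊛ E)
        ≈⟨ Mₕ.*-congˡ {x = 1-X} (Mₕ.+-congˡ {x = X ^ h} (Mₕ.*-congʳ {x = E} (Mₕ.const-cong Mₕ.+k≋0))) ⟩
      1-X ⊛ (X ^ h ⊕ const (+ 0) ⊛ E)
        ≈⟨ (let open Mₕ.Solver in solve 3 (λ Z H E → Z :* (H :+ con (+ 0) :* E) := H :* Z) Mₕ.≈-refl 1-X (X ^ h) E) ⟩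
      X ^ h ⊛ 1-X ∎
      where open Mₕ.≈-Reasoning

    R-high : ∀ e → R (h ℕ.+ e) Mₕ.≋ 1-X e
    R-high e = Mₕ.≋-trans (Mₕ.at R≈ (h ℕ.+ e)) (Mₕ.X^-⊛ h 1-X e)

    R-high′ : ∀ e → R (suc (h ℕ.+ e)) Mₕ.≋ 1-X (suc e)
    R-high′ e = subst (λ n → R n Mₕ.≋ 1-X (suc e)) (ℕₚ.+-suc h e) (R-high (suc e))

    R-low : ∀ e → e ℕ.< h → R e Mₕ.≋ + 0
    R-low e p = Mₕ.≋-trans (Mₕ.at R≈ e) (Mₕ.X^-⊛-low h 1-X e p)

    U-low : ∀ e → e ℕ.< h → U e Mₕ.≋ + 0
    U-low zero p = Mₕ.≋-trans U-zero (R-low 0 p)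
    U-low (suc e) p = Mₕ.≋-trans (U-rec′ e (R-low (suc e) p))
      (Mₕ.+-cong≋ (Mₕ.≋-refl {+ 0}) (Mₕ.neg-cong≋ (Mₕ.*-cong≋ (Mₕ.≋-refl {+ 2}) (U-low e (ℕₚ.<-trans (ℕₚ.n<1+n e) p)))))

    -- `U-low` holds modulo h; the factor 2 that `U-rec` brings along lifts it to modulo 2h.
    U-m : + 2 * U m ≋ + 0
    U-m = ≋-scale 2 refl (U-low m (subst (m ℕ.<_) (sym h≡1+m) (ℕₚ.n<1+n m)))

    R-h : R h ≋ + 1 + + h
    R-h = begin
      R h ≡⟨ cong R (sym (ℕₚ.+-identityʳ h)) ⟩
      R (h ℕ.+ 0)
        ≈⟨ at (let open Solver in solve 4 (λ Z H κ E → Z :* (H :+ κ :* E) := H :* Z :+ κ :* (Z :* E)) ≈-refl 1-X (X ^ h) (const (+ h)) E) (h ℕ.+ 0) ⟩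
      (X ^ h ⊛ 1-X) (h ℕ.+ 0) + (const (+ h) ⊛ (1-X ⊛ E)) (h ℕ.+ 0)
        ≈⟨ +-cong≋ (X^-⊛ h 1-X 0) (≋-trans (≡⇒≋ (trans (const-⊛ (+ h) (1-X ⊛ E) (h ℕ.+ 0)) (cong (λ n → + h * (1-X ⊛ E) n) (ℕₚ.+-identityʳ h))))
             (≋-scale h {k = 2} (ℕₚ.*-comm h 2) (proj₂ (proj₂ (fullProduct i odd))))) ⟩
      + 1 + + h * + 1 ≡⟨ cong (ℤ._+_ (+ 1)) (ℤₚ.*-identityʳ (+ h)) ⟩
      + 1 + + h ∎
      where open ≋-Reasoning

    U-h : U h ≋ + 1 + + h
    U-h = begin
      U h                           ≡⟨ cong U h≡1+m ⟩
      U (suc m)                     ≈⟨ U-rec m ⟩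
      R (suc m) - + 2 * U m         ≈⟨ +-cong≋ (≋-trans (≡⇒≋ (cong R (sym h≡1+m))) R-h) (neg-cong≋ U-m) ⟩
      + 1 + + h - + 0               ≡⟨ ℤₚ.+-identityʳ (+ 1 + + h) ⟩
      + 1 + + h ∎
      where open ≋-Reasoning

    U-1+h : U (suc (h ℕ.+ 0)) Mₕ.≋ - + 3
    U-1+h = Mₕ.≋-trans (U-rec′ (h ℕ.+ 0) (R-high′ 0)) (Mₕ.+-cong≋ (Mₕ.≋-refl { - + 1}) (Mₕ.neg-cong≋ {b = + 2 * + 1} (Mₕ.*-cong≋ (Mₕ.≋-refl {+ 2}) U-h′)))
      where
      U-h′ : U (h ℕ.+ 0) Mₕ.≋ + 1
      U-h′ = Mₕ.≋-trans (Mₕ.≡⇒≋ (cong U (ℕₚ.+-identityʳ h))) (Mₕ.≋-trans (≋-coarsen 2 refl U-h)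
        (Mₕ.+-cong≋ (Mₕ.≋-refl {+ 1}) (Mₕ.+k≋0)))

    -- By `W-rec`, W_n = U_(n+1) - 2 U_(n+2) + 4 U_(n+3) - ... in the 2-adic sense. Above h, U is
    -- geometric with ratio -2 modulo h, so the sum is U_(n+1) (1 + 4 + 16 + ...) = -U_(n+1) / 3.
    -- Hence the constant 3, and hence the vanishing of `z 0` modulo h.
    z : ℕ → ℤ
    z e = + 3 * W (h ℕ.+ e) + U (suc (h ℕ.+ e))

    z-rec : ∀ e → z e Mₕ.≋ - + 2 * z (suc e)
    z-rec e = begin
      + 3 * W n + U (suc n)                                ≡⟨ cong (λ w → + 3 * w + U (suc n)) (W-rec n) ⟩
      + 3 * (U (suc n) - + 2 * W (suc n)) + U (suc n)
        ≡⟨ (let open +-*-Solver in solve 2 (λ U W → con (+ 3) :* (U :- con (+ 2) :* W) :+ U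
             := con (- + 2) :* (con (+ 3) :* W :+ (con (+ 0) :- con (+ 2) :* U))) refl (U (suc n)) (W (suc n))) ⟩
      - + 2 * (+ 3 * W (suc n) + (+ 0 - + 2 * U (suc n)))
        ≈⟨ Mₕ.*-cong≋ (Mₕ.≋-refl { - + 2}) (Mₕ.+-cong≋ (Mₕ.≋-refl {+ 3 * W (suc n)})
             (U-rec′ (suc n) (subst (λ l → R (suc l) Mₕ.≋ + 0) (ℕₚ.+-suc h e) (R-high′ (suc e))))) ⟨
      - + 2 * (+ 3 * W (suc n) + U (suc (suc n)))          ≡⟨ cong (λ l → - + 2 * (+ 3 * W l + U (suc l))) (sym (ℕₚ.+-suc h e)) ⟩
      - + 2 * z (suc e) ∎
      where
      open Mₕ.≋-Reasoning
      n = h ℕ.+ e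

    -- From z 0 ≡ 0 and U_(h+1) ≡ -3 it follows that 3 a ≡ 0 for a = W h - 1. This says a ≡ -2 a, so
    -- `nilpotent` for a constant sequence cancels the 3.
    W-h : W h Mₕ.≋ + 1
    W-h = Mₕ.≋-trans (Mₕ.≡⇒≋ (let open +-*-Solver in solve 1 (λ w → w := (w :- con (+ 1)) :+ con (+ 1)) refl (W h)))
        (Mₕ.+-cong≋ (nilpotent (suc i) (λ _ → a) (λ _ → a≋-2a)) (Mₕ.≋-refl {+ 1}))
      where
      a = W h - + 1
      open Mₕ.≋-Reasoning
      a≋-2a : a Mₕ.≋ - + 2 * a
      a≋-2a = begin
        W h - + 1
          ≡⟨ (let open +-*-Solver in solve 1 (λ w → w :- con (+ 1) := con (- + 2) :* (w :- con (+ 1)) :+ (con (+ 3) :* w :+ con (- + 3))) refl (W h)) ⟩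
        - + 2 * a + (+ 3 * W h + - + 3)
          ≈⟨ Mₕ.+-cong≋ (Mₕ.≋-refl { - + 2 * a}) (Mₕ.+-cong≋ (Mₕ.≡⇒≋ (cong (λ n → + 3 * W n) (sym (ℕₚ.+-identityʳ h)))) (Mₕ.≋-sym U-1+h)) ⟩
        - + 2 * a + z 0     ≈⟨ Mₕ.+-cong≋ (Mₕ.≋-refl { - + 2 * a}) (nilpotent (suc i) z z-rec) ⟩
        - + 2 * a + + 0     ≡⟨ ℤₚ.+-identityʳ _ ⟩
        - + 2 * a ∎

    -- W_m = U_h - 2 W_h: U_h has to be known modulo 2h, but W_h only modulo h, and the result is (1
    -- + h) - 2.
    v-half : v h ≋ + h - + 1
    v-half = begin
      v h          ≡⟨ cong v h≡1+m ⟩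
      v (suc m)    ≈⟨ v-coeff′ m (2 ℕ.* m) refl (+-cong≋ (≋-trans (≡⇒≋ (cong +_ (sym (ℕₚ.+-identityʳ (2 ℕ.* m))))) (+2m+≋ 0)) (≋-refl { - + 1})) ⟩
      W m          ≡⟨ W-rec m ⟩
      U (suc m) - + 2 * W (suc m)
        ≈⟨ +-cong≋ (≋-trans (≡⇒≋ (cong U (sym h≡1+m))) U-h)
             (neg-cong≋ (≋-scale 2 refl (Mₕ.≋-trans (Mₕ.≡⇒≋ (cong W (sym h≡1+m))) W-h))) ⟩
      (+ 1 + + h) - + 2 * + 1 ≡⟨ (let open +-*-Solver in solve 1 (λ h → (con (+ 1) :+ h) :- con (+ 2) :* con (+ 1) := h :- con (+ 1)) refl (+ h)) ⟩
      + h - + 1 ∎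
      where open ≋-Reasoning

  -- Binomial coefficients as the coefficients of (1 + x)^n.

  1+X : Series
  1+X = lin (+ 1) (+ 1)

  pascal : ∀ n s → (1+X ^ suc n) (suc s) ≡ (1+X ^ n) (suc s) + (1+X ^ n) s
  pascal n s = trans (lin-⊛ (+ 1) (+ 1) (1+X ^ n) s)
    (cong₂ _+_ (ℤₚ.*-identityˡ ((1+X ^ n) (suc s))) (ℤₚ.*-identityˡ ((1+X ^ n) s)))

  1+X^-0 : ∀ n → (1+X ^ n) 0 ≡ + 1
  1+X^-0 zero = refl
  1+X^-0 (suc n) = trans (ℤₚ.*-identityˡ ((1+X ^ n) 0)) (1+X^-0 n)

  -- For n + 1 = p this yields the divisibility of the inner binomial coefficients without
  -- factorials. The induction is Pascal's rule applied on both sides.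
  1+X^-absorption : ∀ n s → + suc s * (1+X ^ suc n) (suc s) ≡ + suc n * (1+X ^ n) s
  1+X^-absorption zero zero = refl
  1+X^-absorption zero (suc s) = trans (cong (+ suc (suc s) *_) (pascal 0 (suc s))) (ℤₚ.*-zeroʳ (+ suc (suc s)))
  1+X^-absorption (suc n) zero = begin
    + 1 * (1+X ^ suc (suc n)) 1                 ≡⟨ cong (+ 1 *_) (pascal (suc n) 0) ⟩
    + 1 * (b + (1+X ^ suc n) 0)  ≡⟨ ℤₚ.*-distribˡ-+ (+ 1) b _ ⟩
    + 1 * b + + 1 * (1+X ^ suc n) 0
      ≡⟨ cong₂ _+_ (trans (1+X^-absorption n 0) (cong (+ suc n *_) (1+X^-0 n))) (cong (+ 1 *_) (1+X^-0 (suc n))) ⟩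
    + suc n * + 1 + + 1
      ≡⟨ (let open +-*-Solver in solve 1 (λ n → n :* con (+ 1) :+ con (+ 1) := (con (+ 1) :+ n) :* con (+ 1)) refl (+ suc n)) ⟩
    + suc (suc n) * + 1  ≡⟨ cong (+ suc (suc n) *_) (sym (1+X^-0 (suc n))) ⟩
    + suc (suc n) * (1+X ^ suc n) 0 ∎
    where
    open ≡-Reasoning
    b = (1+X ^ suc n) 1
  1+X^-absorption (suc n) (suc s) = begin
    + suc (suc s) * (1+X ^ suc (suc n)) (suc (suc s))  ≡⟨ cong (+ suc (suc s) *_) (pascal (suc n) (suc s)) ⟩
    + suc (suc s) * (b + c)
      ≡⟨ (let open +-*-Solver in solve 3 (λ s b c → (con (+ 1) :+ s) :* (b :+ c) := (con (+ 1) :+ s) :* b :+ (s :* c :+ c)) refl (+ suc s) b c) ⟩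
    + suc (suc s) * b + (+ suc s * c + c)
      ≡⟨ cong₂ _+_ (1+X^-absorption n (suc s)) (cong (_+ c) (1+X^-absorption n s)) ⟩
    + suc n * (1+X ^ n) (suc s) + (+ suc n * (1+X ^ n) s + c)
      ≡⟨ (let open +-*-Solver in solve 4 (λ n x y c → n :* x :+ (n :* y :+ c) := n :* (x :+ y) :+ c) refl (+ suc n) ((1+X ^ n) (suc s)) ((1+X ^ n) s) c) ⟩
    + suc n * ((1+X ^ n) (suc s) + (1+X ^ n) s) + c   ≡⟨ cong (λ z → + suc n * z + c) (sym (pascal n s)) ⟩
    + suc n * c + c ≡⟨ (let open +-*-Solver in solve 2 (λ n c → n :* c :+ c := (con (+ 1) :+ n) :* c) refl (+ suc n) c) ⟩
    + suc (suc n) * c ∎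
    where
    open ≡-Reasoning
    b = (1+X ^ suc n) (suc (suc s))
    c = (1+X ^ suc n) (suc s)

  1+X^-1 : ∀ n → (1+X ^ n) 1 ≡ + n
  1+X^-1 zero = refl
  1+X^-1 (suc n) = trans (sym (ℤₚ.*-identityˡ ((1+X ^ suc n) 1))) (trans (1+X^-absorption n 0)
    (trans (cong (+ suc n *_) (1+X^-0 n)) (ℤₚ.*-identityʳ (+ suc n))))

  -- Degrees and homogeneous forms modulo k.

  module Degree (k : ℕ) where
    open Values k public

    minus-zero : ∀ {a b c} → a ≋ b → c ≋ + 0 → a - c ≋ b
    minus-zero {b = b} p q = ≋-trans (+-cong≋ p (neg-cong≋ q)) (≡⇒≋ (ℤₚ.+-identityʳ b))

    ⊛-vanishes : ∀ f g n → (∀ i j → i ℕ.+ j ≡ n → (f i ≋ + 0) ⊎ (g j ≋ + 0)) → (f ⊛ g) n ≋ + 0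
    ⊛-vanishes f g n p = go f g n p
      where
      term : ∀ {a b} → (a ≋ + 0) ⊎ (b ≋ + 0) → a * b ≋ + 0
      term {a} {b} (inj₁ q) = ≋-trans (*-cong≋ q (≋-refl {b})) (≡⇒≋ (ℤₚ.*-zeroˡ b))
      term {a} {b} (inj₂ q) = ≋-trans (*-cong≋ (≋-refl {a}) q) (≡⇒≋ (ℤₚ.*-zeroʳ a))
      go : ∀ f g n → (∀ i j → i ℕ.+ j ≡ n → (f i ≋ + 0) ⊎ (g j ≋ + 0)) → (f ⊛ g) n ≋ + 0
      go f g zero p = term (p 0 0 refl)
      go f g (suc n) p = +-cong≋ {b = + 0} {d = + 0} (term (p 0 (suc n) refl)) (go (f ∘ suc) g n (λ i j eq → p (suc i) j (cong suc eq)))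

    Degree≤ : ℕ → Series → Set
    Degree≤ d f = ∀ s → d ℕ.< s → f s ≋ + 0

    Degree≤-⊛ : ∀ {c d f g} → Degree≤ c f → Degree≤ d g → Degree≤ (c ℕ.+ d) (f ⊛ g)
    Degree≤-⊛ {c} {d} {f} {g} p q s c+d<s = ⊛-vanishes f g s split
      where
      split : ∀ i j → i ℕ.+ j ≡ s → (f i ≋ + 0) ⊎ (g j ≋ + 0)
      split i j refl with c ℕ.<? i | d ℕ.<? j
      ... | yes c<i | _ = inj₁ (p i c<i)
      ... | no _ | yes d<j = inj₂ (q j d<j)
      ... | no c≮i | no d≮j = ⊥-elim (ℕₚ.<⇒≱ c+d<s (ℕₚ.+-mono-≤ (ℕₚ.≮⇒≥ c≮i) (ℕₚ.≮⇒≥ d≮j)))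

    Degree≤-const : ∀ a d → Degree≤ d (const a)
    Degree≤-const a d (suc s) p = ≋-refl

    Degree≤-lin : ∀ a b → Degree≤ 1 (lin a b)
    Degree≤-lin a b (suc (suc s)) p = ≋-refl
    Degree≤-lin a b (suc zero) (s≤s ())

    Degree≤-prod : ∀ g n → (∀ j → Degree≤ 1 (g j)) → Degree≤ n (prod g n)
    Degree≤-prod g zero p = Degree≤-const (+ 1) 0
    Degree≤-prod g (suc n) p = Degree≤-⊛ (p 0) (Degree≤-prod (g ∘ suc) n (p ∘ suc))

    prod-replicate : ∀ f n → prod (λ _ → f) n ≈ f ^ n
    prod-replicate f zero = ≈-refl
    prod-replicate f (suc n) = *-congˡ {x = f} (prod-replicate f n)

    -- The homogeneous polynomial Σ_{i ≤ n} c_i a^{n-i} b^i.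
    homogeneous : ℕ → Series → Series → Series → Series
    homogeneous zero c a b = const (c 0)
    homogeneous (suc n) c a b = const (c 0) ⊛ a ^ suc n ⊕ b ⊛ homogeneous n (c ∘ suc) a b

    tail-cong : ∀ {c d} → c ≈ d → c ∘ suc ≈ d ∘ suc
    tail-cong ⟪ p ⟫ = ⟪ p ∘ suc ⟫

    homogeneous-cong : ∀ n {c d} a b → c ≈ d → homogeneous n c a b ≈ homogeneous n d a b
    homogeneous-cong zero a b p = const-cong (at p 0)
    homogeneous-cong (suc n) a b p = +-cong (*-congʳ {x = a ^ suc n} (const-cong (at p 0)))
      (*-congˡ {x = b} (homogeneous-cong n a b (tail-cong p)))

    homogeneous-⊕ : ∀ n β c d a b → homogeneous n (c ⊕ β · d) a b ≈ homogeneous n c a b ⊕ const β ⊛ homogeneous n d a b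
    homogeneous-⊕ zero β c d a b = ≈-trans (const-+ (c 0) (β * d 0)) (+-congˡ {x = const (c 0)} (const-* β (d 0)))
    homogeneous-⊕ (suc n) β c d a b = begin
      const (c 0 + β * d 0) ⊛ a ^ suc n ⊕ b ⊛ homogeneous n ((c ∘ suc) ⊕ β · (d ∘ suc)) a b
        ≈⟨ +-cong (*-congʳ {x = a ^ suc n} (≈-trans (const-+ (c 0) (β * d 0)) (+-congˡ {x = const (c 0)} (const-* β (d 0)))))
             (*-congˡ {x = b} (homogeneous-⊕ n β (c ∘ suc) (d ∘ suc) a b)) ⟩
      (const (c 0) ⊕ const β ⊛ const (d 0)) ⊛ a ^ suc n ⊕ b ⊛ (hc ⊕ const β ⊛ hd)
        ≈⟨ (let open Solver in solve 7 (λ c β d a b C D → (c :+ β :* d) :* a :+ b :* (C :+ β :* D)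
             := (c :* a :+ b :* C) :+ β :* (d :* a :+ b :* D)) ≈-refl (const (c 0)) (const β) (const (d 0)) (a ^ suc n) b hc hd) ⟩
      homogeneous (suc n) c a b ⊕ const β ⊛ homogeneous (suc n) d a b ∎
      where
      open ≈-Reasoning
      hc = homogeneous n (c ∘ suc) a b
      hd = homogeneous n (d ∘ suc) a b

    homogeneous-raise : ∀ n c a b → c (suc n) ≋ + 0 → homogeneous (suc n) c a b ≈ a ⊛ homogeneous n c a b
    homogeneous-raise zero c a b p = ≈-trans
      (+-congˡ {x = const (c 0) ⊛ (a ⊛ const (+ 1))} (*-congˡ {x = b} (const-cong p)))
      (let open Solver in solve 3 (λ c a b → c :* (a :* con (+ 1)) :+ b :* con (+ 0) := a :* c) ≈-refl (const (c 0)) a b)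
    homogeneous-raise (suc n) c a b p = ≈-trans
      (+-congˡ {x = const (c 0) ⊛ a ^ suc (suc n)} (*-congˡ {x = b} (homogeneous-raise n (c ∘ suc) a b p)))
      (let open Solver in solve 5 (λ c a A b C → c :* (a :* A) :+ b :* (a :* C) := a :* (c :* A :+ b :* C)) ≈-refl
        (const (c 0)) a (a ^ suc n) b (homogeneous n (c ∘ suc) a b))

    -- `homogeneous n c` ignores the coefficients of c beyond n; when coefficient n + 1 vanishes,
    -- raising the degree by one is multiplication by a.
    homogeneous-step : ∀ n c β a b → c (suc n) ≋ + 0 →
      homogeneous (suc n) (lin (+ 1) β ⊛ c) a b ≈ (a ⊕ const β ⊛ b) ⊛ homogeneous n c a b
    homogeneous-step n c β a b p = begin
      const (+ 1 * c 0) ⊛ a ^ suc n ⊕ b ⊛ homogeneous n ((lin (+ 1) β ⊛ c) ∘ suc) a b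
        ≈⟨ +-cong (*-congʳ {x = a ^ suc n} (const-cong (≡⇒≋ (ℤₚ.*-identityˡ (c 0)))))
            (*-congˡ {x = b} (≈-trans (homogeneous-cong n a b (exact tail)) (homogeneous-⊕ n β (c ∘ suc) c a b))) ⟩
      const (c 0) ⊛ a ^ suc n ⊕ b ⊛ (homogeneous n (c ∘ suc) a b ⊕ const β ⊛ h)
        ≈⟨ (let open Solver in solve 5 (λ c b C β h → c :+ b :* (C :+ β :* h) := (c :+ b :* C) :+ (β :* b) :* h) ≈-refl
              (const (c 0) ⊛ a ^ suc n) b (homogeneous n (c ∘ suc) a b) (const β) h) ⟩
      homogeneous (suc n) c a b ⊕ const β ⊛ b ⊛ h
        ≈⟨ +-congʳ {x = const β ⊛ b ⊛ h} (homogeneous-raise n c a b p) ⟩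
      a ⊛ h ⊕ const β ⊛ b ⊛ h
        ≈⟨ (let open Solver in solve 3 (λ a b h → a :* h :+ b :* h := (a :+ b) :* h) ≈-refl a (const β ⊛ b) h) ⟩
      (a ⊕ const β ⊛ b) ⊛ h ∎
      where
      open ≈-Reasoning
      h = homogeneous n c a b
      tail : ((lin (+ 1) β ⊛ c) ∘ suc) ≗ ((c ∘ suc) ⊕ β · c)
      tail s = trans (lin-⊛ (+ 1) β c s) (cong (_+ β * c s) (ℤₚ.*-identityˡ (c (suc s))))

    -- Transfers knowledge about the coefficients of ∏ (1 + β_j x) to arbitrary a and b. It serves
    -- three times: as the binomial theorem (β = 1), for the shift of `rising`, and for the product
    -- over a full period.
    homogenise : ∀ (β : ℕ → ℤ) n a b →
      prod (λ j → a ⊕ const (β j) ⊛ b) n ≈ homogeneous n (prod (λ j → lin (+ 1) (β j)) n) a b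
    homogenise β zero a b = ≈-refl
    homogenise β (suc n) a b = ≈-trans (*-congˡ {x = a ⊕ const (β 0) ⊛ b} (homogenise (β ∘ suc) n a b))
      (≈-sym (homogeneous-step n (prod (λ j → lin (+ 1) (β (suc j))) n) (β 0) a b
        (Degree≤-prod (λ j → lin (+ 1) (β (suc j))) n (λ j → Degree≤-lin (+ 1) (β (suc j))) (suc n) (ℕₚ.n<1+n n))))

    homogeneous-top : ∀ n c a b → (∀ i → i ℕ.< n → c i ≋ + 0) → homogeneous n c a b ≈ const (c n) ⊛ b ^ n
    homogeneous-top zero c a b p = ≈-sym (⊛-identityʳ (const (c 0)))
    homogeneous-top (suc n) c a b p = ≈-trans
      (+-cong (*-congʳ {x = a ^ suc n} (const-cong (p 0 (s≤s z≤n)))) (*-congˡ {x = b} (homogeneous-top n (c ∘ suc) a b (λ i i<n → p (suc i) (s≤s i<n)))))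
      (let open Solver in solve 4 (λ A b c B → con (+ 0) :* A :+ b :* (c :* B) := c :* (b :* B)) ≈-refl (a ^ suc n) b (const (c (suc n))) (b ^ n))

    homogeneous-ends : ∀ n c a b → (∀ i → suc i ℕ.< suc n → c (suc i) ≋ + 0) →
      homogeneous (suc n) c a b ≈ const (c 0) ⊛ a ^ suc n ⊕ const (c (suc n)) ⊛ b ^ suc n
    homogeneous-ends n c a b p = +-congˡ {x = const (c 0) ⊛ a ^ suc n} (≈-trans
      (*-congˡ {x = b} (homogeneous-top n (c ∘ suc) a b (λ i i<n → p i (s≤s i<n))))
      (let open Solver in solve 3 (λ b c B → b :* (c :* B) := c :* (b :* B)) ≈-refl b (const (c (suc n))) (b ^ n)))

    -- In Σ c_i (1 + x)^(n-i) x^i the term i starts at x^i, so the first nonzero c_r is read off at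
    -- x^r. In the next coefficient, c_r is multiplied by n - r, the linear coefficient of (1 +
    -- x)^(n-r).
    homogeneous-first : ∀ r n c → r ℕ.≤ n → (∀ i → i ℕ.< r → c i ≋ + 0) → homogeneous n c 1+X X r ≋ c r
    homogeneous-first zero zero c q p = ≋-refl
    homogeneous-first zero (suc n) c q p = begin
      c 0 * (1+X ^ suc n) 0 + + 0 * homogeneous n (c ∘ suc) 1+X X 0
        ≡⟨ cong₂ _+_ (cong (c 0 *_) (1+X^-0 (suc n))) (ℤₚ.*-zeroˡ (homogeneous n (c ∘ suc) 1+X X 0)) ⟩
      c 0 * + 1 + + 0 ≡⟨ (let open +-*-Solver in solve 1 (λ c → c :* con (+ 1) :+ con (+ 0) := c) refl (c 0)) ⟩
      c 0 ∎
      where open ≋-Reasoning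
    homogeneous-first (suc r) (suc n) c (s≤s q) p = begin
      (const (c 0) ⊛ 1+X ^ suc n) (suc r) + (X ⊛ h) (suc r)
        ≈⟨ +-cong≋ (≋-trans (≡⇒≋ (const-⊛ (c 0) (1+X ^ suc n) (suc r))) (*-cong≋ (p 0 (s≤s z≤n)) (≋-refl {(1+X ^ suc n) (suc r)})))
             (≋-trans (≡⇒≋ (X-⊛ h r)) (homogeneous-first r n (c ∘ suc) q (λ i i<r → p (suc i) (s≤s i<r)))) ⟩
      + 0 * (1+X ^ suc n) (suc r) + c (suc r) ≡⟨ ℤₚ.+-identityˡ (c (suc r)) ⟩
      c (suc r) ∎
      where
      open ≋-Reasoning
      h = homogeneous n (c ∘ suc) 1+X X

    homogeneous-second : ∀ r n c → r ℕ.< n → (∀ i → i ℕ.< r → c i ≋ + 0) →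
      homogeneous n c 1+X X (suc r) ≋ c r * (+ n - + r) + c (suc r)
    homogeneous-second zero (suc n) c q p = begin
      (const (c 0) ⊛ 1+X ^ suc n) 1 + (X ⊛ h) 1
        ≈⟨ +-cong≋ (≡⇒≋ (trans (const-⊛ (c 0) (1+X ^ suc n) 1) (cong (c 0 *_) (trans (1+X^-1 (suc n)) (sym (ℤₚ.+-identityʳ (+ suc n)))))))
             (≋-trans (≡⇒≋ (X-⊛ h 0)) (homogeneous-first 0 n (c ∘ suc) z≤n (λ i ()))) ⟩
      c 0 * (+ suc n - + 0) + c 1 ∎
      where
      open ≋-Reasoning
      h = homogeneous n (c ∘ suc) 1+X X
    homogeneous-second (suc r) (suc n) c (s≤s q) p = begin
      (const (c 0) ⊛ 1+X ^ suc n) (suc (suc r)) + (X ⊛ h) (suc (suc r))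
        ≈⟨ +-cong≋ (≋-trans (≡⇒≋ (const-⊛ (c 0) (1+X ^ suc n) (suc (suc r)))) (*-cong≋ (p 0 (s≤s z≤n)) (≋-refl {(1+X ^ suc n) (suc (suc r))})))
             (≋-trans (≡⇒≋ (X-⊛ h (suc r))) (homogeneous-second r n (c ∘ suc) q (λ i i<r → p (suc i) (s≤s i<r)))) ⟩
      + 0 * (1+X ^ suc n) (suc (suc r)) + (c (suc r) * (+ n - + r) + c (suc (suc r)))
        ≡⟨ trans (ℤₚ.+-identityˡ _) (cong (λ z → c (suc r) * z + c (suc (suc r)))
             (let open +-*-Solver in solve 2 (λ n r → n :- r := (con (+ 1) :+ n) :- (con (+ 1) :+ r)) refl (+ n) (+ r))) ⟩
      c (suc r) * (+ suc n - + suc r) + c (suc (suc r)) ∎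
      where
      open ≋-Reasoning
      h = homogeneous n (c ∘ suc) 1+X X

  -- Prime modulus: the product over one period.

  module PrimeModulus (p′ : ℕ) (k-prime : Prime (suc p′)) where
    p : ℕ
    p = suc p′
    open Degree p public

    ≋-cancel : ∀ {a} n → 0 ℕ.< n → n ℕ.< p → + n * a ≋ + 0 → a ≋ + 0
    ≋-cancel {a} n 0<n n<p eq with euclidsLemma n ℤ.∣ a ∣ k-prime
      (subst (p ℕ∣.∣_) (trans (cong ℤ.∣_∣ (ℤₚ.+-identityʳ (+ n * a))) (ℤₚ.abs-* (+ n) a)) (≋⇒mod eq))
    ... | inj₁ p∣n = ⊥-elim (ℕₚ.<⇒≱ n<p (ℕ∣.∣⇒≤ {{ℕ.>-nonZero 0<n}} p∣n))
    ... | inj₂ p∣a = mod⇒≋ (subst (p ℕ∣.∣_) (cong ℤ.∣_∣ (sym (ℤₚ.+-identityʳ a))) p∣a)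

    p*≋0 : ∀ a → + p * a ≋ + 0
    p*≋0 a = ≋-trans (*-cong≋ +k≋0 (≋-refl {a})) (≡⇒≋ (ℤₚ.*-zeroˡ a))

    1+X^p-middle : ∀ s → suc s ℕ.< p → (1+X ^ p) (suc s) ≋ + 0
    1+X^p-middle s s<p = ≋-cancel (suc s) (s≤s z≤n) s<p
      (≋-trans (≡⇒≋ (1+X^-absorption p′ s)) (p*≋0 ((1+X ^ p′) s)))

    1+X^-degree : ∀ n → Degree≤ n (1+X ^ n)
    1+X^-degree zero = Degree≤-const (+ 1) 0
    1+X^-degree (suc n) = Degree≤-⊛ (Degree≤-lin (+ 1) (+ 1)) (1+X^-degree n)

    1+X^-top : ∀ n → (1+X ^ n) n ≋ + 1
    1+X^-top zero = ≋-refl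
    1+X^-top (suc n) = ≋-trans (≡⇒≋ (pascal n n)) (+-cong≋ (1+X^-degree n (suc n) (ℕₚ.n<1+n n)) (1+X^-top n))

    freshman : ∀ a b → (a ⊕ b) ^ p ≈ a ^ p ⊕ b ^ p
    freshman a b = begin
      (a ⊕ b) ^ p
        ≈⟨ ^-congˡ p (let open Solver in solve 2 (λ a b → a :+ b := a :+ con (+ 1) :* b) ≈-refl a b) ⟩
      (a ⊕ const (+ 1) ⊛ b) ^ p                ≈⟨ prod-replicate (a ⊕ const (+ 1) ⊛ b) p ⟨
      prod (λ _ → a ⊕ const (+ 1) ⊛ b) p       ≈⟨ homogenise (λ _ → + 1) p a b ⟩
      homogeneous p (prod (λ _ → 1+X) p) a b   ≈⟨ homogeneous-cong p a b (prod-replicate 1+X p) ⟩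
      homogeneous p (1+X ^ p) a b              ≈⟨ homogeneous-ends p′ (1+X ^ p) a b 1+X^p-middle ⟩
      const ((1+X ^ p) 0) ⊛ a ^ p ⊕ const ((1+X ^ p) p) ⊛ b ^ p
        ≈⟨ +-cong (*-congʳ {x = a ^ p} (const-cong (≡⇒≋ (1+X^-0 p)))) (*-congʳ {x = b ^ p} (const-cong (1+X^-top p))) ⟩
      const (+ 1) ⊛ a ^ p ⊕ const (+ 1) ⊛ b ^ p
        ≈⟨ (let open Solver in solve 2 (λ a b → con (+ 1) :* a :+ con (+ 1) :* b := a :+ b) ≈-refl (a ^ p) (b ^ p)) ⟩
      a ^ p ⊕ b ^ p ∎
      where open ≈-Reasoning

    fermat : ∀ n → const (+ n) ^ p ≈ const (+ n)
    fermat zero = let open Solver in solve 1 (λ a → con (+ 0) :* a := con (+ 0)) ≈-refl (const (+ 0) ^ p′)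
    fermat (suc n) = begin
      const (+ suc n) ^ p                  ≈⟨ ^-congˡ p (const-+ (+ 1) (+ n)) ⟩
      (const (+ 1) ⊕ const (+ n)) ^ p      ≈⟨ freshman (const (+ 1)) (const (+ n)) ⟩
      const (+ 1) ^ p ⊕ const (+ n) ^ p    ≈⟨ +-cong (1^n≈1 p) (fermat n) ⟩
      const (+ 1) ⊕ const (+ n)            ≈⟨ const-+ (+ 1) (+ n) ⟨
      const (+ suc n) ∎
      where open ≈-Reasoning

    -- Its coefficients are determined by invariance under j ↦ j + 1 (rising-shift).
    rising : Series
    rising = prod (λ j → lin (+ 1) (+ j)) p

    rising-0 : ∀ n (b : ℕ → ℤ) → prod (λ j → lin (+ 1) (b j)) n 0 ≡ + 1
    rising-0 zero b = refl
    rising-0 (suc n) b = trans (ℤₚ.*-identityˡ (prod (λ j → lin (+ 1) (b (suc j))) n 0)) (rising-0 n (b ∘ suc))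

    rising-degree : Degree≤ p′ rising
    rising-degree s q = ≋-trans (at (drop-first-factor) s)
      (Degree≤-prod (λ j → lin (+ 1) (+ suc j)) p′ (λ j → Degree≤-lin (+ 1) (+ suc j)) s q)
      where
      drop-first-factor : rising ≈ prod (λ j → lin (+ 1) (+ suc j)) p′
      drop-first-factor = ≈-trans (*-congʳ {x = prod (λ j → lin (+ 1) (+ suc j)) p′} (exact {lin (+ 1) (+ 0)} {const (+ 1)}
        (λ { zero → refl ; (suc zero) → refl ; (suc (suc n)) → refl }))) (⊛-identityˡ _)

    -- Replacing (1, x) by (1 + x, x) turns 1 + j x into 1 + (j + 1) x, which only permutes the
    -- factors modulo p.
    rising-shift : homogeneous p rising 1+X X ≈ rising
    rising-shift = begin
      homogeneous p rising 1+X X              ≈⟨ homogenise (λ j → + j) p 1+X X ⟨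
      prod (λ j → 1+X ⊕ const (+ j) ⊛ X) p    ≈⟨ prod-cong p (λ j _ → step j) ⟩
      prod (λ j → lin (+ 1) (+ suc j)) p      ≈⟨ prod-rotate (λ j → lin (+ 1) (+ j)) p (lin-cong (≋-refl {+ 1}) +k≋0) ⟩
      rising ∎
      where
      open ≈-Reasoning
      step : ∀ j → 1+X ⊕ const (+ j) ⊛ X ≈ lin (+ 1) (+ suc j)
      step j = begin
        1+X ⊕ const (+ j) ⊛ X  ≈⟨ +-congʳ {x = const (+ j) ⊛ X} (lin≈ (+ 1) (+ 1)) ⟩
        (const (+ 1) ⊕ const (+ 1) ⊛ X) ⊕ const (+ j) ⊛ X
          ≈⟨ (let open Solver in solve 2 (λ j X → (con (+ 1) :+ con (+ 1) :* X) :+ j :* X := con (+ 1) :+ (con (+ 1) :+ j) :* X) ≈-refl (const (+ j)) X) ⟩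
        const (+ 1) ⊕ (const (+ 1) ⊕ const (+ j)) ⊛ X  ≈⟨ +-congˡ {x = const (+ 1)} (*-congʳ {x = X} (const-+ (+ 1) (+ j))) ⟨
        const (+ 1) ⊕ const (+ suc j) ⊛ X  ≈⟨ lin≈ (+ 1) (+ suc j) ⟨
        lin (+ 1) (+ suc j) ∎

    -- Coefficient r + 2 of `rising-shift`. As coefficients 1 to r of `rising` vanish, only the
    -- terms 0, r + 1 and r + 2 contribute, and the last cancels against the right-hand side.
    rising-relation : ∀ r → r ℕ.< p′ → (∀ i → i ℕ.< r → rising (suc i) ≋ + 0) →
      (1+X ^ p) (suc (suc r)) + rising (suc r) * (+ p′ - + r) ≋ + 0
    rising-relation r r<p′ below = begin
      b + x
        ≡⟨ (let open +-*-Solver in solve 3 (λ b x y → b :+ x := (con (+ 1) :* b :+ (x :+ y)) :- y) refl b x y) ⟩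
      (+ 1 * b + (x + y)) - y
        ≈⟨ +-cong≋ (+-cong≋ (≡⇒≋ (cong (_* b) (sym (rising-0 p (λ j → + j))))) (≋-sym (homogeneous-second r p′ (rising ∘ suc) r<p′ below))) (≋-refl { - y}) ⟩
      (rising 0 * b + homogeneous p′ (rising ∘ suc) 1+X X (suc r)) - y
        ≡⟨ cong (_- y) (cong₂ _+_ (sym (const-⊛ (rising 0) (1+X ^ p) (suc (suc r)))) (sym (X-⊛ (homogeneous p′ (rising ∘ suc) 1+X X) (suc r)))) ⟩
      homogeneous p rising 1+X X (suc (suc r)) - y  ≈⟨ +-cong≋ (at rising-shift (suc (suc r))) (≋-refl { - y}) ⟩
      y - y  ≡⟨ ℤₚ.+-inverseʳ y ⟩
      + 0 ∎
      where
      open ≋-Reasoning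
      b = (1+X ^ p) (suc (suc r))
      x = rising (suc r) * (+ p′ - + r)
      y = rising (suc (suc r))

    rising-middle : ∀ r → suc r ℕ.< p′ → rising (suc r) ≋ + 0
    rising-middle = <-rec _ λ r rec r<p′ →
      let r<p = ℕₚ.<-trans (ℕₚ.n<1+n r) r<p′ in
      ≋-cancel (p′ ℕ.∸ r) (ℕₚ.m<n⇒0<n∸m r<p) (s≤s (ℕₚ.m∸n≤m p′ r))
        (≋-trans (≡⇒≋ (trans (ℤₚ.*-comm (+ (p′ ℕ.∸ r)) (rising (suc r))) (trans
            (cong (rising (suc r) *_) (trans (sym (ℤₚ.⊖-≥ (ℕₚ.<⇒≤ r<p))) (sym (ℤₚ.[+m]-[+n]≡m⊖n p′ r))))
            (sym (ℤₚ.+-identityˡ _)))))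
        (≋-trans (+-cong≋ (≋-sym (1+X^p-middle (suc r) (s≤s r<p′))) ≋-refl)
          (rising-relation r r<p (λ i i<r → rec i<r (ℕₚ.<-trans (s≤s i<r) r<p′)))))

    -- Wilson's theorem, since this coefficient is (p - 1)!. It is the case r + 2 = p of the
    -- relation, where (1 + x)^p contributes 1 instead of 0.
    rising-top : ∀ r → p′ ≡ suc r → rising p′ ≋ - + 1
    rising-top r refl = begin
      rising (suc r)
        ≡⟨ (let open +-*-Solver in solve 2 (λ e r → e := (con (+ 1) :+ e :* ((con (+ 1) :+ r) :- r)) :- con (+ 1)) refl (rising (suc r)) (+ r)) ⟩
      (+ 1 + rising (suc r) * (+ suc r - + r)) - + 1
        ≈⟨ +-cong≋ (≋-trans (+-cong≋ (≋-sym (1+X^-top p)) ≋-refl) (rising-relation r (ℕₚ.n<1+n r) (λ i i<r → rising-middle i (s≤s i<r)))) (≋-refl { - + 1}) ⟩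
      - + 1 ∎
      where open ≋-Reasoning

    Φ : Series
    Φ = const (+ 1) ⊕ ⊝ (Y ^ p′)

    -- `rising` ≡ 1 - x^(p-1) makes the product n (n^(p-1) - y^(p-1)). Fermat's theorem is used in
    -- the form n^p ≡ n, which includes the multiples of p.
    factors-full : ∀ n → factors (+ n) p ≈ const (+ n) ⊛ Φ
    factors-full n = begin
      factors (+ n) p   ≈⟨ prod-cong p (λ j _ → factor≈ (+ n) j) ⟩
      prod (λ j → N ⊕ const (+ j) ⊛ Y) p  ≈⟨ homogenise (λ j → + j) p N Y ⟩
      homogeneous p rising N Y            ≈⟨ homogeneous-raise p′ rising N Y (rising-degree p (ℕₚ.n<1+n p′)) ⟩
      N ⊛ homogeneous p′ rising N Y       ≈⟨ *-congˡ {x = N} (ends p′ refl) ⟩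
      N ⊛ (const (+ 1) ⊛ N ^ p′ ⊕ const (- + 1) ⊛ Y ^ p′)
        ≈⟨ (let open Solver in solve 3 (λ N A B → N :* (con (+ 1) :* A :+ con (- + 1) :* B) := N :* A :+ :- (N :* B)) ≈-refl N (N ^ p′) (Y ^ p′)) ⟩
      N ^ p ⊕ ⊝ (N ⊛ Y ^ p′)  ≈⟨ +-congʳ {x = ⊝ (N ⊛ Y ^ p′)} (fermat n) ⟩
      N ⊕ ⊝ (N ⊛ Y ^ p′)      ≈⟨ (let open Solver in solve 2 (λ N B → N :+ :- (N :* B) := N :* (con (+ 1) :+ :- B)) ≈-refl N (Y ^ p′)) ⟩
      N ⊛ Φ ∎
      where
      open ≈-Reasoning
      N = const (+ n)
      ends : ∀ q → p′ ≡ q → homogeneous p′ rising N Y ≈ const (+ 1) ⊛ N ^ p′ ⊕ const (- + 1) ⊛ Y ^ p′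
      ends zero eq = ⊥-elim (¬prime[1] (subst (λ q → Prime (suc q)) eq k-prime))
      ends (suc r) refl = ≈-trans (homogeneous-ends r rising N Y (λ i i<r → rising-middle i i<r))
        (+-cong (*-congʳ {x = N ^ p′} (const-cong (≡⇒≋ (rising-0 p (λ j → + j))))) (*-congʳ {x = Y ^ p′} (const-cong (rising-top r refl))))

    -- Read from y + 1 = x, so that no sign (-1)^p appears and p = 2 needs no special case.
    Y^p≈ : Y ^ p ≈ X ^ p ⊕ ⊝ const (+ 1)
    Y^p≈ = begin
      Y ^ p  ≈⟨ (let open Solver in solve 1 (λ Y → Y := (Y :+ con (+ 1)) :+ :- con (+ 1)) ≈-refl (Y ^ p)) ⟩
      (Y ^ p ⊕ const (+ 1)) ⊕ ⊝ const (+ 1)        ≈⟨ +-congʳ {x = ⊝ const (+ 1)} (+-congˡ {x = Y ^ p} (1^n≈1 p)) ⟨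
      (Y ^ p ⊕ const (+ 1) ^ p) ⊕ ⊝ const (+ 1)    ≈⟨ +-congʳ {x = ⊝ const (+ 1)} (freshman Y (const (+ 1))) ⟨
      (Y ⊕ const (+ 1)) ^ p ⊕ ⊝ const (+ 1)        ≈⟨ +-congʳ {x = ⊝ const (+ 1)} (^-congˡ p Y+1) ⟩
      X ^ p ⊕ ⊝ const (+ 1) ∎
      where
      open ≈-Reasoning
      Y+1 : Y ⊕ const (+ 1) ≈ X
      Y+1 = exact (λ { zero → refl ; (suc zero) → refl ; (suc (suc n)) → refl })

    YΦ≈ : Y ⊛ Φ ≈ X ⊕ ⊝ (X ^ p)
    YΦ≈ = begin
      Y ⊛ Φ             ≈⟨ (let open Solver in solve 2 (λ Y B → Y :* (con (+ 1) :+ :- B) := Y :+ :- (Y :* B)) ≈-refl Y (Y ^ p′)) ⟩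
      Y ⊕ ⊝ (Y ^ p)     ≈⟨ +-cong (lin≈ (- + 1) (+ 1)) (⊝-cong Y^p≈) ⟩
      (const (- + 1) ⊕ const (+ 1) ⊛ X) ⊕ ⊝ (X ^ p ⊕ ⊝ const (+ 1))
        ≈⟨ (let open Solver in solve 2 (λ X B → (con (- + 1) :+ con (+ 1) :* X) :+ :- (B :+ :- con (+ 1)) := X :+ :- B) ≈-refl X (X ^ p)) ⟩
      X ⊕ ⊝ (X ^ p) ∎
      where open ≈-Reasoning

  -- Prime modulus: the coefficients of y Φ^a.

  <-by : ∀ {a b} c → b ≡ suc (a ℕ.+ c) → a ℕ.< b
  <-by {a} c refl = s≤s (ℕₚ.m≤m+n a c)

  ≤-gap : ∀ {a b} → a ℕ.≤ b → ∃ λ c → b ≡ a ℕ.+ c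
  ≤-gap {a} {b} a≤b = b ℕ.∸ a , sym (ℕₚ.m+[n∸m]≡n a≤b)

  module Coefficients (p′ : ℕ) (k-prime : Prime (suc p′)) where
    open PrimeModulus p′ k-prime public

    X^-self : ∀ n → (X ^ n) n ≋ + 1
    X^-self n = begin
      (X ^ n) n                          ≈⟨ at (⊛-identityʳ (X ^ n)) n ⟨
      (X ^ n ⊛ const (+ 1)) n            ≡⟨ cong (X ^ n ⊛ const (+ 1)) (sym (ℕₚ.+-identityʳ n)) ⟩
      (X ^ n ⊛ const (+ 1)) (n ℕ.+ 0)    ≈⟨ X^-⊛ n (const (+ 1)) 0 ⟩
      + 1 ∎
      where open ≋-Reasoning

    X^-other : ∀ n s → s ≢ n → (X ^ n) s ≋ + 0
    X^-other n s s≢n = ≋-trans (≋-sym (at (⊛-identityʳ (X ^ n)) s)) (go (ℕₚ.≤-<-connex n s))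
      where
      go : (n ℕ.≤ s) ⊎ (s ℕ.< n) → (X ^ n ⊛ const (+ 1)) s ≋ + 0
      go (inj₂ s<n) = X^-⊛-low n (const (+ 1)) s s<n
      go (inj₁ n≤s) with ≤-gap n≤s
      ... | zero , refl = ⊥-elim (s≢n (ℕₚ.+-identityʳ n))
      ... | suc c , refl = X^-⊛ n (const (+ 1)) (suc c)

    X^p-1 : Series
    X^p-1 = X ^ p ⊕ ⊝ const (+ 1)

    private
      expand : ∀ C → X^p-1 ⊛ C ≈ X ^ p ⊛ C ⊕ ⊝ C
      expand C = let open Solver in solve 2 (λ P C → (P :+ :- con (+ 1)) :* C := P :* C :+ :- C) ≈-refl (X ^ p) C

    -- The divisor x^p - 1 has constant term -1, so a quotient is determined separately in each
    -- residue class modulo p: it starts with -A and goes on subtracting A in steps of p.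
    divide-low : ∀ {C A} → X^p-1 ⊛ C ≈ A → ∀ s → s ℕ.< p → C s ≋ - A s
    divide-low {C} {A} eq s s<p = begin
      C s                          ≡⟨ (let open +-*-Solver in solve 1 (λ c → c := :- (con (+ 0) :- c)) refl (C s)) ⟩
      - (+ 0 - C s)                ≈⟨ neg-cong≋ (+-cong≋ (X^-⊛-low p C s s<p) (≋-refl { - C s})) ⟨
      - ((X ^ p ⊛ C) s - C s)      ≈⟨ neg-cong≋ (at (≈-trans (≈-sym (expand C)) eq) s) ⟩
      - A s ∎
      where open ≋-Reasoning

    divide-high : ∀ {C A} → X^p-1 ⊛ C ≈ A → ∀ s → C (p ℕ.+ s) ≋ C s - A (p ℕ.+ s)
    divide-high {C} {A} eq s = begin
      C (p ℕ.+ s)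
        ≡⟨ (let open +-*-Solver in solve 2 (λ c d → d := c :- (c :- d)) refl (C s) (C (p ℕ.+ s))) ⟩
      C s - (C s - C (p ℕ.+ s))
        ≈⟨ +-cong≋ (≋-refl {C s}) (neg-cong≋ (+-cong≋ (X^-⊛ p C s) (≋-refl { - C (p ℕ.+ s)}))) ⟨
      C s - ((X ^ p ⊛ C) (p ℕ.+ s) - C (p ℕ.+ s))
        ≈⟨ +-cong≋ (≋-refl {C s}) (neg-cong≋ (at (≈-trans (≈-sym (expand C)) eq) (p ℕ.+ s))) ⟩
      C s - A (p ℕ.+ s) ∎
      where open ≋-Reasoning

    Y-⊛ : ∀ f n → (Y ⊛ f) (suc n) ≡ f n - f (suc n)
    Y-⊛ f n = trans (lin-⊛ (- + 1) (+ 1) f n)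
      (let open +-*-Solver in solve 2 (λ a b → con (- + 1) :* a :+ con (+ 1) :* b := b :- a) refl (f (suc n)) (f n))

    Y^-degree : ∀ n → Degree≤ n (Y ^ n)
    Y^-degree zero = Degree≤-const (+ 1) 0
    Y^-degree (suc n) = Degree≤-⊛ (Degree≤-lin (- + 1) (+ 1)) (Y^-degree n)

    Y^-top : ∀ n → (Y ^ n) n ≋ + 1
    Y^-top zero = ≋-refl
    Y^-top (suc n) = ≋-trans (≡⇒≋ (Y-⊛ (Y ^ n) n)) (+-cong≋ (Y^-top n) (neg-cong≋ (Y^-degree n (suc n) (ℕₚ.n<1+n n))))

    Y^-next : ∀ n → (Y ^ suc n) n ≋ - + suc n
    Y^-next zero = ≋-refl
    Y^-next (suc n) = ≋-trans (≡⇒≋ (Y-⊛ (Y ^ suc n) n)) (≋-trans (+-cong≋ (Y^-next n) (neg-cong≋ (Y^-top (suc n))))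
      (≡⇒≋ (let open +-*-Solver in solve 1 (λ n → (:- n) :- con (+ 1) := :- (con (+ 1) :+ n)) refl (+ suc n))))

    1-X^p′ : Series
    1-X^p′ = const (+ 1) ⊕ ⊝ (X ^ p′)

    YΦ≈X[1-X^p′] : Y ⊛ Φ ≈ X ⊛ 1-X^p′
    YΦ≈X[1-X^p′] = ≈-trans YΦ≈
      (let open Solver in solve 2 (λ X P → X :+ :- (X :* P) := X :* (con (+ 1) :+ :- P)) ≈-refl X (X ^ p′))

    -- For a ≤ p + 1: (x^p - 1) y Φ^a = (y Φ)^a y^(p+1-a), where (y Φ)^a = x^a (1 - x^(p-1))^a is sparse.
    module SmallExponent (a e : ℕ) (a+e≡1+p : suc p ≡ a ℕ.+ e) where

      H : Series
      H = X ^ a ⊛ Y ^ e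

      A : ℕ → Series
      A zero = H
      A (suc n) = A n ⊕ ⊝ (X ^ p′ ⊛ A n)

      A≈ : ∀ n → A n ≈ H ⊛ 1-X^p′ ^ n
      A≈ zero = ≈-sym (⊛-identityʳ H)
      A≈ (suc n) = ≈-trans (+-cong (A≈ n) (⊝-cong (*-congˡ {x = X ^ p′} (A≈ n))))
        (let open Solver in solve 3 (λ H P Z → H :* Z :+ :- (P :* (H :* Z)) := H :* ((con (+ 1) :+ :- P) :* Z)) ≈-refl H (X ^ p′) (1-X^p′ ^ n))

      A-step : ∀ n {t} s → t ≡ p′ ℕ.+ s → A (suc n) t ≋ A n t - A n s
      A-step n s refl = +-cong≋ (≋-refl {A n (p′ ℕ.+ s)}) (neg-cong≋ (X^-⊛ p′ (A n) s))

      A-low : ∀ n s → s ℕ.< a → A n s ≋ + 0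
      A-low n s s<a = ≋-trans (at (≈-trans (A≈ n) (*-assoc (X ^ a) (Y ^ e) (1-X^p′ ^ n))) s)
        (X^-⊛-low a (Y ^ e ⊛ 1-X^p′ ^ n) s s<a)

      H-high : ∀ s → suc p ℕ.< s → H s ≋ + 0
      H-high s 1+p<s with ≤-gap {a} (ℕₚ.≤-trans (ℕₚ.m≤m+n a e) (ℕₚ.<⇒≤ (subst (ℕ._< s) a+e≡1+p 1+p<s)))
      ... | c , refl = ≋-trans (X^-⊛ a (Y ^ e) c) (Y^-degree e c (ℕₚ.+-cancelˡ-< a e c (subst (ℕ._< a ℕ.+ c) a+e≡1+p 1+p<s)))

      H-1+p : H (suc p) ≋ + 1
      H-1+p = subst (λ n → H n ≋ + 1) (sym a+e≡1+p) (≋-trans (X^-⊛ a (Y ^ e) e) (Y^-top e))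

      H-p : H p ≋ - + e
      H-p = go e refl
        where
        go : ∀ e′ → e ≡ e′ → H p ≋ - + e′
        go zero refl = A-low 0 p (subst (p ℕ.<_) (trans a+e≡1+p (ℕₚ.+-identityʳ a)) (ℕₚ.n<1+n p))
        go (suc e′) refl = subst (λ n → H n ≋ - + suc e′) (sym (ℕₚ.suc-injective (trans a+e≡1+p (ℕₚ.+-suc a e′))))
          (≋-trans (X^-⊛ a (Y ^ suc e′) e′) (Y^-next e′))

      A-p : 1 ℕ.< a → ∀ n → A n p ≋ - + e
      A-p 1<a zero = H-p
      A-p 1<a (suc n) = ≋-trans (A-step n 1 (ℕₚ.+-comm 1 p′)) (minus-zero (A-p 1<a n) (A-low n 1 1<a))

      A-1+p : 2 ℕ.< a → ∀ n → A n (suc p) ≋ + 1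
      A-1+p 2<a zero = H-1+p
      A-1+p 2<a (suc n) = ≋-trans (A-step n 2 (ℕₚ.+-comm 2 p′)) (minus-zero (A-1+p 2<a n) (A-low n 2 2<a))

      -- As 2p = p′ + (p + 1), every step subtracts the leading coefficient 1 of H once.
      A-2p : 1 ℕ.< p → 2 ℕ.< a → ∀ n → A n (p ℕ.+ p) ≋ - + n
      A-2p 1<p 2<a zero = H-high (p ℕ.+ p) (ℕₚ.+-monoˡ-< p 1<p)
      A-2p 1<p 2<a (suc n) = ≋-trans (A-step n (suc p) (sym (ℕₚ.+-suc p′ p)))
        (≋-trans (+-cong≋ (A-2p 1<p 2<a n) (neg-cong≋ (A-1+p 2<a n)))
          (≡⇒≋ (let open +-*-Solver in solve 1 (λ n → (:- n) :- con (+ 1) := :- (con (+ 1) :+ n)) refl (+ n))))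

      -- Multiplication by 1 - x^p′ links indices that differ by p′. The chain u, u + p′, u + 2p′,
      -- ... starts below the order a of H and, as u > 2, jumps past its degree p + 1, so it meets
      -- no coefficient of H.
      A-gap : ∀ u → 2 ℕ.< u → u ℕ.< a → ∀ n i → A n (i ℕ.* p′ ℕ.+ (p′ ℕ.+ u)) ≋ + 0
      A-gap u 2<u u<a zero i = H-high _ (ℕₚ.<-≤-trans
        (subst (ℕ._< p′ ℕ.+ u) (ℕₚ.+-comm p′ 2) (ℕₚ.+-monoʳ-< p′ 2<u)) (ℕₚ.m≤n+m (p′ ℕ.+ u) (i ℕ.* p′)))
      A-gap u 2<u u<a (suc n) zero = ≋-trans (A-step n u refl) (minus-zero (A-gap u 2<u u<a n zero) (A-low n u u<a))
      A-gap u 2<u u<a (suc n) (suc i) = ≋-trans (A-step n (i ℕ.* p′ ℕ.+ (p′ ℕ.+ u)) (ℕₚ.+-assoc p′ (i ℕ.* p′) (p′ ℕ.+ u)))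
        (minus-zero (A-gap u 2<u u<a n (suc i)) (A-gap u 2<u u<a n i))

      C : Series
      C = Y ⊛ Φ ^ a

      C-relation : X^p-1 ⊛ C ≈ A a
      C-relation = begin
        X^p-1 ⊛ (Y ⊛ Φ ^ a)           ≈⟨ *-congʳ {x = Y ⊛ Φ ^ a} Y^p≈ ⟨
        Y ^ p ⊛ (Y ⊛ Φ ^ a)           ≈⟨ (let open Solver in solve 3 (λ P Y F → P :* (Y :* F) := (Y :* P) :* F) ≈-refl (Y ^ p) Y (Φ ^ a)) ⟩
        Y ^ suc p ⊛ Φ ^ a             ≈⟨ *-congʳ {x = Φ ^ a} (≈-trans (^-congʳ Y a+e≡1+p) (^-homo-* Y a e)) ⟩
        (Y ^ a ⊛ Y ^ e) ⊛ Φ ^ a       ≈⟨ (let open Solver in solve 3 (λ A E F → (A :* E) :* F := (A :* F) :* E) ≈-refl (Y ^ a) (Y ^ e) (Φ ^ a)) ⟩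
        (Y ^ a ⊛ Φ ^ a) ⊛ Y ^ e       ≈⟨ *-congʳ {x = Y ^ e} (≈-trans (≈-sym (^-distrib-* Y Φ a)) (≈-trans (^-congˡ a YΦ≈X[1-X^p′]) (^-distrib-* X 1-X^p′ a))) ⟩
        (X ^ a ⊛ 1-X^p′ ^ a) ⊛ Y ^ e
          ≈⟨ (let open Solver in solve 3 (λ A E F → (A :* E) :* F := (A :* F) :* E) ≈-refl (X ^ a) (1-X^p′ ^ a) (Y ^ e)) ⟩
        H ⊛ 1-X^p′ ^ a                ≈⟨ A≈ a ⟨
        A a ∎
        where open ≈-Reasoning

      C-p : 1 ℕ.< a → C p ≋ + e
      C-p 1<a = begin
        C p                           ≡⟨ cong C (sym (ℕₚ.+-identityʳ p)) ⟩
        C (p ℕ.+ 0)                   ≈⟨ divide-high C-relation 0 ⟩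
        C 0 - A a (p ℕ.+ 0)
          ≈⟨ +-cong≋ (≋-trans (divide-low C-relation 0 (s≤s z≤n)) (neg-cong≋ (A-low a 0 (ℕₚ.<-trans (s≤s z≤n) 1<a))))
               (neg-cong≋ (≋-trans (≡⇒≋ (cong (A a) (ℕₚ.+-identityʳ p))) (A-p 1<a a))) ⟩
        - + 0 - (- + e)               ≡⟨ (let open +-*-Solver in solve 1 (λ e → con (- + 0) :- (:- e) := e) refl (+ e)) ⟩
        + e ∎
        where open ≋-Reasoning

      -- C_p ≡ e, and the step to 2p subtracts -a, giving e + a = p + 1 ≡ 1. After that `A-gap`
      -- keeps the value, because (t + 3) p = (t + 3) p′ + (t + 3) lies on the chain of u = t + 3.
      C-multiple : 1 ℕ.< p → ∀ t → suc (suc t) ℕ.< a → C (suc (suc t) ℕ.* p) ≋ + 1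
      C-multiple 1<p zero 2<a = begin
        C (p ℕ.+ (p ℕ.+ 0))     ≡⟨ cong (λ n → C (p ℕ.+ n)) (ℕₚ.+-identityʳ p) ⟩
        C (p ℕ.+ p)             ≈⟨ divide-high C-relation p ⟩
        C p - A a (p ℕ.+ p)     ≈⟨ +-cong≋ (C-p (ℕₚ.<-trans (s≤s (s≤s z≤n)) 2<a)) (neg-cong≋ (A-2p 1<p 2<a a)) ⟩
        + e - (- + a)           ≡⟨ (let open +-*-Solver in solve 2 (λ e a → e :- (:- a) := a :+ e) refl (+ e) (+ a)) ⟩
        + a + + e               ≡⟨ trans (sym (ℤₚ.pos-+ a e)) (cong +_ (sym a+e≡1+p)) ⟩
        + suc p                 ≈⟨ +-cong≋ (≋-refl {+ 1}) +k≋0 ⟩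
        + 1 ∎
        where open ≋-Reasoning
      C-multiple 1<p (suc t) 3+t<a = begin
        C (p ℕ.+ suc (suc t) ℕ.* p)   ≈⟨ divide-high C-relation (suc (suc t) ℕ.* p) ⟩
        C (suc (suc t) ℕ.* p) - A a (suc (suc (suc t)) ℕ.* p)
          ≈⟨ minus-zero (C-multiple 1<p t (ℕₚ.<-trans (ℕₚ.n<1+n _) 3+t<a))
               (subst (λ n → A a n ≋ + 0) index (A-gap (suc (suc (suc t))) (s≤s (s≤s (s≤s z≤n))) 3+t<a a (suc (suc t)))) ⟩
        + 1 ∎
        where
        open ≋-Reasoning
        index : suc (suc t) ℕ.* p′ ℕ.+ (p′ ℕ.+ suc (suc (suc t))) ≡ suc (suc (suc t)) ℕ.* p
        index = let open ℕ-Solver in solve 2 (λ t p → (con 2 :+ t) :* p :+ (p :+ (con 3 :+ t)) := (con 3 :+ t) :* (con 1 :+ p)) refl t p′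

  -- For exponents p + d: Φ^p is sparse, and Φ^d = 1 + y^(p-1) Q_d gives y Φ^(p+d) = y Φ^p + (x^p - x^(p²)) Q_d.
  module LargeExponent (p′ : ℕ) (k-prime : Prime (suc p′)) (1<p : 1 ℕ.< suc p′) where
    open Coefficients p′ k-prime

    p² : ℕ
    p² = p ℕ.* p

    0<p′ : 0 ℕ.< p′
    0<p′ = ℕₚ.≤-pred 1<p

    K J : Series
    K = Φ ^ p
    J = X ^ p ⊕ ⊝ (X ^ p²)

    Y^p⊛K≈J : Y ^ p ⊛ K ≈ J
    Y^p⊛K≈J = begin
      Y ^ p ⊛ Φ ^ p        ≈⟨ ^-distrib-* Y Φ p ⟨
      (Y ⊛ Φ) ^ p          ≈⟨ ^-congˡ p YΦ≈ ⟩
      D ^ p                ≈⟨ (let open Solver in solve 2 (λ D P → D := (D :+ P) :+ :- P) ≈-refl (D ^ p) ((X ^ p) ^ p)) ⟩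
      (D ^ p ⊕ (X ^ p) ^ p) ⊕ ⊝ ((X ^ p) ^ p)
        ≈⟨ +-cong (≈-trans (≈-sym (freshman D (X ^ p))) (^-congˡ p
             (let open Solver in solve 2 (λ X P → (X :+ :- P) :+ P := X) ≈-refl X (X ^ p)))) (⊝-cong (^-assocʳ X p p)) ⟩
      J ∎
      where
      open ≈-Reasoning
      D = X ⊕ ⊝ (X ^ p)

    K-relation : X^p-1 ⊛ K ≈ J
    K-relation = ≈-trans (*-congʳ {x = K} (≈-sym Y^p≈)) Y^p⊛K≈J

    J-zero : ∀ s → s ≢ p → s ≢ p² → J s ≋ + 0
    J-zero s s≢p s≢p² = +-cong≋ {b = + 0} {d = + 0} (X^-other p s s≢p) (neg-cong≋ {b = + 0} (X^-other p² s s≢p²))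

    p<p² : p ℕ.< p²
    p<p² = subst (ℕ._< p²) (ℕₚ.+-identityʳ p) (ℕₚ.+-monoʳ-< p (ℕₚ.<-≤-trans 0<p′ (ℕₚ.m≤m*n p′ p)))

    -- Dividing x^p - x^(p²) by x^p - 1 shows K ≡ -(x^p + x^(2p) + ... + x^((p-1)p)); this and the
    -- next lemmas on K read off its coefficients.
    K-low : ∀ s → s ℕ.< p → K s ≋ + 0
    K-low s s<p = ≋-trans (divide-low K-relation s s<p)
      (neg-cong≋ (J-zero s (ℕₚ.<⇒≢ s<p) (ℕₚ.<⇒≢ (ℕₚ.<-trans s<p p<p²))))

    not-multiple : ∀ t r → 0 ℕ.< r → r ℕ.< p → t ℕ.* p ℕ.+ r ≢ p²
    not-multiple t r 0<r r<p eq with ℕₚ.≤-<-connex p t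
    ... | inj₁ p≤t = ℕₚ.<⇒≢ (ℕₚ.≤-<-trans (ℕₚ.*-monoˡ-≤ p p≤t) (ℕₚ.m<m+n (t ℕ.* p) 0<r)) (sym eq)
    ... | inj₂ t<p = ℕₚ.<⇒≢ (ℕₚ.<-≤-trans (ℕₚ.+-monoʳ-< (t ℕ.* p) r<p)
      (subst (ℕ._≤ p²) (ℕₚ.+-comm p (t ℕ.* p)) (ℕₚ.*-monoˡ-≤ p t<p))) eq

    K-off : ∀ t r → 0 ℕ.< r → r ℕ.< p → K (t ℕ.* p ℕ.+ r) ≋ + 0
    K-off zero r 0<r r<p = K-low r r<p
    K-off (suc t) r 0<r r<p = ≋-trans (≡⇒≋ (cong K assoc)) (≋-trans (divide-high K-relation (t ℕ.* p ℕ.+ r))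
      (minus-zero (K-off t r 0<r r<p) (J-zero (p ℕ.+ (t ℕ.* p ℕ.+ r))
        (λ eq → ℕₚ.<⇒≢ (ℕₚ.<-≤-trans 0<r (ℕₚ.m≤n+m r (t ℕ.* p))) (sym (ℕₚ.+-cancelˡ-≡ p _ 0 (trans eq (sym (ℕₚ.+-identityʳ p))))))
        (λ eq → not-multiple (suc t) r 0<r r<p (trans assoc eq)))))
      where
      assoc : suc t ℕ.* p ℕ.+ r ≡ p ℕ.+ (t ℕ.* p ℕ.+ r)
      assoc = ℕₚ.+-assoc p (t ℕ.* p) r

    K-multiple : ∀ t → suc t ℕ.< p → K (suc t ℕ.* p) ≋ - + 1
    K-multiple zero _ = ≋-trans (divide-high K-relation 0) (+-cong≋ (K-low 0 (s≤s z≤n))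
      (neg-cong≋ {b = + 1} (+-cong≋ (subst (λ n → (X ^ p) n ≋ + 1) (sym (ℕₚ.+-identityʳ p)) (X^-self p))
        (neg-cong≋ {b = + 0} (X^-other p² (p ℕ.+ 0) (λ eq → ℕₚ.<⇒≢ p<p² (trans (sym (ℕₚ.+-identityʳ p)) eq)))))))
    K-multiple (suc t) 2+t<p = ≋-trans (divide-high K-relation (suc t ℕ.* p))
      (minus-zero (K-multiple t (ℕₚ.<-trans (ℕₚ.n<1+n _) 2+t<p)) (J-zero (suc (suc t) ℕ.* p)
        (λ eq → ℕₚ.<⇒≢ {1} {suc (suc t)} (s≤s (s≤s z≤n)) (ℕₚ.*-cancelʳ-≡ 1 (suc (suc t)) p (trans (ℕₚ.*-identityˡ p) (sym eq))))
        (λ eq → ℕₚ.<⇒≢ 2+t<p (ℕₚ.*-cancelʳ-≡ (suc (suc t)) p p eq))))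

    K-p² : K p² ≋ + 0
    K-p² = go p′ refl 0<p′
      where
      go : ∀ q → p′ ≡ q → 0 ℕ.< q → K p² ≋ + 0
      go (suc t) refl _ = ≋-trans (divide-high K-relation (suc t ℕ.* p)) (+-cong≋ (K-multiple t (ℕₚ.n<1+n (suc t)))
        (neg-cong≋ {b = - + 1} (+-cong≋ (X^-other p p² (λ eq → ℕₚ.<⇒≢ p<p² (sym eq))) (neg-cong≋ {b = + 1} (X^-self p²)))))

    K-p+p² : K (suc p ℕ.* p) ≋ + 0
    K-p+p² = ≋-trans (divide-high K-relation p²) (minus-zero K-p² (J-zero (p ℕ.+ p²)
      (λ eq → ℕₚ.<⇒≢ (ℕₚ.<-trans (s≤s z≤n) p<p²) (sym (ℕₚ.+-cancelˡ-≡ p _ 0 (trans eq (sym (ℕₚ.+-identityʳ p))))))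
      (λ eq → ℕₚ.<⇒≢ (ℕₚ.m<n+m p² (s≤s z≤n)) (sym eq))))

    YK-multiple : ∀ t → (Y ⊛ K) (suc t ℕ.* p) ≋ - K (suc t ℕ.* p)
    YK-multiple t = ≋-trans (≡⇒≋ (Y-⊛ K (p′ ℕ.+ t ℕ.* p)))
      (≋-trans (+-cong≋ (≋-trans (≡⇒≋ (cong K (ℕₚ.+-comm p′ (t ℕ.* p)))) (K-off t p′ 0<p′ (ℕₚ.n<1+n p′))) (≋-refl { - K (suc t ℕ.* p)}))
        (≡⇒≋ (ℤₚ.+-identityˡ _)))

    YK-off : ∀ t s → 1 ℕ.< s → s ℕ.< p → (Y ⊛ K) (t ℕ.* p ℕ.+ s) ≋ + 0
    YK-off t (suc s) (s≤s 0<s) 1+s<p = ≋-trans (≡⇒≋ (cong (Y ⊛ K) (ℕₚ.+-suc (t ℕ.* p) s)))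
      (≋-trans (≡⇒≋ (Y-⊛ K (t ℕ.* p ℕ.+ s)))
      (minus-zero (K-off t s 0<s (ℕₚ.<-trans (ℕₚ.n<1+n s) 1+s<p))
        (≋-trans (≡⇒≋ (cong K (sym (ℕₚ.+-suc (t ℕ.* p) s)))) (K-off t (suc s) (s≤s z≤n) 1+s<p))))

    Q : ℕ → Series
    Q zero = const (+ 0)
    Q (suc d) = Q d ⊛ Φ ⊕ ⊝ const (+ 1)

    Φ-degree : Degree≤ p′ Φ
    Φ-degree (suc s) p′<s = minus-zero (≋-refl {+ 0}) (Y^-degree p′ (suc s) p′<s)

    -- The degree bound (d - 1) p′, with p′ added on both sides to avoid truncated subtraction at d
    -- = 0.
    Q-degree : ∀ d s → d ℕ.* p′ ℕ.< s ℕ.+ p′ → Q d s ≋ + 0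
    Q-degree zero zero _ = ≋-refl
    Q-degree zero (suc s) _ = ≋-refl
    Q-degree (suc d) zero q = ⊥-elim (ℕₚ.<⇒≱ q (ℕₚ.m≤m+n p′ (d ℕ.* p′)))
    Q-degree (suc d) s@(suc _) q = minus-zero {c = + 0} (⊛-vanishes (Q d) Φ s split) ≋-refl
      where
      split : ∀ i j → i ℕ.+ j ≡ s → (Q d i ≋ + 0) ⊎ (Φ j ≋ + 0)
      split i j eq with ℕₚ.≤-<-connex j p′
      ... | inj₂ p′<j = inj₂ (Φ-degree j p′<j)
      ... | inj₁ j≤p′ = inj₁ (Q-degree d i (ℕₚ.<-≤-trans
        (ℕₚ.+-cancelˡ-< p′ (d ℕ.* p′) s (subst (p′ ℕ.+ d ℕ.* p′ ℕ.<_) (ℕₚ.+-comm s p′) q))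
        (subst (ℕ._≤ i ℕ.+ p′) eq (ℕₚ.+-monoʳ-≤ i j≤p′))))

    Φ^d≈ : ∀ d → Φ ^ d ≈ const (+ 1) ⊕ Y ^ p′ ⊛ Q d
    Φ^d≈ zero = let open Solver in solve 1 (λ w → con (+ 1) := con (+ 1) :+ w :* con (+ 0)) ≈-refl (Y ^ p′)
    Φ^d≈ (suc d) = ≈-trans (*-congˡ {x = Φ} (Φ^d≈ d))
      (let open Solver in solve 2 (λ w Q → (con (+ 1) :+ :- w) :* (con (+ 1) :+ w :* Q)
         := con (+ 1) :+ w :* (Q :* (con (+ 1) :+ :- w) :+ :- con (+ 1))) ≈-refl (Y ^ p′) (Q d))

    decomposition : ∀ d → Y ⊛ Φ ^ (p ℕ.+ d) ≈ Y ⊛ K ⊕ (X ^ p ⊛ Q d ⊕ ⊝ (X ^ p² ⊛ Q d))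
    decomposition d = begin
      Y ⊛ Φ ^ (p ℕ.+ d)                              ≈⟨ *-congˡ {x = Y} (≈-trans (^-homo-* Φ p d) (*-congˡ {x = K} (Φ^d≈ d))) ⟩
      Y ⊛ (K ⊛ (const (+ 1) ⊕ Y ^ p′ ⊛ Q d))
        ≈⟨ (let open Solver in solve 4 (λ Y K w Q → Y :* (K :* (con (+ 1) :+ w :* Q)) := Y :* K :+ ((Y :* w) :* K) :* Q) ≈-refl Y K (Y ^ p′) (Q d)) ⟩
      Y ⊛ K ⊕ (Y ^ p ⊛ K) ⊛ Q d                      ≈⟨ +-congˡ {x = Y ⊛ K} (*-congʳ {x = Q d} Y^p⊛K≈J) ⟩
      Y ⊛ K ⊕ J ⊛ Q d
        ≈⟨ +-congˡ {x = Y ⊛ K} (let open Solver in solve 3 (λ A B Q → (A :+ :- B) :* Q := A :* Q :+ :- (B :* Q)) ≈-refl (X ^ p) (X ^ p²) (Q d)) ⟩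
      Y ⊛ K ⊕ (X ^ p ⊛ Q d ⊕ ⊝ (X ^ p² ⊛ Q d)) ∎
      where open ≈-Reasoning

    Q-relation : ∀ d → X^p-1 ⊛ Q d ≈ Y ⊛ Φ ^ d ⊕ ⊝ Y
    Q-relation d = begin
      X^p-1 ⊛ Q d               ≈⟨ *-congʳ {x = Q d} Y^p≈ ⟨
      Y ^ p ⊛ Q d
        ≈⟨ (let open Solver in solve 3 (λ Y w Q → (Y :* w) :* Q := Y :* (con (+ 1) :+ w :* Q) :+ :- Y) ≈-refl Y (Y ^ p′) (Q d)) ⟩
      Y ⊛ (const (+ 1) ⊕ Y ^ p′ ⊛ Q d) ⊕ ⊝ Y  ≈⟨ +-congʳ {x = ⊝ Y} (*-congˡ {x = Y} (Φ^d≈ d)) ⟨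
      Y ⊛ Φ ^ d ⊕ ⊝ Y ∎
      where open ≈-Reasoning

    Φ-0 : Φ 0 ≋ + 0
    Φ-0 = begin
      Φ 0                        ≡⟨ (let open +-*-Solver in solve 1 (λ f → f := :- (con (- + 1) :* f)) refl (Φ 0)) ⟩
      - (Y ⊛ Φ) 0                ≈⟨ neg-cong≋ (at YΦ≈X[1-X^p′] 0) ⟩
      - (+ 0 * 1-X^p′ 0)         ≡⟨ cong -_ (ℤₚ.*-zeroˡ (1-X^p′ 0)) ⟩
      + 0 ∎
      where open ≋-Reasoning

    -- Without constant term, Φ^d starts at x^d at the earliest; through `Q-relation` this yields
    -- the low coefficients of `Q d`.
    Φ≈X⊛ : Φ ≈ X ⊛ (Φ ∘ suc)
    Φ≈X⊛ = ⟪ (λ { zero → ≋-trans Φ-0 (≡⇒≋ (sym (ℤₚ.*-zeroˡ (Φ 1)))) ; (suc n) → ≡⇒≋ (sym (X-⊛ (Φ ∘ suc) n)) }) ⟫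

    YΦ^d-low : ∀ d s → s ℕ.< d → (Y ⊛ Φ ^ d) s ≋ + 0
    YΦ^d-low d s s<d = ≋-trans (at (≈-trans (*-congˡ {x = Y} (≈-trans (^-congˡ d Φ≈X⊛) (^-distrib-* X (Φ ∘ suc) d)))
        (let open Solver in solve 3 (λ Y A B → Y :* (A :* B) := A :* (Y :* B)) ≈-refl Y (X ^ d) ((Φ ∘ suc) ^ d))) s)
      (X^-⊛-low d (Y ⊛ (Φ ∘ suc) ^ d) s s<d)

    Q-0 : ∀ d → 0 ℕ.< d → Q d 0 ≋ - + 1
    Q-0 d 0<d = ≋-trans (divide-low (Q-relation d) 0 (s≤s z≤n))
      (neg-cong≋ {b = + 1} (+-cong≋ {b = + 0} (YΦ^d-low d 0 0<d) (≋-refl {+ 1})))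

    Q-low : ∀ d s → 1 ℕ.< s → s ℕ.< p → s ℕ.< d → Q d s ≋ + 0
    Q-low d s@(suc (suc _)) _ s<p s<d = ≋-trans (divide-low (Q-relation d) s s<p)
      (neg-cong≋ {b = + 0} (+-cong≋ {b = + 0} {d = + 0} (YΦ^d-low d s s<d) ≋-refl))
    Q-low d (suc zero) (s≤s ()) _ _

    Q-p : ∀ d → p ℕ.< d → Q d p ≋ - + 1
    Q-p d p<d = go p′ refl 0<p′
      where
      go : ∀ q → p′ ≡ q → 0 ℕ.< q → Q d p ≋ - + 1
      -- With p at least 2 visible to the type checker, coefficient p of `Y` computes to 0.
      go (suc q) refl _ = ≋-trans (≡⇒≋ (cong (Q d) (sym (ℕₚ.+-identityʳ p)))) (≋-trans (divide-high (Q-relation d) 0)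
        (minus-zero (Q-0 d (ℕₚ.<-trans (s≤s z≤n) p<d))
          (+-cong≋ {b = + 0} {d = + 0} (YΦ^d-low d (p ℕ.+ 0) (subst (ℕ._< d) (sym (ℕₚ.+-identityʳ p)) p<d)) ≋-refl)))

    coefficient : ∀ d n {a b c} → (Y ⊛ K) n ≋ a → (X ^ p ⊛ Q d) n ≋ b → (X ^ p² ⊛ Q d) n ≋ c →
      (Y ⊛ Φ ^ (p ℕ.+ d)) n ≋ a + (b - c)
    coefficient d n α β γ = ≋-trans (at (decomposition d) n) (+-cong≋ α (+-cong≋ β (neg-cong≋ γ)))

    X^pQ-zero : ∀ d t s → d ℕ.* p′ ℕ.< t ℕ.* p ℕ.+ s ℕ.+ p′ → (X ^ p ⊛ Q d) (suc t ℕ.* p ℕ.+ s) ≋ + 0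
    X^pQ-zero d t s q = ≋-trans (≡⇒≋ (cong (X ^ p ⊛ Q d) (ℕₚ.+-assoc p (t ℕ.* p) s)))
      (≋-trans (X^-⊛ p (Q d) (t ℕ.* p ℕ.+ s)) (Q-degree d (t ℕ.* p ℕ.+ s) q))

    X^pQ-zero′ : ∀ d t → d ℕ.* p′ ℕ.< t ℕ.* p ℕ.+ p′ → (X ^ p ⊛ Q d) (suc t ℕ.* p) ≋ + 0
    X^pQ-zero′ d t q = ≋-trans (X^-⊛ p (Q d) (t ℕ.* p)) (Q-degree d (t ℕ.* p) q)

    -- The value 1 has two sources. For l < p it is -K at lp; for l = p and l = p + 1, treated next,
    -- K vanishes and it is -Q_0 and -Q_p, entering through x^(p²) Q.
    YΦ-multiple-< : ∀ t d → suc t ℕ.< p → 2 ℕ.* suc t ≡ p ℕ.+ d → (Y ⊛ Φ ^ (p ℕ.+ d)) (suc t ℕ.* p) ≋ + 1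
    YΦ-multiple-< t d 1+t<p eq = coefficient d (suc t ℕ.* p) {+ 1} {+ 0} {+ 0}
      (≋-trans (YK-multiple t) (neg-cong≋ (K-multiple t 1+t<p)))
      (X^pQ-zero′ d t (ℕₚ.≤-<-trans (ℕₚ.*-mono-≤ d≤t (ℕₚ.n≤1+n p′)) (ℕₚ.m<m+n (t ℕ.* p) 0<p′)))
      (X^-⊛-low p² (Q d) (suc t ℕ.* p) (ℕₚ.*-monoˡ-< p 1+t<p))
      where
      d≤t : d ℕ.≤ t
      d≤t = ℕₚ.≮⇒≥ λ t<d → ℕₚ.<⇒≢ (ℕₚ.+-mono-<-≤ 1+t<p t<d)
        (trans (cong (suc t ℕ.+_) (sym (ℕₚ.+-identityʳ (suc t)))) eq)

    YΦ-multiple-≡ : (Y ⊛ Φ ^ (p ℕ.+ p)) p² ≋ + 1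
    YΦ-multiple-≡ = coefficient p p² {+ 0} {+ 0} { - + 1}
      (≋-trans (YK-multiple p′) (neg-cong≋ K-p²))
      (X^pQ-zero′ p p′ (subst (ℕ._< p′ ℕ.* p ℕ.+ p′) (ℕₚ.*-comm p′ p) (ℕₚ.m<m+n (p′ ℕ.* p) 0<p′)))
      (≋-trans (≡⇒≋ (cong (X ^ p² ⊛ Q p) (sym (ℕₚ.+-identityʳ p²)))) (≋-trans (X^-⊛ p² (Q p) 0) (Q-0 p (s≤s z≤n))))

    YΦ-multiple-> : (Y ⊛ Φ ^ (p ℕ.+ suc (suc p))) (suc p ℕ.* p) ≋ + 1
    YΦ-multiple-> = coefficient (suc (suc p)) (suc p ℕ.* p) {+ 0} {+ 0} { - + 1}
      (≋-trans (YK-multiple p) (neg-cong≋ K-p+p²))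
      (X^pQ-zero′ (suc (suc p)) p (<-by 0 (let open ℕ-Solver in solve 1 (λ q → (con 1 :+ q) :* (con 1 :+ q) :+ q
        := con 1 :+ ((con 3 :+ q) :* q :+ con 0)) refl p′)))
      (≋-trans (≡⇒≋ (cong (X ^ p² ⊛ Q (suc (suc p))) (ℕₚ.+-comm p p²)))
        (≋-trans (X^-⊛ p² (Q (suc (suc p))) p) (Q-p (suc (suc p)) (ℕₚ.<-trans (ℕₚ.n<1+n p) (ℕₚ.n<1+n (suc p))))))

    -- K lives on multiples of p, so y K vanishes at lp + s. The degree of Q excludes x^p Q, and
    -- x^(p²) Q starts too late. For l = p the last term does reach the coefficient, and `Q-low` is
    -- needed.
    YΦ-off-< : ∀ t d s → suc t ℕ.< p → 2 ℕ.* suc t ℕ.+ 1 ≡ p ℕ.+ d → 1 ℕ.< s → s ℕ.< p →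
      (Y ⊛ Φ ^ (p ℕ.+ d)) (suc t ℕ.* p ℕ.+ s) ≋ + 0
    YΦ-off-< t d s 1+t<p eq 1<s s<p = coefficient d (suc t ℕ.* p ℕ.+ s) {+ 0} {+ 0} {+ 0}
      (YK-off (suc t) s 1<s s<p)
      (X^pQ-zero d t s (ℕₚ.≤-<-trans (ℕₚ.*-monoˡ-≤ p′ d≤1+t)
        (subst (ℕ._< t ℕ.* p ℕ.+ s ℕ.+ p′) (ℕₚ.+-comm (t ℕ.* p′) p′)
          (ℕₚ.+-monoˡ-< p′ (ℕₚ.≤-<-trans (ℕₚ.*-monoʳ-≤ t (ℕₚ.n≤1+n p′)) (ℕₚ.m<m+n (t ℕ.* p) (ℕₚ.<-trans (s≤s z≤n) 1<s)))))))
      (X^-⊛-low p² (Q d) (suc t ℕ.* p ℕ.+ s) (ℕₚ.<-≤-trans (ℕₚ.+-monoʳ-< (suc t ℕ.* p) s<p)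
        (subst (ℕ._≤ p²) (ℕₚ.+-comm p (suc t ℕ.* p)) (ℕₚ.*-monoˡ-≤ p 1+t<p))))
      where
      d≤1+t : d ℕ.≤ suc t
      d≤1+t = ℕₚ.≮⇒≥ λ 1+t<d → ℕₚ.<⇒≢ (subst (ℕ._≤ p ℕ.+ d)
        (let open ℕ-Solver in solve 1 (λ t → (con 2 :+ t) :+ (con 2 :+ t) := con 1 :+ (con 2 :* (con 1 :+ t) :+ con 1)) refl t)
        (ℕₚ.+-mono-≤ 1+t<p 1+t<d)) eq

    YΦ-off-≡ : ∀ s → 1 ℕ.< s → s ℕ.< p → (Y ⊛ Φ ^ (p ℕ.+ suc p)) (p² ℕ.+ s) ≋ + 0
    YΦ-off-≡ s 1<s s<p = coefficient (suc p) (p² ℕ.+ s) {+ 0} {+ 0} {+ 0}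
      (YK-off p s 1<s s<p)
      (X^pQ-zero (suc p) p′ s (subst (ℕ._< p′ ℕ.* p ℕ.+ s ℕ.+ p′)
        (let open ℕ-Solver in solve 1 (λ q → q :* (con 1 :+ q) :+ q := (con 2 :+ q) :* q) refl p′)
        (ℕₚ.+-monoˡ-< p′ (ℕₚ.m<m+n (p′ ℕ.* p) (ℕₚ.<-trans (s≤s z≤n) 1<s)))))
      (≋-trans (X^-⊛ p² (Q (suc p)) s) (Q-low (suc p) s 1<s s<p (ℕₚ.<-trans s<p (ℕₚ.n<1+n p))))

  -- Prime modulus: the congruences for v_n.

  module PrimeCongruences (p′ : ℕ) (k-prime : Prime (suc p′)) (1<p : 1 ℕ.< suc p′) where
    open Coefficients p′ k-prime
    open LargeExponent p′ k-prime 1<p using (YΦ-multiple-<; YΦ-multiple-≡; YΦ-multiple->; YΦ-off-<; YΦ-off-≡)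

    1-X≈⊝Y : 1-X ≈ ⊝ Y
    1-X≈⊝Y = exact (λ { zero → refl ; (suc zero) → refl ; (suc (suc n)) → refl })

    p′≋-1 : + p′ ≋ - + 1
    p′≋-1 = by (+ 1) (let open +-*-Solver in solve 1 (λ q → q := con (- + 1) :+ con (+ 1) :* (con (+ 1) :+ q)) refl (+ p′))

    factors-full-neg : factors (- + 1) p ≈ const (- + 1) ⊛ Φ
    factors-full-neg = ≈-trans (factors-cong p (≋-sym p′≋-1)) (≈-trans (factors-full p′) (*-congʳ {x = Φ} (const-cong p′≋-1)))

    -- There are 2l full periods with N ≡ -1, whose signs cancel in pairs; the sign that remains is
    -- that of 1 - x = -y.
    v-multiple : ∀ l → v (suc (l ℕ.* p)) ≋ - (Y ⊛ Φ ^ (2 ℕ.* l)) (l ℕ.* p)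
    v-multiple l = begin
      v (suc (l ℕ.* p))
        ≈⟨ v-coeff′ (l ℕ.* p) { - + 1} (2 ℕ.* l ℕ.* p ℕ.+ 0) (trans (sym (ℕₚ.*-assoc 2 l p)) (sym (ℕₚ.+-identityʳ _)))
             (plus-zero (≋-trans (≡⇒≋ (cong +_ (ℕₚ.+-identityʳ _))) (multiple≋0 (2 ℕ.* l))) (- + 1)) ⟩
      (1-X ⊛ factors (- + 1) (2 ℕ.* l ℕ.* p ℕ.+ 0)) (l ℕ.* p)  ≈⟨ at (*-cong 1-X≈⊝Y P) (l ℕ.* p) ⟩
      (⊝ Y ⊛ Φ ^ (2 ℕ.* l)) (l ℕ.* p)
        ≈⟨ at (let open Solver in solve 2 (λ Y F → (:- Y) :* F := :- (Y :* F)) ≈-refl Y (Φ ^ (2 ℕ.* l))) (l ℕ.* p) ⟩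
      - (Y ⊛ Φ ^ (2 ℕ.* l)) (l ℕ.* p) ∎
      where
      open ≋-Reasoning
      P : factors (- + 1) (2 ℕ.* l ℕ.* p ℕ.+ 0) ≈ Φ ^ (2 ℕ.* l)
      P = ≈-trans (factors-blocks (- + 1) (2 ℕ.* l) 0) (≈-trans (⊛-identityʳ _) (≈-trans (^-congˡ (2 ℕ.* l) factors-full-neg)
        (≈-trans (^-distrib-* (const (- + 1)) Φ (2 ℕ.* l)) (≈-trans (*-congʳ {x = Φ ^ (2 ℕ.* l)} (-1^even l)) (⊛-identityˡ _)))))

    -- For l = 1 the coefficient is e = p - 1 with a = 2. The summand a that turns e into 1 enters
    -- only at 2p, which is why the sign changes for l ≥ 2.
    v-1+p : v (suc (1 ℕ.* p)) ≋ + 1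
    v-1+p = ≋-trans (v-multiple 1) (≋-trans (≡⇒≋ (cong (λ n → - (Y ⊛ Φ ^ 2) n) (ℕₚ.*-identityˡ p)))
      (neg-cong≋ (≋-trans (SmallExponent.C-p 2 p′ refl (s≤s (s≤s z≤n))) p′≋-1)))

    YΦ-multiple : ∀ t → suc t ℕ.≤ p → (Y ⊛ Φ ^ (2 ℕ.* suc (suc t))) (suc (suc t) ℕ.* p) ≋ + 1
    YΦ-multiple t 1+t≤p with ℕₚ.≤-<-connex (2 ℕ.* suc (suc t)) (suc p)
    ... | inj₁ 2l≤1+p = let (e , eq) = ≤-gap 2l≤1+p in
      SmallExponent.C-multiple (2 ℕ.* suc (suc t)) e eq 1<p t (ℕₚ.m<m+n (suc (suc t)) (s≤s z≤n))
    ... | inj₂ 1+p<2l with ℕₚ.<-cmp (suc (suc t)) p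
    ... | tri< l<p _ _ = let (d , eq) = ≤-gap {p} (ℕₚ.<⇒≤ (ℕₚ.<-trans (ℕₚ.n<1+n p) 1+p<2l)) in
      subst (λ n → (Y ⊛ Φ ^ n) (suc (suc t) ℕ.* p) ≋ + 1) (sym eq) (YΦ-multiple-< (suc t) d l<p eq)
    ... | tri≈ _ refl _ = subst (λ n → (Y ⊛ Φ ^ n) (p ℕ.* p) ≋ + 1) (cong (p ℕ.+_) (sym (ℕₚ.+-identityʳ p))) YΦ-multiple-≡
    ... | tri> _ _ p<l with ℕₚ.≤-antisym 1+t≤p (ℕₚ.≤-pred p<l)
    ... | refl = subst (λ n → (Y ⊛ Φ ^ n) (suc p ℕ.* p) ≋ + 1)
      (let open ℕ-Solver in solve 1 (λ p → p :+ (con 2 :+ p) := con 2 :* (con 1 :+ p)) refl p) YΦ-multiple->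

    v-multiple-≥2 : ∀ l → 2 ℕ.≤ l → l ℕ.≤ suc p → v (suc (l ℕ.* p)) ≋ - + 1
    v-multiple-≥2 (suc (suc t)) _ (s≤s 1+t≤p) = ≋-trans (v-multiple (suc (suc t))) (neg-cong≋ (YΦ-multiple t 1+t≤p))
    v-multiple-≥2 (suc zero) (s≤s ()) _

    v-multiple-next : ∀ l → v (suc (l ℕ.* p)) ≋ v (suc (suc (l ℕ.* p)))
    v-multiple-next l = v-consecutive (l ℕ.* p) (2 ℕ.* l) (sym (ℕₚ.*-assoc 2 l p))

    -- For residues i ≥ (p + 3) / 2 the product contains 2l + 1 full periods, hence the exponent.
    Off : ℕ → Set
    Off l = ∀ s → 1 ℕ.< s → s ℕ.< p → (Y ⊛ Φ ^ (2 ℕ.* l ℕ.+ 1)) (l ℕ.* p ℕ.+ s) ≋ + 0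

    off-0 : Off 0
    off-0 s@(suc (suc _)) _ s<p = ≋-trans (at (*-congˡ {x = Y} (⊛-identityʳ Φ)) s) (≋-trans (at YΦ≈ s)
      (minus-zero (≋-refl {+ 0}) (X^-other p s (ℕₚ.<⇒≢ s<p))))
    off-0 (suc zero) (s≤s ()) _

    -- The bound l ≥ (p - 1) / 2 says 2l + 1 ≥ p, so that Φ^p splits off.
    off-large : ∀ l → p ℕ.≤ 2 ℕ.* l ℕ.+ 1 → l ℕ.≤ p → Off l
    off-large l p≤2l+1 l≤p s 1<s s<p with ℕₚ.m≤n⇒m<n∨m≡n l≤p
    ... | inj₂ refl = subst (λ n → (Y ⊛ Φ ^ n) (p ℕ.* p ℕ.+ s) ≋ + 0)
      (let open ℕ-Solver in solve 1 (λ p → p :+ (con 1 :+ p) := con 2 :* p :+ con 1) refl p) (YΦ-off-≡ s 1<s s<p)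
    ... | inj₁ l<p with l
    ... | zero = ⊥-elim (ℕₚ.<⇒≱ 1<p p≤2l+1)
    ... | suc t = let (d , eq) = ≤-gap p≤2l+1 in
      subst (λ n → (Y ⊛ Φ ^ n) (suc t ℕ.* p ℕ.+ s) ≋ + 0) (sym eq) (YΦ-off-< t d s l<p eq 1<s s<p)

    const-^ : ∀ a n → const a ^ n ≈ const (a ℤ.^ n)
    const-^ a zero = ≈-refl
    const-^ a (suc n) = ≈-trans (*-congˡ {x = const a} (const-^ a n)) (≈-sym (const-* a (a ℤ.^ n)))

    factors-degree : ∀ N n → Degree≤ n (factors N (suc n))
    factors-degree N n s n<s = Degree≤-⊛ {0} {n} factor-0 (Degree≤-prod (factor N ∘ suc) n (λ j → Degree≤-lin (N - + suc j) (+ suc j))) s n<s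
      where
      factor-0 : Degree≤ 0 (factor N 0)
      factor-0 (suc zero) _ = ≋-refl
      factor-0 (suc (suc s)) _ = ≋-refl

    -- With p = 2h + 1 there are (2l + 1) p + (2c + 1) factors. The remainder T has degree at most
    -- 2c, its factor at j = 0 being constant, so only coefficients lp + s of y Φ^(2l+1) with m - 2c
    -- ≤ s ≤ m enter. Since c < h, m - 2c = h + 1 - c is at least 2.
    v-off : ∀ h l c → p′ ≡ 2 ℕ.* h → suc (h ℕ.+ c) ℕ.≤ p′ → Off l → v (l ℕ.* p ℕ.+ suc (suc (h ℕ.+ c))) ≋ + 0
    v-off h l c p′≡2h m≤p′ off = begin
      v (l ℕ.* p ℕ.+ suc m)         ≡⟨ cong v (ℕₚ.+-suc (l ℕ.* p) m) ⟩
      v (suc (l ℕ.* p ℕ.+ m))       ≈⟨ v-coeff′ (l ℕ.* p ℕ.+ m) {+ n} (a ℕ.* p ℕ.+ suc (2 ℕ.* c)) count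
                                         (≡⇒≋ (trans (cong (λ n → + n - + 1) (ℕₚ.+-suc (a ℕ.* p) (2 ℕ.* c)))
                                           (let open +-*-Solver in solve 1 (λ n → (con (+ 1) :+ n) :- con (+ 1) := n) refl (+ n)))) ⟩
      (1-X ⊛ factors (+ n) (a ℕ.* p ℕ.+ suc (2 ℕ.* c))) (l ℕ.* p ℕ.+ m)
        ≈⟨ at (*-cong 1-X≈⊝Y (≈-trans (factors-blocks (+ n) a (suc (2 ℕ.* c))) (*-congʳ {x = T} P))) (l ℕ.* p ℕ.+ m) ⟩
      (⊝ Y ⊛ (const ((+ n) ℤ.^ a) ⊛ Φ ^ a ⊛ T)) (l ℕ.* p ℕ.+ m)
        ≈⟨ at (let open Solver in solve 4 (λ Y c F T → (:- Y) :* (c :* F :* T) := (:- c) :* ((Y :* F) :* T)) ≈-refl Y (const ((+ n) ℤ.^ a)) (Φ ^ a) T) (l ℕ.* p ℕ.+ m) ⟩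
      (⊝ const ((+ n) ℤ.^ a) ⊛ ((Y ⊛ Φ ^ a) ⊛ T)) (l ℕ.* p ℕ.+ m)
        ≈⟨ at (*-congʳ {x = (Y ⊛ Φ ^ a) ⊛ T} (exact {⊝ const ((+ n) ℤ.^ a)} {const (- ((+ n) ℤ.^ a))} (λ { zero → refl ; (suc _) → refl }))) (l ℕ.* p ℕ.+ m) ⟩
      (const (- ((+ n) ℤ.^ a)) ⊛ ((Y ⊛ Φ ^ a) ⊛ T)) (l ℕ.* p ℕ.+ m)  ≡⟨ const-⊛ (- ((+ n) ℤ.^ a)) ((Y ⊛ Φ ^ a) ⊛ T) (l ℕ.* p ℕ.+ m) ⟩
      - ((+ n) ℤ.^ a) * ((Y ⊛ Φ ^ a) ⊛ T) (l ℕ.* p ℕ.+ m)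
        ≈⟨ *-cong≋ (≋-refl { - ((+ n) ℤ.^ a)}) (⊛-vanishes (Y ⊛ Φ ^ a) T (l ℕ.* p ℕ.+ m) split) ⟩
      - ((+ n) ℤ.^ a) * + 0 ≡⟨ ℤₚ.*-zeroʳ (- ((+ n) ℤ.^ a)) ⟩
      + 0 ∎
      where
      open ≋-Reasoning
      m = suc (h ℕ.+ c)
      a = 2 ℕ.* l ℕ.+ 1
      -- N = 2 (lp + m) - 1 as a natural number, the form that `factors-full` takes.
      n = a ℕ.* p ℕ.+ 2 ℕ.* c
      T = factors (+ n) (suc (2 ℕ.* c))
      count : 2 ℕ.* (l ℕ.* p ℕ.+ m) ≡ a ℕ.* p ℕ.+ suc (2 ℕ.* c)
      count = trans (let open ℕ-Solver in solve 4 (λ l p h c → con 2 :* (l :* p :+ (con 1 :+ (h :+ c)))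
          := con 2 :* l :* p :+ (con 1 :+ con 2 :* h) :+ (con 1 :+ con 2 :* c)) refl l p h c)
        (trans (cong (λ q → 2 ℕ.* l ℕ.* p ℕ.+ suc q ℕ.+ suc (2 ℕ.* c)) (sym p′≡2h))
          (cong (ℕ._+ suc (2 ℕ.* c)) (let open ℕ-Solver in solve 2 (λ l p → con 2 :* l :* p :+ p := (con 2 :* l :+ con 1) :* p) refl l p)))
      P : factors (+ n) p ^ a ≈ const ((+ n) ℤ.^ a) ⊛ Φ ^ a
      P = ≈-trans (^-congˡ a (factors-full n)) (≈-trans (^-distrib-* (const (+ n)) Φ a) (*-congʳ {x = Φ ^ a} (const-^ (+ n) a)))
      c<h : suc c ℕ.≤ h
      c<h = ℕₚ.+-cancelˡ-≤ h (suc c) h (subst (ℕ._≤ h ℕ.+ h) (sym (ℕₚ.+-suc h c))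
        (subst (m ℕ.≤_) (trans p′≡2h (cong (h ℕ.+_) (ℕₚ.+-identityʳ h))) m≤p′))
      split : ∀ i j → i ℕ.+ j ≡ l ℕ.* p ℕ.+ m → ((Y ⊛ Φ ^ a) i ≋ + 0) ⊎ (T j ≋ + 0)
      split i j eq with ℕₚ.≤-<-connex j (2 ℕ.* c)
      ... | inj₂ 2c<j = inj₂ (factors-degree (+ n) (2 ℕ.* c) j 2c<j)
      ... | inj₁ j≤2c with ≤-gap j≤2c | ≤-gap c<h
      ... | g , 2c≡ | b , h≡ = inj₁ (subst (λ i → (Y ⊛ Φ ^ a) i ≋ + 0) (sym i≡) (off s (s≤s (s≤s z≤n)) s<p))
        where
        s = suc (suc (b ℕ.+ g))
        m≡ : m ≡ s ℕ.+ j
        m≡ = trans (cong (λ h → suc (h ℕ.+ c)) h≡) (trans (let open ℕ-Solver in solve 2 (λ c b → con 1 :+ (con 1 :+ c :+ b :+ c) := con 2 :+ b :+ con 2 :* c) refl c b)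
          (trans (cong (λ z → 2 ℕ.+ b ℕ.+ z) 2c≡) (let open ℕ-Solver in solve 3 (λ b j g → con 2 :+ b :+ (j :+ g) := con 2 :+ (b :+ g) :+ j) refl b j g)))
        i≡ : i ≡ l ℕ.* p ℕ.+ s
        i≡ = ℕₚ.+-cancelʳ-≡ j i (l ℕ.* p ℕ.+ s) (trans eq (trans (cong (l ℕ.* p ℕ.+_) m≡) (sym (ℕₚ.+-assoc (l ℕ.* p) s j))))
        s<p : s ℕ.< p
        s<p = s≤s (ℕₚ.≤-trans (subst (s ℕ.≤_) (sym m≡) (ℕₚ.m≤m+n s j)) m≤p′)

  -- Powers of two: periodicity and the indices of a residue.

  even-or-odd : ∀ z → z Mod2.≋ + 0 ⊎ z Mod2.≋ + 1
  even-or-odd z with z ℤ.%ℕ 2 | ℤ÷.n%ℕd<d z 2 | ℤ÷.a≡a%ℕn+[a/ℕn]*n z 2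
  ... | 0 | _ | eq = inj₁ (Mod.by (z ℤ./ℕ 2) eq)
  ... | 1 | _ | eq = inj₂ (Mod.by (z ℤ./ℕ 2) eq)
  ... | suc (suc _) | s≤s (s≤s ()) | _

  0≢1-mod-2 : ¬ (+ 0 Mod2.≋ + 1)
  0≢1-mod-2 p = ℕₚ.<⇒≱ (s≤s (s≤s z≤n)) (ℕ∣.∣⇒≤ (Mod2.≋⇒mod p))

  ¬2∣⇒odd : ∀ {a} → ¬ (+ 2 ∣ a) → a Mod2.≋ + 1
  ¬2∣⇒odd {a} ¬2∣a with even-or-odd a
  ... | inj₂ odd = odd
  ... | inj₁ even = ⊥-elim (¬2∣a (subst (+ 2 ∣_) (ℤₚ.+-identityʳ a) (Mod2.≋⇒mod even)))

  odd⇒¬2∣ : ∀ {a} → a Mod2.≋ + 1 → ¬ (+ 2 ∣ a)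
  odd⇒¬2∣ {a} odd 2∣a = 0≢1-mod-2 (Mod2.≋-trans
    (Mod2.≋-sym (Mod2.mod⇒≋ (subst (+ 2 ∣_) (sym (ℤₚ.+-identityʳ a)) 2∣a))) odd)

  0<2^ : ∀ q → 0 ℕ.< 2 ℕ.^ q
  0<2^ zero = s≤s z≤n
  0<2^ (suc q) = ℕₚ.<-≤-trans (0<2^ q) (ℕₚ.m≤m+n (2 ℕ.^ q) _)

  module _ (i : ℕ) where
    private h = 2 ℕ.^ suc i
    open Values (2 ℕ.* h)

    v-shift-2^ : ∀ m → v (suc m ℕ.+ h) ≋ v (suc m) + + h
    v-shift-2^ = FullShift.v-shift h (fullProduct i)

    v-2^ : v h ≋ + h - + 1
    v-2^ with ≤-gap (0<2^ (suc i))
    ... | m , h≡1+m = Half.v-half i m h≡1+m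

    v-period : ∀ m → Mod._≋_ h (v (suc m ℕ.+ h)) (v (suc m))
    v-period m = Mₕ.≋-trans (≋-coarsen 2 refl (v-shift-2^ m))
        (Mₕ.≋-trans (Mₕ.+-cong≋ (Mₕ.≋-refl {v (suc m)}) Mₕ.+k≋0) (Mₕ.≡⇒≋ (ℤₚ.+-identityʳ (v (suc m)))))
      where module Mₕ = Values h

    v-periodic : ∀ l m → Mod._≋_ h (v (l ℕ.* h ℕ.+ suc m)) (v (suc m))
    v-periodic zero m = Mod.≋-refl h
    v-periodic (suc l) m = Mod.≋-trans h (Mod.≡⇒≋ h (cong v index)) (Mod.≋-trans h (v-period (l ℕ.* h ℕ.+ m))
        (Mod.≋-trans h (Mod.≡⇒≋ h (cong v (sym (ℕₚ.+-suc (l ℕ.* h) m)))) (v-periodic l m)))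
      where
      index : suc l ℕ.* h ℕ.+ suc m ≡ suc (l ℕ.* h ℕ.+ m) ℕ.+ h
      index = let open ℕ-Solver in solve 3 (λ h x m → h :+ x :+ (con 1 :+ m) := con 1 :+ (x :+ m) :+ h) refl h (l ℕ.* h) m

    h≢0 : ¬ (+ h ≋ + 0)
    h≢0 p = ℕₚ.<⇒≱ (ℕₚ.m<m+n h (subst (0 ℕ.<_) (sym (ℕₚ.+-identityʳ h)) (0<2^ (suc i))))
      (ℕ∣.∣⇒≤ {{ℕ.>-nonZero (0<2^ (suc i))}} (subst (2 ℕ.* h ℕ∣.∣_) (cong ℤ.∣_∣ (ℤₚ.+-identityʳ (+ h))) (≋⇒mod p)))

    -- A residue modulo h has two lifts modulo 2h, which differ by h; the parity of the quotient
    -- decides between them.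
    refine : ∀ {b a} → Mod._≋_ h b a → b ≋ a ⊎ b + + h ≋ a
    refine {b} {a} b≋a with Mod.≋-sym h b≋a
    ... | Mod.by t refl with even-or-odd t
    ... | inj₁ (Mod.by s refl) = inj₁ (≋-sym (by s (trans
        (let open +-*-Solver in solve 3 (λ b s h → b :+ (con (+ 0) :+ s :* con (+ 2)) :* h := b :+ s :* (con (+ 2) :* h)) refl b s (+ h))
        (cong (λ z → b + s * z) (sym (ℤₚ.pos-* 2 h))))))
    ... | inj₂ (Mod.by s refl) = inj₂ (≋-sym (by s (trans
        (let open +-*-Solver in solve 3 (λ b s h → b :+ (con (+ 1) :+ s :* con (+ 2)) :* h := b :+ h :+ s :* (con (+ 2) :* h)) refl b s (+ h))
        (cong (λ z → b + + h + s * z) (sym (ℤₚ.pos-* 2 h))))))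

    exclusive : ∀ {b a} → b ≋ a → b + + h ≋ a → ⊥
    exclusive {b} p q = h≢0 (≋-trans (≡⇒≋ (let open +-*-Solver in solve 2 (λ b h → h := (b :+ h) :- b) refl b (+ h)))
      (≋-trans (+-cong≋ (≋-trans q (≋-sym p)) (≋-refl { - b})) (≡⇒≋ (ℤₚ.+-inverseʳ b))))

    -- Of the two indices x and x + 2^q, exactly one hits a given lift of the residue v x.
    record LiftedIndex (a : ℤ) (x : ℕ) : Set where
      field
        index     : ℕ
        index≡    : index ≡ x ⊎ index ≡ x ℕ.+ h
        value     : v index ≋ a
        unique    : ∀ y → y ≡ x ⊎ y ≡ x ℕ.+ h → v y ≋ a → y ≡ index

    lift-index : ∀ {a} x → 1 ℕ.≤ x → Mod._≋_ h (v x) a → LiftedIndex a x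
    lift-index {a} x@(suc m) _ vx≋a with refine vx≋a
    ... | inj₁ p = record { index = x ; index≡ = inj₁ refl ; value = p ; unique = unique }
      where
      unique : ∀ y → y ≡ x ⊎ y ≡ x ℕ.+ h → v y ≋ a → y ≡ x
      unique y (inj₁ eq) _ = eq
      unique y (inj₂ refl) q = ⊥-elim (exclusive p (≋-trans (≋-sym (v-shift-2^ m)) q))
    ... | inj₂ p = record { index = x ℕ.+ h ; index≡ = inj₂ refl ; value = ≋-trans (v-shift-2^ m) p ; unique = unique }
      where
      unique : ∀ y → y ≡ x ⊎ y ≡ x ℕ.+ h → v y ≋ a → y ≡ x ℕ.+ h
      unique y (inj₂ eq) _ = eq
      unique y (inj₁ refl) q = ⊥-elim (exclusive q p)

  record TwoIndices (q : ℕ) (a : ℤ) : Set where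
    open Mod (2 ℕ.^ q)
    field
      i j   : ℕ
      i≢j   : i ≢ j
      1≤i   : 1 ℕ.≤ i
      1≤j   : 1 ℕ.≤ j
      i≤2^q : i ℕ.≤ 2 ℕ.^ q
      j≤2^q : j ℕ.≤ 2 ℕ.^ q
      vi≋a  : v i ≋ a
      vj≋a  : v j ≋ a
      only  : ∀ m → 1 ℕ.≤ m → m ℕ.≤ 2 ℕ.^ q → v m ≋ a → m ≡ i ⊎ m ≡ j

  -- Doubling the modulus replaces each index x by exactly one of x and x + h, as v changes by h
  -- between them, so the number two persists from q = 1.
  two-indices : ∀ q {a} → a Mod2.≋ + 1 → TwoIndices (suc q) a
  two-indices zero {a} odd = record
    { i = 1 ; j = 2 ; i≢j = λ () ; 1≤i = s≤s z≤n ; 1≤j = s≤s z≤n ; i≤2^q = s≤s z≤n ; j≤2^q = s≤s (s≤s z≤n)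
    ; vi≋a = Mod2.≋-sym odd ; vj≋a = Mod2.≋-sym odd ; only = only }
    where
    only : ∀ m → 1 ℕ.≤ m → m ℕ.≤ 2 → v m Mod2.≋ a → m ≡ 1 ⊎ m ≡ 2
    only 1 _ _ _ = inj₁ refl
    only 2 _ _ _ = inj₂ refl
    only (suc (suc (suc _))) _ (s≤s (s≤s ())) _
  two-indices (suc q) {a} odd = record
    { i = I.index ; j = J.index
    ; i≢j = distinct I.index≡ J.index≡
    ; 1≤i = positive P.1≤i I.index≡ ; 1≤j = positive P.1≤j J.index≡
    ; i≤2^q = bounded P.i≤2^q I.index≡ ; j≤2^q = bounded P.j≤2^q J.index≡
    ; vi≋a = I.value ; vj≋a = J.value ; only = only }
    where
    h = 2 ℕ.^ suc q
    module P = TwoIndices (two-indices q {a} odd)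
    module I = LiftedIndex (lift-index q P.i P.1≤i P.vi≋a)
    module J = LiftedIndex (lift-index q P.j P.1≤j P.vj≋a)
    open Mod (2 ℕ.* h)
    positive : ∀ {x y} → 1 ℕ.≤ x → y ≡ x ⊎ y ≡ x ℕ.+ h → 1 ℕ.≤ y
    positive 1≤x (inj₁ refl) = 1≤x
    positive 1≤x (inj₂ refl) = ℕₚ.≤-trans 1≤x (ℕₚ.m≤m+n _ h)
    bounded : ∀ {x y} → x ℕ.≤ h → y ≡ x ⊎ y ≡ x ℕ.+ h → y ℕ.≤ 2 ℕ.* h
    bounded x≤h (inj₁ refl) = ℕₚ.≤-trans x≤h (ℕₚ.m≤m+n h _)
    bounded x≤h (inj₂ refl) = ℕₚ.+-mono-≤ x≤h (ℕₚ.≤-reflexive (sym (ℕₚ.+-identityʳ h)))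
    too-large : ∀ {x y} → 1 ℕ.≤ x → y ℕ.≤ h → y ≢ x ℕ.+ h
    too-large 1≤x y≤h refl = ℕₚ.<⇒≱ (ℕₚ.m<n+m h 1≤x) y≤h
    distinct : ∀ {x y} → x ≡ P.i ⊎ x ≡ P.i ℕ.+ h → y ≡ P.j ⊎ y ≡ P.j ℕ.+ h → x ≢ y
    distinct (inj₁ refl) (inj₁ eq) refl = P.i≢j eq
    distinct (inj₁ refl) (inj₂ eq) refl = too-large P.1≤j P.i≤2^q eq
    distinct (inj₂ refl) (inj₁ eq) refl = too-large P.1≤i P.j≤2^q (sym eq)
    distinct (inj₂ refl) (inj₂ eq) refl = P.i≢j (ℕₚ.+-cancelʳ-≡ h P.i P.j eq)
    candidate : ∀ m {x} → x ≡ P.i ⊎ x ≡ P.j → m ≡ x ⊎ m ≡ x ℕ.+ h → v m ≋ a → m ≡ I.index ⊎ m ≡ J.index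
    candidate m (inj₁ refl) p vm≋a = inj₁ (I.unique m p vm≋a)
    candidate m (inj₂ refl) p vm≋a = inj₂ (J.unique m p vm≋a)
    only : ∀ m → 1 ℕ.≤ m → m ℕ.≤ 2 ℕ.* h → v m ≋ a → m ≡ I.index ⊎ m ≡ J.index
    only m 1≤m m≤2h vm≋a with ℕₚ.≤-<-connex m h
    ... | inj₁ m≤h = candidate m (P.only m 1≤m m≤h (≋-coarsen 2 refl vm≋a)) (inj₁ refl) vm≋a
    ... | inj₂ h<m with ≤-gap h<m
    -- An index above h is first lowered by h, which the period modulo h permits.
    ... | c , refl = candidate m (P.only (suc c) (s≤s z≤n)
          (ℕₚ.+-cancelˡ-≤ h (suc c) h (subst (ℕ._≤ h ℕ.+ h) (sym (ℕₚ.+-suc h c)) (subst (m ℕ.≤_) (cong (h ℕ.+_) (ℕₚ.+-identityʳ h)) m≤2h)))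
          (Mod.≋-trans h (Mod.≋-sym h (v-period q c)) (Mod.≋-trans h (Mod.≡⇒≋ h (cong v (sym index))) (≋-coarsen 2 refl vm≋a))))
        (inj₂ index) vm≋a
      where
      index : suc h ℕ.+ c ≡ suc c ℕ.+ h
      index = cong suc (ℕₚ.+-comm h c)

  -- The statements in their final indexing.

  v-not-even : ∀ n → 1 ℕ.≤ n → ¬ (+ 2 ∣ v n)
  v-not-even (suc m) _ = odd⇒¬2∣ (v-odd m)

  n+1≡ : ∀ n → n ℕ.+ 1 ≡ suc n
  n+1≡ n = ℕₚ.+-comm n 1

  n+2≡ : ∀ n → n ℕ.+ 2 ≡ suc (suc n)
  n+2≡ n = ℕₚ.+-comm n 2

  v-consecutive-mod : ∀ k m c → 2 ℕ.* m ≡ c ℕ.* k → v (m ℕ.+ 1) ≡ v (m ℕ.+ 2) [mod k ]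
  v-consecutive-mod k m c eq rewrite n+1≡ m | n+2≡ m = Mod.≋⇒mod k (Values.v-consecutive k m c eq)

  v-after-multiple : ∀ k l → v (l ℕ.* k ℕ.+ 1) ≡ v (l ℕ.* k ℕ.+ 2) [mod k ]
  v-after-multiple k l = v-consecutive-mod k (l ℕ.* k) (2 ℕ.* l) (sym (ℕₚ.*-assoc 2 l k))

  -- Here 2m = (2l + 1) k, an odd number of periods, against 2l of them after a full multiple.
  v-after-half-multiple : ∀ h l → v (l ℕ.* (2 ℕ.* h) ℕ.+ h ℕ.+ 1) ≡ v (l ℕ.* (2 ℕ.* h) ℕ.+ h ℕ.+ 2) [mod 2 ℕ.* h ]
  v-after-half-multiple h l = v-consecutive-mod (2 ℕ.* h) (l ℕ.* (2 ℕ.* h) ℕ.+ h) (2 ℕ.* l ℕ.+ 1)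
    (let open ℕ-Solver in solve 2 (λ h l → con 2 :* (l :* (con 2 :* h) :+ h) := (con 2 :* l :+ con 1) :* (con 2 :* h)) refl h l)

  -- N = 2 (lk + h + 1) - 1 = (2l + 1) k ≡ 0.
  v-middle : ∀ h l → v (l ℕ.* (2 ℕ.* h ℕ.+ 1) ℕ.+ (h ℕ.+ 2)) ≡ + 0 [mod 2 ℕ.* h ℕ.+ 1 ]
  v-middle h l = ≋⇒mod (≋-trans (≡⇒≋ (cong v index)) (v-vanishing m
      (≋-trans (≡⇒≋ (trans (cong (λ n → + n - + 1) count) (let open +-*-Solver in solve 1 (λ n → (con (+ 1) :+ n) :- con (+ 1) := n) refl (+ (suc (2 ℕ.* l) ℕ.* k)))))
        (multiple≋0 (suc (2 ℕ.* l))))))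
    where
    k = 2 ℕ.* h ℕ.+ 1
    m = l ℕ.* k ℕ.+ h
    open Values k
    index : l ℕ.* k ℕ.+ (h ℕ.+ 2) ≡ suc (suc m)
    index = trans (sym (ℕₚ.+-assoc (l ℕ.* k) h 2)) (n+2≡ m)
    count : 2 ℕ.* suc m ≡ suc (suc (2 ℕ.* l) ℕ.* k)
    count = let open ℕ-Solver in solve 2 (λ h l → let k = con 2 :* h :+ con 1 in
      con 2 :* (con 1 :+ (l :* k :+ h)) := con 1 :+ (con 1 :+ con 2 :* l) :* k) refl h l

  v-prime : ∀ k → Prime k →
    (v 1 ≡ + 1 [mod k ] × v 2 ≡ + 1 [mod k ] × v (k ℕ.+ 1) ≡ + 1 [mod k ] × v (k ℕ.+ 2) ≡ + 1 [mod k ])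
    × (∀ l → 2 ℕ.≤ l → l ℕ.≤ k ℕ.+ 1 →
         v (l ℕ.* k ℕ.+ 1) ≡ - (+ 1) [mod k ] × v (l ℕ.* k ℕ.+ 2) ≡ - (+ 1) [mod k ])
  v-prime zero k-prime = ⊥-elim (¬prime[0] k-prime)
  v-prime (suc zero) k-prime = ⊥-elim (¬prime[1] k-prime)
  v-prime k@(suc p′@(suc _)) k-prime =
    (≋⇒mod {v 1} {+ 1} ≋-refl , ≋⇒mod {v 2} {+ 1} ≋-refl
     , at-1 k (subst (λ n → v (suc n) ≋ + 1) (ℕₚ.*-identityˡ k) v-1+p)
     , at-2 k (subst (λ n → v (suc (suc n)) ≋ + 1) (ℕₚ.*-identityˡ k) (≋-trans (≋-sym (v-multiple-next 1)) v-1+p)))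
    , λ l 2≤l l≤k+1 → let v≋ = v-multiple-≥2 l 2≤l (subst (l ℕ.≤_) (n+1≡ k) l≤k+1) in
        at-1 (l ℕ.* k) v≋ , at-2 (l ℕ.* k) (≋-trans (≋-sym (v-multiple-next l)) v≋)
    where
    open Values k
    open PrimeCongruences p′ k-prime (s≤s (s≤s z≤n)) using (v-1+p; v-multiple-next; v-multiple-≥2)
    at-1 : ∀ n {a} → v (suc n) ≋ a → v (n ℕ.+ 1) ≡ a [mod k ]
    at-1 n {a} p = ≋⇒mod (subst (λ n → v n ≋ a) (sym (n+1≡ n)) p)
    at-2 : ∀ n {a} → v (suc (suc n)) ≋ a → v (n ℕ.+ 2) ≡ a [mod k ]
    at-2 n {a} p = ≋⇒mod (subst (λ n → v n ≋ a) (sym (n+2≡ n)) p)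

  odd-prime : ∀ {k} → Prime k → 2 ℕ.< k → ∃ λ h → k ≡ suc (2 ℕ.* h)
  odd-prime {k} k-prime 2<k with k ℕ.% 2 | ℕ÷.m%n<n k 2 | ℕ÷.m≡m%n+[m/n]*n k 2
  ... | 1 | _ | eq = k ℕ./ 2 , trans eq (cong suc (ℕₚ.*-comm (k ℕ./ 2) 2))
  ... | suc (suc _) | s≤s (s≤s ()) | _
  ... | 0 | _ | eq with prime⇒irreducible k-prime (ℕ∣.divides (k ℕ./ 2) eq)
  ... | inj₂ refl = ⊥-elim (ℕₚ.<-irrefl refl 2<k)

  half-k+3 : ∀ h → (suc (2 ℕ.* h) ℕ.+ 3) ℕ./ 2 ≡ suc (suc h)
  half-k+3 h = trans (cong (ℕ._/ 2) (let open ℕ-Solver in solve 1 (λ h → con 1 :+ con 2 :* h :+ con 3 := (con 2 :+ h) :* con 2) refl h))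
    (ℕ÷.m*n/n≡m (suc (suc h)) 2)

  half-k-1 : ∀ h → (suc (2 ℕ.* h) ℕ.∸ 1) ℕ./ 2 ≡ h
  half-k-1 h = trans (cong (ℕ._/ 2) (ℕₚ.*-comm 2 h)) (ℕ÷.m*n/n≡m h 2)

  module _ (h : ℕ) (k-prime : Prime (suc (2 ℕ.* h))) (2<k : 2 ℕ.< suc (2 ℕ.* h)) where
    private k = suc (2 ℕ.* h)
    open Values k
    open PrimeCongruences (2 ℕ.* h) k-prime (ℕₚ.<-trans (s≤s (s≤s z≤n)) 2<k)

    v-gap : ∀ l i → Off l → (k ℕ.+ 3) ℕ./ 2 ℕ.≤ i → i ℕ.≤ k → v (l ℕ.* k ℕ.+ i) ≋ + 0
    v-gap l i off i≥ i≤k with ≤-gap (subst (ℕ._≤ i) (half-k+3 h) i≥)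
    ... | c , refl = v-off h l c refl (ℕₚ.≤-pred i≤k) off

    v-gap-0 : ∀ i → (k ℕ.+ 3) ℕ./ 2 ℕ.≤ i → i ℕ.≤ k → v i ≋ + 0
    v-gap-0 i = v-gap 0 i off-0

    v-gap-large : ∀ l i → (k ℕ.∸ 1) ℕ./ 2 ℕ.≤ l → l ℕ.≤ k → (k ℕ.+ 3) ℕ./ 2 ℕ.≤ i → i ℕ.≤ k → v (l ℕ.* k ℕ.+ i) ≋ + 0
    v-gap-large l i l≥ l≤k = v-gap l i (off-large l
      (ℕₚ.≤-trans (ℕₚ.≤-reflexive (sym (n+1≡ (2 ℕ.* h)))) (ℕₚ.+-monoˡ-≤ 1 (ℕₚ.*-monoʳ-≤ 2 (subst (ℕ._≤ l) (half-k-1 h) l≥)))) l≤k)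

  v-prime-gap-0 : ∀ k → Prime k → 2 ℕ.< k → ∀ i → (k ℕ.+ 3) ℕ./ 2 ℕ.≤ i → i ℕ.≤ k → v i ≡ + 0 [mod k ]
  v-prime-gap-0 k k-prime 2<k i i≥ i≤k with odd-prime k-prime 2<k
  ... | h , refl = Mod.≋⇒mod k (v-gap-0 h k-prime 2<k i i≥ i≤k)

  v-prime-gap : ∀ k → Prime k → 2 ℕ.< k → ∀ l i → (k ℕ.∸ 1) ℕ./ 2 ℕ.≤ l → l ℕ.≤ k →
    (k ℕ.+ 3) ℕ./ 2 ℕ.≤ i → i ℕ.≤ k → v (l ℕ.* k ℕ.+ i) ≡ + 0 [mod k ]
  v-prime-gap k k-prime 2<k l i l≥ l≤k i≥ i≤k with odd-prime k-prime 2<k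
  ... | h , refl = Mod.≋⇒mod k (v-gap-large h k-prime 2<k l i l≥ l≤k i≥ i≤k)

  v-2^-table : ∀ q → 1 ℕ.≤ q →
    (∀ l i → 1 ℕ.≤ i → i ℕ.≤ 2 ℕ.^ q → v (l ℕ.* 2 ℕ.^ q ℕ.+ i) ≡ v i [mod 2 ℕ.^ q ])
    × (∀ a → ¬ (+ 2 ∣ a) → Σ ℕ λ i → Σ ℕ λ j → 1 ℕ.≤ i × i ℕ.< j × j ℕ.≤ 2 ℕ.^ q
         × v i ≡ a [mod 2 ℕ.^ q ] × v j ≡ a [mod 2 ℕ.^ q ]
         × (∀ m → 1 ℕ.≤ m → m ℕ.≤ 2 ℕ.^ q → v m ≡ a [mod 2 ℕ.^ q ] → m ≡ i ⊎ m ≡ j))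
  v-2^-table (suc q) _ = (λ { l (suc m) _ _ → ≋⇒mod (v-periodic q l m) }) , sorted
    where
    open Mod (2 ℕ.^ suc q)
    sorted : ∀ a → ¬ (+ 2 ∣ a) → Σ ℕ λ i → Σ ℕ λ j → 1 ℕ.≤ i × i ℕ.< j × j ℕ.≤ 2 ℕ.^ suc q
         × v i ≡ a [mod 2 ℕ.^ suc q ] × v j ≡ a [mod 2 ℕ.^ suc q ]
         × (∀ m → 1 ℕ.≤ m → m ℕ.≤ 2 ℕ.^ suc q → v m ≡ a [mod 2 ℕ.^ suc q ] → m ≡ i ⊎ m ≡ j)
    sorted a ¬2∣a with two-indices q (¬2∣⇒odd ¬2∣a)
    ... | t with ℕₚ.<-cmp (TwoIndices.i t) (TwoIndices.j t)
    ... | tri< i<j _ _ = i , j , 1≤i , i<j , j≤2^q , ≋⇒mod vi≋a , ≋⇒mod vj≋a , λ m p r s → only m p r (mod⇒≋ s)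
      where open TwoIndices t
    ... | tri≈ _ i≡j _ = ⊥-elim (TwoIndices.i≢j t i≡j)
    ... | tri> _ _ j<i = j , i , 1≤j , j<i , i≤2^q , ≋⇒mod vj≋a , ≋⇒mod vi≋a , λ m p r s → swap (only m p r (mod⇒≋ s))
      where open TwoIndices t

  v-2^-shift : ∀ q a → 2 ℕ.≤ q → 1 ℕ.≤ a → v (a ℕ.+ 2 ℕ.^ (q ℕ.∸ 1)) ≡ v a + + (2 ℕ.^ (q ℕ.∸ 1)) [mod 2 ℕ.^ q ]
  v-2^-shift (suc (suc i)) (suc m) _ _ = Mod.≋⇒mod (2 ℕ.^ suc (suc i)) (v-shift-2^ i m)
  v-2^-shift (suc zero) _ (s≤s ()) _

  pos-∸1 : ∀ {n} → 0 ℕ.< n → + n - + 1 ≡ + (n ℕ.∸ 1)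
  pos-∸1 {n} 0<n = trans (ℤₚ.[+m]-[+n]≡m⊖n n 1) (ℤₚ.⊖-≥ 0<n)

  v-2^-values : ∀ q → 2 ℕ.≤ q →
    v 1 ≡ + 1 [mod 2 ℕ.^ q ] × v 2 ≡ + 1 [mod 2 ℕ.^ q ]
    × v (2 ℕ.^ (q ℕ.∸ 1)) ≡ + (2 ℕ.^ (q ℕ.∸ 1) ℕ.∸ 1) [mod 2 ℕ.^ q ]
    × v (2 ℕ.^ (q ℕ.∸ 1) ℕ.+ 1) ≡ + (2 ℕ.^ (q ℕ.∸ 1) ℕ.+ 1) [mod 2 ℕ.^ q ]
    × v (2 ℕ.^ (q ℕ.∸ 1) ℕ.+ 2) ≡ + (2 ℕ.^ (q ℕ.∸ 1) ℕ.+ 1) [mod 2 ℕ.^ q ]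
    × v (2 ℕ.^ q) ≡ + (2 ℕ.^ q ℕ.∸ 1) [mod 2 ℕ.^ q ]
  v-2^-values (suc zero) (s≤s ())
  v-2^-values (suc (suc i)) _ =
    ≋⇒mod {v 1} {+ 1} ≋-refl , ≋⇒mod {v 2} {+ 1} ≋-refl
    , ≋⇒mod (≋-trans (v-2^ i) (≡⇒≋ (pos-∸1 (0<2^ (suc i)))))
    , ≋⇒mod (≋-trans (≡⇒≋ (cong v (ℕₚ.+-comm h 1))) (≋-trans (v-shift-2^ i 0) 1+h))
    , ≋⇒mod (≋-trans (≡⇒≋ (cong v (ℕₚ.+-comm h 2))) (≋-trans (v-shift-2^ i 1) 1+h))
    -- The half-period value one level up holds modulo 2^(q+1) and is reduced to 2^q.
    , ≋⇒mod (≋-trans (≋-coarsen 2 refl (v-2^ (suc i))) (≡⇒≋ (pos-∸1 (0<2^ (suc (suc i))))))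
    where
    h = 2 ℕ.^ suc i
    open Mod (2 ℕ.* h)
    1+h : + 1 + + h ≋ + (h ℕ.+ 1)
    1+h = ≡⇒≋ (cong +_ (ℕₚ.+-comm 1 h))

open import Data.Nat using (ℕ; _+_; _*_; _∸_; _^_; _≤_; _<_)
open import Data.Nat.DivMod using (_/_)
open import Data.Nat.Primality using (Prime)
open import Data.Integer as ℤ using (ℤ; +_; -_)
open import Data.Integer.Divisibility using (_∣_)
open import Data.Product using (_×_; Σ)
open import Data.Sum using (_⊎_)
open import Relation.Nullary using (¬_)
open import Relation.Binary.PropositionalEquality using (_≡_)

theorem1 :
      -- 1. v_n is odd for n ≥ 1
      ((n : ℕ) → 1 ≤ n → ¬ ((+ 2) ∣ v n))
      -- 2. k ≥ 1, l ≥ 0 : v_{lk+1} ≡ v_{lk+2} (mod k)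
    × ((k l : ℕ) → 1 ≤ k → v (l * k + 1) ≡ v (l * k + 2) [mod k ])
      -- 3. even k = 2h ≥ 2 : v_{lk+k/2+1} ≡ v_{lk+k/2+2} (mod k)
    × ((h l : ℕ) → 1 ≤ h →
         v (l * (2 * h) + h + 1) ≡ v (l * (2 * h) + h + 2) [mod 2 * h ])
      -- 4. odd k = 2h+1 ≥ 3 : v_{lk+(k+3)/2} ≡ 0 (mod k), where (k+3)/2 = h+2
    × ((h l : ℕ) → 1 ≤ h →
         v (l * (2 * h + 1) + (h + 2)) ≡ + 0 [mod 2 * h + 1 ])
      -- 5. prime k
    × ((k : ℕ) → Prime k →
         (v 1 ≡ + 1 [mod k ] × v 2 ≡ + 1 [mod k ]
          × v (k + 1) ≡ + 1 [mod k ] × v (k + 2) ≡ + 1 [mod k ])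
       × ((l : ℕ) → 2 ≤ l → l ≤ k + 1 →
            v (l * k + 1) ≡ - (+ 1) [mod k ] × v (l * k + 2) ≡ - (+ 1) [mod k ]))
      -- 6. prime k > 2 : v_i ≡ 0 (mod k) for (k+3)/2 ≤ i ≤ k
    × ((k : ℕ) → Prime k → 2 < k → (i : ℕ) → (k + 3) / 2 ≤ i → i ≤ k →
         v i ≡ + 0 [mod k ])
      -- 7. prime k > 2 : v_{lk+i} ≡ 0 (mod k) for (k-1)/2 ≤ l ≤ k, (k+3)/2 ≤ i ≤ k
    × ((k : ℕ) → Prime k → 2 < k → (l i : ℕ) → (k ∸ 1) / 2 ≤ l → l ≤ k →
         (k + 3) / 2 ≤ i → i ≤ k → v (l * k + i) ≡ + 0 [mod k ])
      -- 8. q ≥ 1, k = 2^q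
    × ((q : ℕ) → 1 ≤ q →
         ((l i : ℕ) → 1 ≤ i → i ≤ 2 ^ q → v (l * 2 ^ q + i) ≡ v i [mod 2 ^ q ])
       × ((a : ℤ) → ¬ ((+ 2) ∣ a) →
            Σ ℕ λ i → Σ ℕ λ j → 1 ≤ i × i < j × j ≤ 2 ^ q
              × v i ≡ a [mod 2 ^ q ] × v j ≡ a [mod 2 ^ q ]
              × ((m : ℕ) → 1 ≤ m → m ≤ 2 ^ q → v m ≡ a [mod 2 ^ q ] →
                   m ≡ i ⊎ m ≡ j)))
      -- 9. q ≥ 2
    × ((q : ℕ) → 2 ≤ q →
         v 1 ≡ + 1 [mod 2 ^ q ] × v 2 ≡ + 1 [mod 2 ^ q ]
       × v (2 ^ (q ∸ 1)) ≡ + (2 ^ (q ∸ 1) ∸ 1) [mod 2 ^ q ]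
       × v (2 ^ (q ∸ 1) + 1) ≡ + (2 ^ (q ∸ 1) + 1) [mod 2 ^ q ]
       × v (2 ^ (q ∸ 1) + 2) ≡ + (2 ^ (q ∸ 1) + 1) [mod 2 ^ q ]
       × v (2 ^ q) ≡ + (2 ^ q ∸ 1) [mod 2 ^ q ])
      -- 10. q ≥ 2, 1 ≤ a ≤ 2^{q-1}
    × ((q a : ℕ) → 2 ≤ q → 1 ≤ a → a ≤ 2 ^ (q ∸ 1) →
         v (a + 2 ^ (q ∸ 1)) ≡ v a ℤ.+ + (2 ^ (q ∸ 1)) [mod 2 ^ q ])
theorem1 =
    v-not-even
  , (λ k l _ → v-after-multiple k l)
  , (λ h l _ → v-after-half-multiple h l)
  , (λ h l _ → v-middle h l)
  , v-prime
  , v-prime-gap-0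
  , v-prime-gap
  , v-2^-table
  , v-2^-values
  , (λ q a 2≤q 1≤a _ → v-2^-shift q a 2≤q 1≤a)
  where open LineNumbers using (v-not-even; v-after-multiple; v-after-half-multiple; v-middle; v-prime;
          v-prime-gap-0; v-prime-gap; v-2^-table; v-2^-values; v-2^-shift)
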